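{- Fix $\ell\ge1$ and a word $w\in\{+,-\}^{2\ell}$. Let $T_w(q)$ be the generating function of pure steep tilings of the oblique strip of width $2\ell$ with asymptotic data $w$ (considered up to translation by integer multiples of $(1,1)$), where the exponent of $q$ is the minimal number of flips needed to obtain the tiling from the minimal tiling $T^w_{\min}$. Then $$T_w(q)=\prod_{\substack{i<j\\ w_i=+,\ w_j=-\\ j-i\text{ odd}}}\left(1+q^{j-i}\right)\prod_{\substack{i<j\\ w_i=+,\ w_j=-\\ j-i\text{ even}}}\frac{1}{1-q^{j-i}}.$$
   Context: A domino is a closed $2\times1$ or $1\times2$ rectangle with integer corners. A tiling of the oblique strip of width $2\ell$ is a set of dominos with disjoint interiors whose union $R$ satisfies $\{|x-y-\ell|\le\ell-1\}\subseteq R\subseteq\{|x-y-\ell|\le\ell+1\}$. A horizontal (resp. vertical) domino is north-going (resp. east-going) if the sum of the coordinates of its top left corner is odd, and south-going (resp. west-going) otherwise. The tiling is steep if for some $B$ all dominos in $\{x+y>B\}$ are north- or east-going and all dominos in $\{x+y<-B\}$ are south- or west-going. Its asymptotic data is the word $w\in\{+,-\}^{2\ell}$ such that for each $k\in\{1,\dots,\ell\}$: for all large enough $x$ the unit square with bottom right corner $(x,x-2k)$ is covered by a north-going domino if $w_{2k-1}=+$ and an east-going one if $w_{2k-1}=-$; for all negative enough $x$ the unit square with top left corner $(x,x-2k+2)$ is covered by a west-going domino if $w_{2k}=+$ and a south-going one if $w_{2k}=-$ (this word exists and is unique). The tiling is pure if there are half-integers $a,b$ such that, for $x\in\mathbb{Z}+\frac12$,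 the unit square centered at $(x,x)$ is covered iff $x\ge a$, and the unit square centered at $(x,x-2\ell)$ is covered iff $x\le b$. A flip replaces two horizontal dominos forming a $2\times2$ square by two vertical dominos, or vice versa; it is centered on the $k$-th diagonal if the center of the square lies on $y=x-k$. Particle configuration: a site is a point $(x,y)\in(\mathbb{Z}+\frac12)^2$ with $0\le x-y\le2\ell$; it is occupied if covered by a south- or west-going domino or if it is uncovered and lies on $y=x$, and empty if covered by a north- or east-going domino or if it is uncovered and lies on $y=x-2\ell$. Define integers $c_0=0$, $c_{2k-1}=c_{2k-2}+1$ if $w_{2k-1}=+$ and $c_{2k-1}=c_{2k-2}$ otherwise, $c_{2k}=c_{2k-1}$ if $w_{2k}=+$ and $c_{2k}=c_{2k-1}+1$ otherwise. The minimal tiling $T^w_{\min}$ is the steep tiling with asymptotic data $w$ in which, for every $m\in\{0,\dots,2\ell\}$ and $x\in\mathbb{Z}+\frac12$, the site $(x,x-m)$ is occupied iff $x<c_m$; it is pure. -}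

module Defs where

open import Data.Bool using (Bool; true; false; _∧_; _∨_; not; if_then_else_)
open import Data.Nat as ℕ using (ℕ; zero; suc; _≡ᵇ_; _%_)
open import Data.Nat.Divisibility using (_∣?_)
open import Data.Integer as ℤ using (ℤ; +_; _-_; _≤_; _<_; ∣_∣)
import Data.Integer.Properties as ℤP
open import Data.List using (List; []; _∷_; _++_; foldr; map; upTo)
open import Data.Nat.ListAction using (sum)
open import Data.Product using (Σ; ∃; _×_; _,_)
open import Data.Sum using (_⊎_)
open import Data.Empty using (⊥)
open import Relation.Nullary using (¬_)
open import Relation.Nullary.Decidable using (⌊_⌋)
open import Relation.Binary.PropositionalEquality using (_≡_)
open import Function.Bundles using (_⇔_)

data Sign : Set where
  plus minus : Sign

-- Dominos.  A domino is given by its orientation and the integer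
-- coordinates (x , y) of its bottom-left corner:
--   hor x y = [x , x+2] × [y , y+1]   (a 2×1 rectangle)
--   ver x y = [x , x+1] × [y , y+2]   (a 1×2 rectangle)
-- Unit squares are named by their bottom-left corner (a , b), i.e. the
-- square [a , a+1] × [b , b+1], whose center is (a+1/2 , b+1/2).

data Orient : Set where
  hor ver : Orient

-- A tiling (a set of dominos), as its characteristic function.
Tiling : Set
Tiling = Orient → ℤ → ℤ → Bool

Covers : Orient → ℤ → ℤ → ℤ → ℤ → Set
Covers hor x y a b = (a ≡ x ⊎ a ≡ x ℤ.+ + 1) × b ≡ y
Covers ver x y a b = a ≡ x × (b ≡ y ⊎ b ≡ y ℤ.+ + 1)

evenℤ : ℤ → Bool
evenℤ z = (∣ z ∣ % 2) ≡ᵇ 0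

data Dir : Set where
  N S E W : Dir

-- top-left corner of  hor x y  is (x , y+1): north-going iff x+y+1 odd iff x+y even;
-- top-left corner of  ver x y  is (x , y+2): east-going  iff x+y+2 odd iff x+y odd.
dir : Orient → ℤ → ℤ → Dir
dir hor x y = if evenℤ (x ℤ.+ y) then N else S
dir ver x y = if evenℤ (x ℤ.+ y) then W else E

Covered : Tiling → ℤ → ℤ → Set
Covered T a b = ∃ λ o → ∃ λ x → ∃ λ y → T o x y ≡ true × Covers o x y a b

CoveredBy : Tiling → ℤ → ℤ → Dir → Set
CoveredBy T a b δ =
  ∃ λ o → ∃ λ x → ∃ λ y → T o x y ≡ true × Covers o x y a b × dir o x y ≡ δ

DisjointInteriors : Tiling → Set
DisjointInteriors T = ∀ o x y o' x' y' a b →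
  T o x y ≡ true → T o' x' y' ≡ true →
  Covers o x y a b → Covers o' x' y' a b →
  (o ≡ o' × x ≡ x' × y ≡ y')

-- Tiling of the oblique strip of width 2ℓ:
--   {|x-y-ℓ| ≤ ℓ-1} ⊆ R ⊆ {|x-y-ℓ| ≤ ℓ+1},  R = union of the dominos.
-- Since R is a union of closed unit squares this says exactly: every unit
-- square (a , b) with 1 ≤ a-b ≤ 2ℓ-1 is covered, and every covered unit
-- square satisfies 0 ≤ a-b ≤ 2ℓ.
IsStripTiling : ℕ → Tiling → Set
IsStripTiling ℓ T =
  DisjointInteriors T ×
  (∀ a b → + 1 ≤ a - b → a - b ≤ + (2 ℕ.* ℓ) ℤ.- + 1 → Covered T a b) ×
  (∀ a b → Covered T a b → (+ 0 ≤ a - b × a - b ≤ + (2 ℕ.* ℓ)))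

-- Steep: for some B, dominos contained in {x+y > B} are north/east-going,
-- dominos contained in {x+y < -B} are south/west-going.  (The corners of
-- the domino  o x y  have coordinate sums ranging over [x+y , x+y+3].)
Steep : Tiling → Set
Steep T = ∃ λ (B : ℤ) → ∀ o x y → T o x y ≡ true →
  (B < x ℤ.+ y → (dir o x y ≡ N ⊎ dir o x y ≡ E)) ×
  (x ℤ.+ y ℤ.+ + 3 < ℤ.- B → (dir o x y ≡ S ⊎ dir o x y ≡ W))

nth : List Sign → ℕ → Sign → Set
nth [] _ s = ⊥
nth (t ∷ ts) zero s = t ≡ s
nth (t ∷ ts) (suc i) s = nth ts i s

-- Asymptotic data w (w given 0-based, so the paper's w_{2k-1}, w_{2k}
-- are  nth w (2(k-1))  and  nth w (2(k-1)+1);  here  k' = k-1 < ℓ).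
--  * the square with bottom right corner (x , x-2k), i.e. bottom-left
--    corner (x-1 , x-2k), is eventually (x → +∞) covered by a north-going
--    domino if w_{2k-1} = + and an east-going one if w_{2k-1} = -;
--  * the square with top left corner (x , x-2k+2), i.e. bottom-left corner
--    (x , x-2k+1), is eventually (x → -∞) covered by a west-going domino
--    if w_{2k} = + and a south-going one if w_{2k} = -.
dirOf+ : Sign → Dir
dirOf+ plus = N
dirOf+ minus = E

dirOf- : Sign → Dir
dirOf- plus = W
dirOf- minus = S

HasAsymptoticData : ℕ → List Sign → Tiling → Set
HasAsymptoticData ℓ w T = ∀ k' → k' ℕ.< ℓ →
  (∀ s → nth w (2 ℕ.* k') s →
     ∃ λ X → ∀ x → X ≤ x →
       CoveredBy T (x - + 1) (x - + (2 ℕ.* suc k')) (dirOf+ s)) ×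
  (∀ s → nth w (suc (2 ℕ.* k')) s →
     ∃ λ X → ∀ x → x ≤ X →
       CoveredBy T x (x - + (2 ℕ.* suc k') ℤ.+ + 1) (dirOf- s))

-- Pure: there are half-integers a = A + 1/2, b = B + 1/2 such that the
-- square centered at (n+1/2 , n+1/2) is covered iff n+1/2 ≥ a, i.e. n ≥ A,
-- and the square centered at (n+1/2 , n+1/2-2ℓ) is covered iff n ≤ B.
Pure : ℕ → Tiling → Set
Pure ℓ T = ∃ λ A → ∃ λ B → ∀ n →
  (Covered T n n ⇔ A ≤ n) × (Covered T n (n - + (2 ℕ.* ℓ)) ⇔ n ≤ B)

Good : ℕ → List Sign → Tiling → Set
Good ℓ w T = IsStripTiling ℓ T × Steep T × HasAsymptoticData ℓ w T × Pure ℓ T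

-- The site (n+1/2 , n+1/2-m) (square with bottom-left corner (n , n-m)),
-- 0 ≤ m ≤ 2ℓ, is occupied: covered by a south- or west-going domino, or
-- uncovered and on the diagonal y = x (m = 0).
Occupied : Tiling → ℤ → ℕ → Set
Occupied T n m =
  CoveredBy T n (n - + m) S ⊎ CoveredBy T n (n - + m) W ⊎
  (m ≡ 0 × ¬ Covered T n (n - + m))

-- c_m :  c' odd? w m  with the first letter at an odd position (1-based)
incr : Bool → Sign → ℕ
incr true plus = 1
incr true minus = 0
incr false plus = 0
incr false minus = 1

c' : Bool → List Sign → ℕ → ℕ
c' _ _ zero = 0
c' _ [] (suc m) = 0
c' odd (s ∷ ws) (suc m) = incr odd s ℕ.+ c' (not odd) ws m

c : List Sign → ℕ → ℕ
c w m = c' true w m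

-- T is the minimal tiling T^w_min: a steep tiling with asymptotic data w
-- whose site (x , x-m), x = n+1/2, is occupied iff x < c_m, i.e. n < c_m.
IsMinTiling : ℕ → List Sign → Tiling → Set
IsMinTiling ℓ w T =
  IsStripTiling ℓ T × Steep T × HasAsymptoticData ℓ w T ×
  (∀ m → m ℕ.≤ 2 ℕ.* ℓ → ∀ n → (Occupied T n m ⇔ n < + c w m))

isDom : Orient → ℤ → ℤ → Orient → ℤ → ℤ → Bool
isDom hor x y hor x' y' = ⌊ x ℤ.≟ x' ⌋ ∧ ⌊ y ℤ.≟ y' ⌋
isDom ver x y ver x' y' = ⌊ x ℤ.≟ x' ⌋ ∧ ⌊ y ℤ.≟ y' ⌋
isDom _ _ _ _ _ _ = false

Replace : (Orient → ℤ → ℤ → Bool) → (Orient → ℤ → ℤ → Bool) → Tiling → Tiling → Set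
Replace rem add T T' =
  ∀ o x y → T' o x y ≡ ((T o x y ∧ not (rem o x y)) ∨ add o x y)

horPair verPair : ℤ → ℤ → Orient → ℤ → ℤ → Bool
horPair a b o x y = isDom hor a b o x y ∨ isDom hor a (b ℤ.+ + 1) o x y
verPair a b o x y = isDom ver a b o x y ∨ isDom ver (a ℤ.+ + 1) b o x y

Flip : Tiling → Tiling → Set
Flip T T' = ∃ λ a → ∃ λ b →
  (T hor a b ≡ true × T hor a (b ℤ.+ + 1) ≡ true ×
     Replace (horPair a b) (verPair a b) T T') ⊎
  (T ver a b ≡ true × T ver (a ℤ.+ + 1) b ≡ true ×
     Replace (verPair a b) (horPair a b) T T')

Reach : Tiling → Tiling → ℕ → Set
Reach T T' zero = ∀ o x y → T o x y ≡ T' o x y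
Reach T T' (suc n) = ∃ λ T'' → Flip T T'' × Reach T'' T' n

shift : ℤ → Tiling → Tiling
shift k T o x y = T o (x - k) (y - k)

_∼_ : Tiling → Tiling → Set
T ∼ T' = ∃ λ k → ∀ o x y → T' o x y ≡ shift k T o x y

ReachUpTo : Tiling → Tiling → ℕ → Set
ReachUpTo T₀ T n = ∃ λ k → Reach T₀ (shift k T) n

ClassDist : Tiling → Tiling → ℕ → Set
ClassDist T₀ T n = ReachUpTo T₀ T n × (∀ m → m ℕ.< n → ¬ ReachUpTo T₀ T m)

Series : Set
Series = ℕ → ℕ

one : Series
one zero = 1
one (suc _) = 0

_⋆_ : Series → Series → Series
(f ⋆ g) n = sum (map (λ k → f k ℕ.* g (n ℕ.∸ k)) (upTo (suc n)))

onePlus : ℕ → Series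
onePlus d n = (if n ≡ᵇ 0 then 1 else 0) ℕ.+ (if n ≡ᵇ d then 1 else 0)

-- 1/(1 - q^d) = Σ_{r ≥ 0} q^{rd}   (d ≥ 1)
geom : ℕ → Series
geom d n = if ⌊ d ∣? n ⌋ then 1 else 0

oddℕ : ℕ → Bool
oddℕ d = (d % 2) ≡ᵇ 1

factor : ℕ → Series
factor d = if oddℕ d then onePlus d else geom d

distsFrom : List Sign → ℕ → List ℕ
distsFrom [] d = []
distsFrom (plus ∷ ws) d = distsFrom ws (suc d)
distsFrom (minus ∷ ws) d = d ∷ distsFrom ws (suc d)

pairDists : List Sign → List ℕ
pairDists [] = []
pairDists (plus ∷ ws) = distsFrom ws 1 ++ pairDists ws
pairDists (minus ∷ ws) = pairDists ws

productFormula : List Sign → Series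
productFormula w = foldr (λ d acc → factor d ⋆ acc) one (pairDists w)

module Submission where

-- Read along the diagonals x - y = m, a tiling is a sequence of particle
-- configurations; every domino joins two neighbouring diagonals and makes a hole
-- (m even) or a particle (m odd) hop by 0 or 1.  Hence pure steep tilings are
-- sequences ∅ = λ⁰ , λ¹ , … , λ²ˡ = ∅ of partitions in which the m-th step adds
-- (letter +) or removes (letter -) a horizontal or vertical strip, according to
-- the parity of m.  A flip adds or removes one box of one λᵐ.  As long as some
-- λᵐ is nonempty one of its boxes can be removed, so the distance from the
-- minimal tiling is Σ |λᵐ|.  Local rules of RSK type, |n| + |k| = |p| + |q| + r,
-- commute a letter + with a following letter - at the cost of a number r, which
-- is arbitrary for strips of equal type and at most 1 otherwise.  Moving all
-- letters + to the right leaves the constant sequence ∅ together with one number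
-- r for each pair i < j with letters + and -, which contributes r (j - i) to the sum.

open import Defs
open import Data.Bool using (Bool; true; false; not; _xor_; if_then_else_; _∧_; _∨_; T)
open import Data.Nat using (ℕ; zero; suc; _+_; _*_; _∸_; _⊔_; _⊓_; _≤_; _<_; z≤n; s≤s; _<?_; _≤?_; _≡ᵇ_)
open import Data.Nat.Properties
open import Data.Nat.DivMod using ([m+n]%n≡m%n)
open import Data.Nat.Divisibility using (_∣?_; divides; quotient)
open import Data.Nat.ListAction using (sum)
import Data.Nat.Tactic.RingSolver as ℕS
open import Data.Integer as ℤ using (ℤ; +_; -[1+_]; ∣_∣)
import Data.Integer.Properties as ℤP
import Data.Integer.Tactic.RingSolver as ℤS
open import Data.Fin using (Fin; zero; suc; splitAt; join; remQuot; combine; _↑ˡ_; _↑ʳ_)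
import Data.Fin.Properties as Fin
open import Data.List using (List; []; _∷_; length; map; foldr; applyUpTo)
open import Data.List.Relation.Unary.All using (All; []; _∷_)
open import Data.List.Relation.Unary.All.Properties using (++⁺; ++⁻; ++↔)
open import Data.Product using (Σ; ∃; _×_; _,_; proj₁; proj₂; uncurry)
open import Data.Sum as Sum using (_⊎_; inj₁; inj₂; [_,_]′)
open import Data.Empty using (⊥; ⊥-elim)
open import Data.Unit using (⊤; tt)
open import Relation.Nullary using (¬_; Dec; yes; no)
open import Relation.Nullary.Decidable using (⌊_⌋)
open import Relation.Binary.Definitions using (tri<; tri≈; tri>)
open import Relation.Binary.PropositionalEquality
open import Function using (_∘_; id)
open import Function.Bundles using (_⇔_; mk⇔; module Equivalence; module Inverse)

-- Conjugating a partition exchanges holes with particles and horizontal with vertical strips. A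
-- partition is therefore stored with both its rows and its columns: conjugation swaps two fields,
-- and one Boolean covers both kinds of diagonals. The type of the strip alternates along the word,
-- so letters at odd distance carry strips of different types; this is the source of the two kinds
-- of factors. A letter + pushed to the end of the word is trivial because the last partition is
-- empty. Since partitions are compared row by row, the passage to the numbers r is a relation built
-- from local rules, with existence and uniqueness in both directions in place of a pair of inverse
-- functions. Translations are controlled by the charge, the first covered site of diagonal 0: flips
-- preserve it, so exactly one translate of a tiling can be reached from the minimal one. For the
-- lower bound on the distance it is enough that a flip raises the total size by at most one; the
-- upper bound needs a box whose removal respects both neighbouring strips.

-- Finite sums

Σ< : ℕ → (ℕ → ℕ) → ℕ
Σ< zero f = 0
Σ< (suc k) f = Σ< k f + f k

Σ<-cong : ∀ k {f g : ℕ → ℕ} → (∀ i → i < k → f i ≡ g i) → Σ< k f ≡ Σ< k g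
Σ<-cong zero h = refl
Σ<-cong (suc k) h = cong₂ _+_ (Σ<-cong k λ i i<k → h i (m<n⇒m<1+n i<k)) (h k ≤-refl)

Σ<-+ : ∀ k (f g : ℕ → ℕ) → Σ< k (λ i → f i + g i) ≡ Σ< k f + Σ< k g
Σ<-+ zero f g = refl
Σ<-+ (suc k) f g rewrite Σ<-+ k f g = four (Σ< k f) (Σ< k g) (f k) (g k)
  where
  four : ∀ a b c d → a + b + (c + d) ≡ a + c + (b + d)
  four = ℕS.solve-∀

Σ<-shift : ∀ k (f : ℕ → ℕ) → Σ< (suc k) f ≡ f 0 + Σ< k (f ∘ suc)
Σ<-shift zero f = +-comm 0 (f 0)
Σ<-shift (suc k) f rewrite Σ<-shift k f = +-assoc (f 0) _ _

Σ<-swap : ∀ k l (f : ℕ → ℕ → ℕ) → Σ< k (λ i → Σ< l (f i)) ≡ Σ< l (λ j → Σ< k (λ i → f i j))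
Σ<-swap zero zero f = refl
Σ<-swap zero (suc l) f = trans (Σ<-swap zero l f) (sym (+-identityʳ _))
Σ<-swap (suc k) l f =
  trans (cong (_+ Σ< l (f k)) (Σ<-swap k l f)) (sym (Σ<-+ l (λ j → Σ< k (λ i → f i j)) (f k)))

Σ<-tail0 : ∀ {k l} (f : ℕ → ℕ) → k ≤ l → (∀ i → k ≤ i → f i ≡ 0) → Σ< l f ≡ Σ< k f
Σ<-tail0 {k} {l} f k≤l z = subst (λ t → Σ< t f ≡ Σ< k f) (m∸n+n≡m k≤l) (go (l ∸ k))
  where
  go : ∀ d → Σ< (d + k) f ≡ Σ< k f
  go zero = refl
  go (suc d) = trans (cong₂ _+_ (go d) (z (d + k) (m≤n+m k d))) (+-identityʳ _)

-- Partitions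

-- row and col are conjugate: the box (i , j) is present iff j < row i iff i < col j.
record Part : Set where
  field
    row col : ℕ → ℕ
    r→c : ∀ {i j} → j < row i → i < col j
    c→r : ∀ {i j} → i < col j → j < row i
open Part public

dual : Part → Part
dual p = record { row = col p ; col = row p ; r→c = c→r p ; c→r = r→c p }

infix 4 _≈_
-- Propositional equality of partitions would require function extensionality, so everything is
-- stated up to equal rows; columns then agree by `≈-dual`.
_≈_ : Part → Part → Set
p ≈ q = ∀ i → row p i ≡ row q i

≈-refl : ∀ {p} → p ≈ p
≈-refl i = refl

≈-sym : ∀ {p q} → p ≈ q → q ≈ p
≈-sym h i = sym (h i)

≈-trans : ∀ {p q r} → p ≈ q → q ≈ r → p ≈ r
≈-trans h k i = trans (h i) (k i)

≤-fromGalois : ∀ {m n} → (∀ j → j < m → j < n) → m ≤ n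
≤-fromGalois {m} {n} h with m ≤? n
... | yes m≤n = m≤n
... | no m≰n = ⊥-elim (<-irrefl refl (h n (≰⇒> m≰n)))

≈-dual : ∀ {p q} → p ≈ q → dual p ≈ dual q
≈-dual {p} {q} h j = ≤-antisym
  (≤-fromGalois λ i x → r→c q (subst (j <_) (h i) (c→r p x)))
  (≤-fromGalois λ i x → r→c p (subst (j <_) (sym (h i)) (c→r q x)))

row-anti : ∀ p {i i'} → i ≤ i' → row p i' ≤ row p i
row-anti p i≤i' = ≤-fromGalois λ j x → c→r p (≤-<-trans i≤i' (r→c p x))

row-zero : ∀ p {i} → col p 0 ≤ i → row p i ≡ 0
row-zero p {i} h = n≤0⇒n≡0 (≤-fromGalois λ j x →
  ⊥-elim (<-irrefl refl (<-≤-trans (r→c p (≤-<-trans z≤n x)) h)))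

∅ : Part
∅ = record { row = λ _ → 0 ; col = λ _ → 0 ; r→c = λ () ; c→r = λ () }

IsEmpty : Part → Set
IsEmpty p = p ≈ ∅

empty-from-first : ∀ p → row p 0 ≡ 0 → IsEmpty p
empty-from-first p h i = n≤0⇒n≡0 (≤-trans (row-anti p z≤n) (≤-reflexive h))

dual-empty : ∀ {p} → IsEmpty p → IsEmpty (dual p)
dual-empty {p} h = ≈-dual {p} {∅} h

module _ (f : ℕ → ℕ) (anti : ∀ i → f (suc i) ≤ f i) where
  private
    anti0 : ∀ i → f i ≤ f 0
    anti0 zero = ≤-refl
    anti0 (suc i) = ≤-trans (anti i) (anti0 i)

  -- For an antitone `f` the indices with `j < f i` form an initial segment, whose length is found
  -- by scanning down from the bound `k`. This supplies the columns of a partition given by its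
  -- rows.
  lead : ℕ → ℕ → ℕ
  lead j zero = 0
  lead j (suc k) with j <? f k
  ... | yes _ = suc k
  ... | no _ = lead j k

  anti≤ : ∀ {i k} → i ≤ k → f k ≤ f i
  anti≤ {i} {k} i≤k = subst (λ t → f t ≤ f i) (m∸n+n≡m i≤k) (go (k ∸ i))
    where
    go : ∀ d → f (d + i) ≤ f i
    go zero = ≤-refl
    go (suc d) = ≤-trans (anti (d + i)) (go d)

  lead-sound : ∀ j k i → i < lead j k → j < f i
  lead-sound j (suc k) i x with j <? f k
  ... | yes j<fk = <-≤-trans j<fk (anti≤ (≤-pred x))
  ... | no _ = lead-sound j k i x

  lead-complete : ∀ j k i → f k ≡ 0 → j < f i → i < lead j k
  lead-complete j k i fk x = go k i<k
    where
    i<k : i < k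
    i<k = ≰⇒> λ k≤i → n≮0 (<-≤-trans x (≤-trans (anti≤ k≤i) (≤-reflexive fk)))
    go : ∀ k → i < k → i < lead j k
    go (suc k) i<sk with j <? f k
    ... | yes _ = i<sk
    ... | no j≮ = go k (≤∧≢⇒< (≤-pred i<sk) λ { refl → j≮ x })

  mkPart : ∀ k → f k ≡ 0 → Part
  mkPart k fk = record
    { row = f ; col = λ j → lead j k
    ; r→c = λ {i} {j} → lead-complete j k i fk
    ; c→r = λ {i} {j} → lead-sound j k i }

size : Part → ℕ
size p = Σ< (col p 0) (row p)

size-rows : ∀ p {k} → col p 0 ≤ k → Σ< k (row p) ≡ size p
size-rows p h = Σ<-tail0 (row p) h (λ i → row-zero p)

ind : ℕ → ℕ → ℕ
ind j zero = 0
ind zero (suc n) = 1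
ind (suc j) (suc n) = ind j n

ind< : ∀ {j n} → j < n → ind j n ≡ 1
ind< {zero} {suc n} h = refl
ind< {suc j} {suc n} h = ind< (≤-pred h)

ind≮ : ∀ {j n} → ¬ j < n → ind j n ≡ 0
ind≮ {j} {zero} h = refl
ind≮ {zero} {suc n} h = ⊥-elim (h (s≤s z≤n))
ind≮ {suc j} {suc n} h = ind≮ (h ∘ s≤s)

Σ<-ind : ∀ k n → n ≤ k → Σ< k (λ j → ind j n) ≡ n
Σ<-ind k zero h = Σ<-tail0 {0} {k} _ z≤n (λ i _ → refl)
Σ<-ind (suc k) (suc n) h = trans (Σ<-shift k (λ j → ind j (suc n))) (cong suc (Σ<-ind k n (≤-pred h)))

ind-galois : ∀ p i j → ind j (row p i) ≡ ind i (col p j)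
ind-galois p i j with j <? row p i
... | yes h = trans (ind< h) (sym (ind< (r→c p h)))
... | no h = trans (ind≮ h) (sym (ind≮ (h ∘ c→r p)))

-- Double counting of boxes: a row or column length is a sum of indicators, and `ind-galois` makes
-- the indicator symmetric.
size-dual : ∀ p → size (dual p) ≡ size p
size-dual p = begin
  Σ< R (col p)                        ≡⟨ Σ<-cong R (λ j _ → sym (Σ<-ind C (col p j) (row-anti (dual p) z≤n))) ⟩
  Σ< R (λ j → Σ< C (λ i → ind i (col p j))) ≡⟨ Σ<-swap R C _ ⟩
  Σ< C (λ i → Σ< R (λ j → ind i (col p j))) ≡⟨ Σ<-cong C (λ i _ → trans (Σ<-cong R (λ j _ → sym (ind-galois p i j))) (Σ<-ind R (row p i) (row-anti p z≤n))) ⟩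
  Σ< C (row p) ∎
  where
  open ≡-Reasoning
  R = row p 0
  C = col p 0

size-cong : ∀ {p q} → p ≈ q → size p ≡ size q
size-cong {p} {q} h = trans (Σ<-cong (col p 0) (λ i _ → h i)) (size-rows q (≤-reflexive (sym (≈-dual {p} {q} h 0))))

size-empty : ∀ {p} → IsEmpty p → size p ≡ 0
size-empty {p} h = size-cong {p} {∅} h

size≡0 : ∀ p → size p ≡ 0 → IsEmpty p
size≡0 p h = empty-from-first p (n≤0⇒n≡0 (≤-trans (lem (col p 0) refl) (≤-reflexive h)))
  where
  lem : ∀ k → col p 0 ≡ k → row p 0 ≤ Σ< k (row p)
  lem zero e = ≤-reflexive (row-zero p (≤-reflexive e))
  lem (suc k) e = ≤-trans (m≤m+n _ _) (≤-reflexive (sym (Σ<-shift k (row p))))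

-- V adds a vertical strip, hence Str true a horizontal one.

V : Part → Part → Set
V p q = ∀ i → row p i ≤ row q i × row q i ≤ suc (row p i)

orient : Bool → Part → Part
orient true p = dual p
orient false p = p

Str : Bool → Part → Part → Set
Str b p q = V (orient b p) (orient b q)

orient-cong : ∀ b {p q} → p ≈ q → orient b p ≈ orient b q
orient-cong true {p} {q} h = ≈-dual {p} {q} h
orient-cong false h = h

V-cong : ∀ {p p' q q'} → p ≈ p' → q ≈ q' → V p q → V p' q'
V-cong h k v i = subst₂ _≤_ (h i) (k i) (proj₁ (v i)) , subst₂ _≤_ (k i) (cong suc (h i)) (proj₂ (v i))

Str-cong : ∀ b {p p' q q'} → p ≈ p' → q ≈ q' → Str b p q → Str b p' q'
Str-cong b {p} {p'} {q} {q'} h k =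
  V-cong {orient b p} {orient b p'} {orient b q} {orient b q'} (orient-cong b {p} {p'} h) (orient-cong b {q} {q'} k)

V-refl : ∀ p → V p p
V-refl p i = ≤-refl , n≤1+n _

Str-refl : ∀ b p → Str b p p
Str-refl b p = V-refl (orient b p)

⊆-dual : ∀ p q → (∀ i → row p i ≤ row q i) → ∀ j → col p j ≤ col q j
⊆-dual p q h j = ≤-fromGalois λ i x → r→c q (<-≤-trans (c→r p x) (h i))

Str-⊆ : ∀ b {p q} → Str b p q → ∀ i → row p i ≤ row q i
Str-⊆ true {p} {q} v = ⊆-dual (dual p) (dual q) (λ i → proj₁ (v i))
Str-⊆ false v i = proj₁ (v i)

Str-empty : ∀ b {p q} → Str b p q → IsEmpty q → IsEmpty p
Str-empty b {p} {q} s h i = n≤0⇒n≡0 (≤-trans (Str-⊆ b {p} {q} s i) (≤-reflexive (h i)))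

-- No row grows by more than one, so a box of `q` in column `suc j` has its left neighbour in `p`.
-- This is the column form of the strip condition; `interlace⇒V` goes back.
interlace : ∀ {p q} → V p q → ∀ j → col q (suc j) ≤ col p j
interlace {p} {q} v j = ≤-fromGalois λ i x → r→c p (≤-pred (≤-trans (c→r q x) (proj₂ (v i))))

interlace⇒V : ∀ {p q} → (∀ j → col p j ≤ col q j) → (∀ j → col q (suc j) ≤ col p j) → V p q
interlace⇒V {p} {q} h k i = ⊆-dual (dual p) (dual q) h i ,
  ≤-fromGalois λ { zero _ → s≤s z≤n ; (suc j) x → s≤s (c→r p (<-≤-trans (r→c q x) (k j))) }

-- Local rules

-- Reversing the interval from `lo` to `hi` is an involution that keeps the sum of a point and its
-- image; the first makes the local rule reversible, the second controls sizes.
reflect : ∀ {lo hi x} → x ≤ hi → lo ≤ x → (lo ≤ lo + hi ∸ x) × (lo + hi ∸ x ≤ hi) × x + (lo + hi ∸ x) ≡ lo + hi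
reflect {lo} {hi} {x} x≤hi lo≤x =
  subst (lo ≤_) (sym (+-∸-assoc lo x≤hi)) (m≤m+n lo _) ,
  subst (lo + hi ∸ x ≤_) (m+n∸m≡n lo hi) (∸-monoʳ-≤ (lo + hi) lo≤x) ,
  m+[n∸m]≡n (≤-trans x≤hi (m≤n+m hi lo))

-- The local rule of the Robinson–Schensted–Knuth correspondence for four
-- partitions k ⊆ p , q ⊆ n around a cell, all of whose strips are horizontal.
record RSK (p q n k : Part) (r : ℕ) : Set where
  constructor rsk
  field
    first : row n 0 ≡ row p 0 ⊔ row q 0 + r
    next : ∀ i → row n (suc i) + row k i ≡ (row p (suc i) ⊔ row q (suc i)) + (row p i ⊓ row q i)

H-⊆ : ∀ {p q} → Str true p q → ∀ i → row p i ≤ row q i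
H-⊆ {p} {q} = Str-⊆ true {p} {q}

H-interlace : ∀ {p q} → Str true p q → ∀ i → row q (suc i) ≤ row p i
H-interlace {p} {q} = interlace {dual p} {dual q}

mkH : ∀ {p q} → (∀ i → row p i ≤ row q i) → (∀ i → row q (suc i) ≤ row p i) → Str true p q
mkH {p} {q} = interlace⇒V {dual p} {dual q}

-- Both strips being horizontal, row `suc i` of `n` lies between the larger of the rows `suc i` and
-- the smaller of the rows `i` of `p` and `q`; reflected in this interval it becomes row `i` of `k`.
-- Row 0 of `n` has no such upper bound: its excess is `r`, which is why `r` is arbitrary.
rsk-up : ∀ p q n → Str true p n → Str true q n → ∃ λ k → ∃ λ r → Str true k p × Str true k q × RSK p q n k r
rsk-up p q n sp sq = k , r ,
  mkH {k} {p} (λ i → ≤-trans (k≤ i) (m⊓n≤m _ _)) (λ i → ≤-trans (m≤m⊔n _ _) (k≥ i)) ,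
  mkH {k} {q} (λ i → ≤-trans (k≤ i) (m⊓n≤n _ _)) (λ i → ≤-trans (m≤n⊔m _ _) (k≥ i)) ,
  rsk (sym (m+[n∸m]≡n (⊔-lub (H-⊆ {p} {n} sp 0) (H-⊆ {q} {n} sq 0)))) (λ i → proj₂ (proj₂ (refl' i)))
  where
  r = row n 0 ∸ (row p 0 ⊔ row q 0)
  lo hi : ℕ → ℕ
  lo i = row p (suc i) ⊔ row q (suc i)
  hi i = row p i ⊓ row q i
  f : ℕ → ℕ
  f i = lo i + hi i ∸ row n (suc i)
  refl' : ∀ i → (lo i ≤ f i) × (f i ≤ hi i) × row n (suc i) + f i ≡ lo i + hi i
  refl' i = reflect (⊓-glb (H-interlace {p} {n} sp i) (H-interlace {q} {n} sq i))
                    (⊔-lub (H-⊆ {p} {n} sp (suc i)) (H-⊆ {q} {n} sq (suc i)))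
  k≥ : ∀ i → lo i ≤ f i
  k≥ i = proj₁ (refl' i)
  k≤ : ∀ i → f i ≤ hi i
  k≤ i = proj₁ (proj₂ (refl' i))
  k : Part
  k = mkPart f (λ i → ≤-trans (k≤ (suc i)) (≤-trans (m⊓n≤m _ _) (≤-trans (m≤m⊔n _ _) (k≥ i)))) (col p 0)
       (n≤0⇒n≡0 (≤-trans (k≤ _) (≤-trans (m⊓n≤m _ _) (≤-reflexive (row-zero p ≤-refl)))))

rsk-down : ∀ p q k r → Str true k p → Str true k q → ∃ λ n → Str true p n × Str true q n × RSK p q n k r
rsk-down p q k r sp sq = n ,
  mkH {p} {n} (λ i → ≤-trans (m≤m⊔n _ _) (n≥ i)) (λ i → ≤-trans (n≤ i) (m⊓n≤m _ _)) ,
  mkH {q} {n} (λ i → ≤-trans (m≤n⊔m _ _) (n≥ i)) (λ i → ≤-trans (n≤ i) (m⊓n≤n _ _)) ,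
  rsk refl (λ i → trans (+-comm (f (suc i)) (row k i)) (proj₂ (proj₂ (refl' i))))
  where
  lo hi : ℕ → ℕ
  lo i = row p (suc i) ⊔ row q (suc i)
  hi i = row p i ⊓ row q i
  f : ℕ → ℕ
  f zero = row p 0 ⊔ row q 0 + r
  f (suc i) = lo i + hi i ∸ row k i
  refl' : ∀ i → (lo i ≤ f (suc i)) × (f (suc i) ≤ hi i) × row k i + f (suc i) ≡ lo i + hi i
  refl' i = reflect (⊓-glb (H-⊆ {k} {p} sp i) (H-⊆ {k} {q} sq i))
                    (⊔-lub (H-interlace {k} {p} sp i) (H-interlace {k} {q} sq i))
  n≥ : ∀ i → row p i ⊔ row q i ≤ f i
  n≥ zero = m≤m+n _ r
  n≥ (suc i) = proj₁ (refl' i)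
  n≤ : ∀ i → f (suc i) ≤ hi i
  n≤ i = proj₁ (proj₂ (refl' i))
  -- A horizontal strip may create one new row, hence the bound `suc (col p 0)`.
  n : Part
  n = mkPart f (λ i → ≤-trans (n≤ i) (≤-trans (m⊓n≤m _ _) (≤-trans (m≤m⊔n _ _) (n≥ i)))) (suc (col p 0))
       (n≤0⇒n≡0 (≤-trans (n≤ _) (≤-trans (m⊓n≤m _ _) (≤-reflexive (row-zero p ≤-refl)))))

⊔+⊓ : ∀ a b → (a ⊔ b) + (a ⊓ b) ≡ a + b
⊔+⊓ a b with ≤-total a b
... | inj₁ a≤b rewrite m≤n⇒m⊔n≡n a≤b | m≤n⇒m⊓n≡m a≤b = +-comm b a
... | inj₂ b≤a rewrite m≥n⇒m⊔n≡m b≤a | m≥n⇒m⊓n≡n b≤a = refl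

-- The reflections pair the maximum in row `suc i` with the minimum in row `i`; together with row 0
-- of `n` each maximum and each minimum occurs once, and the two add up to the rows of `p` and `q`.
-- The bound `m` reaches below all four partitions.
rsk-size : ∀ {p q n k r} → RSK p q n k r → size n + size k ≡ size p + size q + r
rsk-size {p} {q} {n} {k} {r} (rsk f g) = begin
  size n + size k
    ≡⟨ cong₂ _+_ (sym (size-rows n {suc m} (≤-trans nb (n≤1+n m)))) (sym (size-rows k {m} kb)) ⟩
  Σ< (suc m) (row n) + Σ< m (row k)
    ≡⟨ cong (_+ Σ< m (row k)) (Σ<-shift m (row n)) ⟩
  row n 0 + Σ< m (row n ∘ suc) + Σ< m (row k)
    ≡⟨ +-assoc (row n 0) _ _ ⟩
  row n 0 + (Σ< m (row n ∘ suc) + Σ< m (row k))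
    ≡⟨ cong₂ _+_ f (trans (sym (Σ<-+ m _ _)) (trans (Σ<-cong m (λ i _ → g i)) (Σ<-+ m _ _))) ⟩
  mx 0 + r + (Σ< m (mx ∘ suc) + Σ< m mn)
    ≡⟨ re (mx 0) r _ _ ⟩
  mx 0 + Σ< m (mx ∘ suc) + Σ< m mn + r
    ≡⟨ cong (λ t → t + Σ< m mn + r) (trans (sym (Σ<-shift m mx)) (Σ<-tail0 {m} {suc m} mx (n≤1+n m) mx0)) ⟩
  Σ< m mx + Σ< m mn + r
    ≡⟨ cong (_+ r) (trans (sym (Σ<-+ m mx mn)) (trans (Σ<-cong m (λ i _ → ⊔+⊓ (row p i) (row q i))) (Σ<-+ m _ _))) ⟩
  Σ< m (row p) + Σ< m (row q) + r
    ≡⟨ cong (_+ r) (cong₂ _+_ (size-rows p {m} pb) (size-rows q {m} qb)) ⟩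
  size p + size q + r ∎
  where
  open ≡-Reasoning
  m = col p 0 + col q 0 + (col n 0 + col k 0)
  mx mn : ℕ → ℕ
  mx i = row p i ⊔ row q i
  mn i = row p i ⊓ row q i
  pb : col p 0 ≤ m
  pb = ≤-trans (m≤m+n _ _) (m≤m+n _ _)
  qb : col q 0 ≤ m
  qb = ≤-trans (m≤n+m _ (col p 0)) (m≤m+n _ _)
  nb : col n 0 ≤ m
  nb = ≤-trans (m≤m+n _ _) (m≤n+m _ (col p 0 + col q 0))
  kb : col k 0 ≤ m
  kb = ≤-trans (m≤n+m _ (col n 0)) (m≤n+m _ (col p 0 + col q 0))
  mx0 : ∀ i → m ≤ i → mx i ≡ 0
  mx0 i h rewrite row-zero p (≤-trans pb h) | row-zero q (≤-trans qb h) = refl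
  re : ∀ a b c d → a + b + (c + d) ≡ a + c + d + b
  re = ℕS.solve-∀

rsk-uniq-k : ∀ {p q n k r p' q' n' k' r'} → RSK p q n k r → RSK p' q' n' k' r' →
  p ≈ p' → q ≈ q' → n ≈ n' → k ≈ k' × r ≡ r'
rsk-uniq-k {p} {q} {n} {k} {r} {p'} {q'} {n'} {k'} {r'} (rsk f g) (rsk f' g') hp hq hn =
  (λ i → +-cancelˡ-≡ (row n (suc i)) _ _
     (trans (g i) (trans (cong₂ _+_ (cong₂ _⊔_ (hp (suc i)) (hq (suc i))) (cong₂ _⊓_ (hp i) (hq i)))
       (trans (sym (g' i)) (cong (_+ row k' i) (sym (hn (suc i)))))))) ,
  +-cancelˡ-≡ (row p 0 ⊔ row q 0) _ _
    (trans (sym f) (trans (hn 0) (trans f' (cong (_+ r') (cong₂ _⊔_ (sym (hp 0)) (sym (hq 0)))))))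

rsk-uniq-n : ∀ {p q n k r p' q' n' k' r'} → RSK p q n k r → RSK p' q' n' k' r' →
  p ≈ p' → q ≈ q' → k ≈ k' → r ≡ r' → n ≈ n'
rsk-uniq-n (rsk f g) (rsk f' g') hp hq hk hr zero =
  trans f (trans (cong₂ _+_ (cong₂ _⊔_ (hp 0) (hq 0)) hr) (sym f'))
rsk-uniq-n {n = n} {k} {n' = n'} {k'} (rsk f g) (rsk f' g') hp hq hk hr (suc i) =
  +-cancelʳ-≡ (row k i) _ _
    (trans (g i) (trans (cong₂ _+_ (cong₂ _⊔_ (hp (suc i)) (hq (suc i))) (cong₂ _⊓_ (hp i) (hq i)))
      (trans (sym (g' i)) (cong (λ t → row n' (suc i) + t) (sym (hk i))))))

-- The rule for one horizontal and one vertical strip (dual RSK): the boxes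
-- removed from p on the way to k travel down the rows as a carry in {0 , 1}.

CarryStep : (p q n k c c⁺ : ℕ) → Set
CarryStep p q n k c c⁺ =
  (p ≤ q × n ≡ q + c × k + c⁺ ≡ p) ⊎ (p ≡ suc q × n ≡ p × k ≡ q × c ≡ c⁺)

record Carry (p q n k : Part) (r : ℕ) : Set where
  constructor mkCarry
  field
    carry : ℕ → ℕ
    carry-start : carry 0 ≡ r
    carry-step : ∀ i → CarryStep (row p i) (row q i) (row n i) (row k i) (carry i) (carry (suc i))
open Carry

module CarryDown (p q k : Part) (r : ℕ) (r≤1 : r ≤ 1) (sp : V k p) (sq : Str true k q) where
  cs f : ℕ → ℕ
  cs zero = r
  cs (suc i) with row p i ≤? row q i
  ... | yes _ = row p i ∸ row k i
  ... | no _ = cs i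
  f i with row p i ≤? row q i
  ... | yes _ = row q i + cs i
  ... | no _ = row p i

  p≤1+q : ∀ i → row p i ≤ suc (row q i)
  p≤1+q i = ≤-trans (proj₂ (sp i)) (s≤s (H-⊆ {k} {q} sq i))

  c≤1 : ∀ i → cs i ≤ 1
  c≤1 zero = r≤1
  c≤1 (suc i) with row p i ≤? row q i
  ... | yes _ = m≤n+o⇒m∸n≤o (row p i) (row k i) (≤-trans (proj₂ (sp i)) (≤-reflexive (+-comm 1 _)))
  ... | no _ = c≤1 i

  st : ∀ i → CarryStep (row p i) (row q i) (f i) (row k i) (cs i) (cs (suc i))
  st i with row p i ≤? row q i
  ... | yes h = inj₁ (h , refl , m+[n∸m]≡n (proj₁ (sp i)))
  ... | no h = inj₂ (≤-antisym (p≤1+q i) (≰⇒> h) , refl ,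
        ≤-antisym (H-⊆ {k} {q} sq i) (≤-pred (≤-trans (≰⇒> h) (proj₂ (sp i)))) , refl)

  -- This makes `n` extend `p` by a horizontal strip. In the first case of `CarryStep`,
  -- `row q (suc i) ≤ row k i` and the carry completes `row k i` to `row p i`; in the second,
  -- `row p i` exceeds `row q i` by one, which leaves room for the carry.
  q+c≤p : ∀ i → row q (suc i) + cs (suc i) ≤ row p i
  q+c≤p i with st i
  ... | inj₁ (_ , _ , e) = ≤-trans (+-monoˡ-≤ (cs (suc i)) (H-interlace {k} {q} sq i)) (≤-reflexive e)
  ... | inj₂ (e , _) = ≤-trans (+-mono-≤ (row-anti q (n≤1+n i)) (c≤1 (suc i)))
         (≤-reflexive (trans (+-comm _ 1) (sym e)))

  f≤p : ∀ i → f (suc i) ≤ row p i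
  f≤p i with st (suc i)
  ... | inj₁ (_ , e , _) = ≤-trans (≤-reflexive e) (q+c≤p i)
  ... | inj₂ (_ , e , _) = ≤-trans (≤-reflexive e) (row-anti p (n≤1+n i))

  p≤f : ∀ i → row p i ≤ f i
  p≤f i with st i
  ... | inj₁ (h , e , _) = ≤-trans h (≤-trans (m≤m+n _ _) (≤-reflexive (sym e)))
  ... | inj₂ (_ , e , _) = ≤-reflexive (sym e)

  n : Part
  n = mkPart f (λ i → ≤-trans (f≤p i) (p≤f i)) (suc (col p 0))
        (n≤0⇒n≡0 (≤-trans (f≤p _) (≤-reflexive (row-zero p ≤-refl))))

  vq : V q n
  vq i with st i
  ... | inj₁ (h , e , _) = ≤-trans (m≤m+n _ _) (≤-reflexive (sym e)) ,
        ≤-trans (≤-reflexive e) (≤-trans (+-monoʳ-≤ _ (c≤1 i)) (≤-reflexive (+-comm _ 1)))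
  ... | inj₂ (e , e' , _) = ≤-trans (n≤1+n _) (≤-reflexive (sym (trans e' e))) , ≤-reflexive (trans e' e)

  result : ∃ λ n → Str true p n × V q n × Carry p q n k r
  result = n , mkH {p} {n} p≤f f≤p , vq , mkCarry cs refl st

module CarryUp (p q n : Part) (sp : Str true p n) (sq : V q n) where
  -- The carry into row `i` is invisible there when `row p i` exceeds `row q i`, because it passes
  -- through. It is read off at the first row from `i` on where `p` does not exceed `q`, as the
  -- excess of `n` over `q`. Row `col p 0` is such a row, so the search depth `col p 0 ∸ i`
  -- suffices.
  go : ℕ → ℕ → ℕ
  go zero i = row n i ∸ row q i
  go (suc d) i with row p i ≤? row q i
  ... | yes _ = row n i ∸ row q i
  ... | no _ = go d (suc i)
  cs f : ℕ → ℕ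
  cs i = go (col p 0 ∸ i) i
  f i with row p i ≤? row q i
  ... | yes _ = row p i ∸ cs (suc i)
  ... | no _ = row q i

  n∸q≤1 : ∀ i → row n i ∸ row q i ≤ 1
  n∸q≤1 i = m≤n+o⇒m∸n≤o (row n i) (row q i) (≤-trans (proj₂ (sq i)) (≤-reflexive (+-comm 1 _)))

  go≤1 : ∀ d i → go d i ≤ 1
  go≤1 zero i = n∸q≤1 i
  go≤1 (suc d) i with row p i ≤? row q i
  ... | yes _ = n∸q≤1 i
  ... | no _ = go≤1 d (suc i)

  c≤1 : ∀ i → cs i ≤ 1
  c≤1 i = go≤1 (col p 0 ∸ i) i

  c-yes : ∀ i → row p i ≤ row q i → row n i ≡ row q i + cs i
  c-yes i h with col p 0 ∸ i
  ... | zero = sym (m+[n∸m]≡n (proj₁ (sq i)))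
  ... | suc d with row p i ≤? row q i
  ...   | yes _ = sym (m+[n∸m]≡n (proj₁ (sq i)))
  ...   | no h' = ⊥-elim (h' h)

  c-no : ∀ i → ¬ row p i ≤ row q i → cs i ≡ cs (suc i)
  c-no i h with i <? col p 0
  ... | no i≮ = ⊥-elim (h (≤-trans (≤-reflexive (row-zero p (≮⇒≥ i≮))) z≤n))
  ... | yes i< = trans (cong (λ d → go d i) (+-∸-assoc 1 i<)) (go-no (col p 0 ∸ suc i))
    where
    go-no : ∀ d → go (suc d) i ≡ go d (suc i)
    go-no d with row p i ≤? row q i
    ... | yes h' = ⊥-elim (h h')
    ... | no _ = refl

  q+c≤p : ∀ i → row q (suc i) + cs (suc i) ≤ row p i
  q+c≤p i with row p (suc i) ≤? row q (suc i)
  ... | yes h = ≤-trans (≤-reflexive (sym (c-yes (suc i) h))) (H-interlace {p} {n} sp i)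
  ... | no h = ≤-trans (+-monoʳ-≤ _ (c≤1 (suc i))) (≤-trans (≤-reflexive (+-comm _ 1))
                 (≤-trans (≰⇒> h) (row-anti p (n≤1+n i))))

  st : ∀ i → CarryStep (row p i) (row q i) (row n i) (f i) (cs i) (cs (suc i))
  st i with row p i ≤? row q i
  ... | yes h = inj₁ (h , c-yes i h , m∸n+n≡m (≤-trans (m≤n+m _ (row q (suc i))) (q+c≤p i)))
  ... | no h = inj₂ (pq , ≤-antisym (≤-trans (proj₂ (sq i)) (≤-reflexive (sym pq))) (H-⊆ {p} {n} sp i) , refl , c-no i h)
    where
    pq : row p i ≡ suc (row q i)
    pq = ≤-antisym (≤-trans (H-⊆ {p} {n} sp i) (proj₂ (sq i))) (≰⇒> h)

  f≤q : ∀ i → f i ≤ row q i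
  f≤q i with st i
  ... | inj₁ (h , _ , e) = ≤-trans (m≤m+n _ _) (≤-trans (≤-reflexive e) h)
  ... | inj₂ (_ , _ , e , _) = ≤-reflexive e

  q≤f : ∀ i → row q (suc i) ≤ f i
  q≤f i with st i
  ... | inj₁ (_ , _ , e) = +-cancelʳ-≤ (cs (suc i)) _ _ (≤-trans (q+c≤p i) (≤-reflexive (sym e)))
  ... | inj₂ (_ , _ , e , _) = ≤-trans (row-anti q (n≤1+n i)) (≤-reflexive (sym e))

  k : Part
  k = mkPart f (λ i → ≤-trans (f≤q (suc i)) (q≤f i)) (col q 0)
        (n≤0⇒n≡0 (≤-trans (f≤q _) (≤-reflexive (row-zero q ≤-refl))))

  vp : V k p
  vp i with st i
  ... | inj₁ (_ , _ , e) = ≤-trans (m≤m+n _ _) (≤-reflexive e) ,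
        ≤-trans (≤-reflexive (sym e)) (≤-trans (+-monoʳ-≤ _ (c≤1 (suc i))) (≤-reflexive (+-comm _ 1)))
  ... | inj₂ (e , _ , e' , _) = ≤-trans (≤-reflexive e') (≤-trans (n≤1+n _) (≤-reflexive (sym e))) ,
        ≤-reflexive (trans e (cong suc (sym e')))

  result : ∃ λ k → ∃ λ r → r ≤ 1 × V k p × Str true k q × Carry p q n k r
  result = k , cs 0 , c≤1 0 , vp , mkH {k} {q} f≤q q≤f , mkCarry cs refl st

carry-zero : ∀ {p q n k r} (h : Carry p q n k r) i → col p 0 ≤ i → row n i ≡ row q i + carry h i
carry-zero {p} h i x with carry-step h i
... | inj₁ (_ , e , _) = e
... | inj₂ (e , _) with trans (sym e) (row-zero p x)
...   | ()

-- In every row, `n + k` plus the outgoing carry equals `p + q` plus the incoming carry, so the sum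
-- telescopes. The carry entering row 0 is `r`, and below all four partitions no carry is left.
carry-size : ∀ {p q n k r} → Carry p q n k r → size n + size k ≡ size p + size q + r
carry-size {p} {q} {n} {k} {r} h = begin
  size n + size k
    ≡⟨ cong₂ _+_ (sym (size-rows n {m} nb)) (sym (size-rows k {m} kb)) ⟩
  Σ< m (row n) + Σ< m (row k)
    ≡⟨ sym (Σ<-+ m (row n) (row k)) ⟩
  Σ< m (λ i → row n i + row k i)
    ≡⟨ sym (+-identityʳ _) ⟩
  Σ< m (λ i → row n i + row k i) + 0
    ≡⟨ cong (λ t → Σ< m (λ i → row n i + row k i) + t) (sym cm) ⟩
  Σ< m (λ i → row n i + row k i) + carry h m
    ≡⟨ tele m ⟩
  Σ< m (λ i → row p i + row q i) + carry h 0
    ≡⟨ cong₂ _+_ (Σ<-+ m (row p) (row q)) (carry-start h) ⟩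
  Σ< m (row p) + Σ< m (row q) + r
    ≡⟨ cong (_+ r) (cong₂ _+_ (size-rows p {m} pb) (size-rows q {m} qb)) ⟩
  size p + size q + r ∎
  where
  open ≡-Reasoning
  m = col p 0 + col q 0 + (col n 0 + col k 0)
  pb : col p 0 ≤ m
  pb = ≤-trans (m≤m+n _ _) (m≤m+n _ _)
  qb : col q 0 ≤ m
  qb = ≤-trans (m≤n+m _ (col p 0)) (m≤m+n _ _)
  nb : col n 0 ≤ m
  nb = ≤-trans (m≤m+n _ _) (m≤n+m _ (col p 0 + col q 0))
  kb : col k 0 ≤ m
  kb = ≤-trans (m≤n+m _ (col n 0)) (m≤n+m _ (col p 0 + col q 0))
  cm : carry h m ≡ 0
  cm = n≤0⇒n≡0 (≤-trans (m≤n+m _ (row q m)) (≤-reflexive (trans (sym (carry-zero h m pb)) (row-zero n nb))))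
  one-row : ∀ i → row n i + row k i + carry h (suc i) ≡ row p i + row q i + carry h i
  one-row i with carry-step h i
  ... | inj₁ (_ , e , e') rewrite e | sym e' = re (row q i) (carry h i) (row k i) (carry h (suc i))
    where
    re : ∀ a b c d → a + b + c + d ≡ c + d + a + b
    re = ℕS.solve-∀
  ... | inj₂ (_ , e , e' , e'') rewrite e | e' | e'' = refl
  tele : ∀ j → Σ< j (λ i → row n i + row k i) + carry h j ≡ Σ< j (λ i → row p i + row q i) + carry h 0
  tele zero = refl
  tele (suc j) = begin
    A + (row n j + row k j) + carry h (suc j) ≡⟨ +-assoc A _ _ ⟩
    A + (row n j + row k j + carry h (suc j)) ≡⟨ cong (λ t → A + t) (one-row j) ⟩
    A + (row p j + row q j + carry h j) ≡⟨ re A (row p j + row q j) (carry h j) ⟩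
    A + carry h j + (row p j + row q j) ≡⟨ cong (_+ (row p j + row q j)) (tele j) ⟩
    B + carry h 0 + (row p j + row q j) ≡⟨ re' B _ _ ⟩
    B + (row p j + row q j) + carry h 0 ∎
    where
    A = Σ< j (λ i → row n i + row k i)
    B = Σ< j (λ i → row p i + row q i)
    re : ∀ a b c → a + (b + c) ≡ a + c + b
    re = ℕS.solve-∀
    re' : ∀ a b c → a + b + c ≡ a + c + b
    re' = ℕS.solve-∀

module CarryUnique {p q n k r p' q' n' k' r'} (h : Carry p q n k r) (h' : Carry p' q' n' k' r')
    (hp : p ≈ p') (hq : q ≈ q') where
  private
    absurd : ∀ {A : Set} i → row p i ≤ row q i → row p' i ≡ suc (row q' i) → A
    absurd i x e = ⊥-elim (<-irrefl refl (≤-trans (≤-reflexive (trans (sym e) (sym (hp i)))) (≤-trans x (≤-reflexive (hq i)))))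
    absurd' : ∀ {A : Set} i → row p' i ≤ row q' i → row p i ≡ suc (row q i) → A
    absurd' i x e = ⊥-elim (<-irrefl refl (≤-trans (≤-reflexive (trans (sym e) (hp i))) (≤-trans x (≤-reflexive (sym (hq i))))))

  -- Which case of `CarryStep` a row takes depends only on `p` and `q`. Given `n`, the carries are
  -- recovered from the bottom, where every row below `p` shows its carry; given `k` and `r`, as in
  -- `uniq-n`, they are recovered from the top.
  uniq-k : n ≈ n' → k ≈ k' × r ≡ r'
  uniq-k hn = keq , trans (sym (carry-start h)) (trans (ceq 0) (carry-start h'))
    where
    back : ∀ d i → col p 0 ≤ d + i → carry h i ≡ carry h' i
    back d i x with carry-step h i | carry-step h' i
    ... | inj₁ (_ , e , _) | inj₁ (_ , e' , _) = +-cancelˡ-≡ (row q i) _ _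
          (trans (sym e) (trans (hn i) (trans e' (cong (_+ carry h' i) (sym (hq i))))))
    ... | inj₁ (a , _) | inj₂ (b , _) = absurd i a b
    ... | inj₂ (b , _) | inj₁ (a , _) = absurd' i a b
    back zero i x | inj₂ (b , _) | inj₂ _ with trans (sym b) (row-zero p x)
    ... | ()
    back (suc d) i x | inj₂ (_ , _ , _ , e) | inj₂ (_ , _ , _ , e') =
      trans e (trans (back d (suc i) (≤-trans x (≤-reflexive (sym (+-suc d i))))) (sym e'))
    ceq : ∀ i → carry h i ≡ carry h' i
    ceq i = back (col p 0) i (m≤m+n _ _)
    keq : k ≈ k'
    keq i with carry-step h i | carry-step h' i
    ... | inj₁ (_ , _ , e) | inj₁ (_ , _ , e') = +-cancelʳ-≡ (carry h (suc i)) _ _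
          (trans e (trans (hp i) (trans (sym e') (cong (λ t → row k' i + t) (sym (ceq (suc i)))))))
    ... | inj₁ (a , _) | inj₂ (b , _) = absurd i a b
    ... | inj₂ (b , _) | inj₁ (a , _) = absurd' i a b
    ... | inj₂ (_ , _ , e , _) | inj₂ (_ , _ , e' , _) = trans e (trans (hq i) (sym e'))

  uniq-n : k ≈ k' → r ≡ r' → n ≈ n'
  uniq-n hk hr i = neq
    where
    ceq : ∀ i → carry h i ≡ carry h' i
    ceq zero = trans (carry-start h) (trans hr (sym (carry-start h')))
    ceq (suc i) with carry-step h i | carry-step h' i
    ... | inj₁ (_ , _ , e) | inj₁ (_ , _ , e') = +-cancelˡ-≡ (row k i) _ _
          (trans e (trans (hp i) (trans (sym e') (cong (_+ carry h' (suc i)) (sym (hk i))))))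
    ... | inj₁ (a , _) | inj₂ (b , _) = absurd i a b
    ... | inj₂ (b , _) | inj₁ (a , _) = absurd' i a b
    ... | inj₂ (_ , _ , _ , e) | inj₂ (_ , _ , _ , e') = trans (sym e) (trans (ceq i) e')
    neq : row n i ≡ row n' i
    neq with carry-step h i | carry-step h' i
    ... | inj₁ (_ , e , _) | inj₁ (_ , e' , _) = trans e (trans (cong₂ _+_ (hq i) (ceq i)) (sym e'))
    ... | inj₁ (a , _) | inj₂ (b , _) = absurd i a b
    ... | inj₂ (b , _) | inj₁ (a , _) = absurd' i a b
    ... | inj₂ (_ , e , _) | inj₂ (_ , e' , _) = trans e (trans (hp i) (sym e'))

-- A strip of type `a` is added and one of type `b` removed: the path from `p` over `n` to `q` is
-- exchanged for the one over `k`. Two vertical strips become horizontal by conjugation, and the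
-- mixed cases differ by exchanging `p` and `q`.
Rule : Bool → Bool → Part → Part → Part → Part → ℕ → Set
Rule true true p q n k r = RSK p q n k r
Rule false false p q n k r = RSK (dual p) (dual q) (dual n) (dual k) r
Rule true false p q n k r = Carry p q n k r
Rule false true p q n k r = Carry q p n k r

rule-up : ∀ a b p q n → Str a p n → Str b q n →
  ∃ λ k → ∃ λ r → (a xor b ≡ true → r ≤ 1) × Str b k p × Str a k q × Rule a b p q n k r
rule-up true true p q n sp sq =
  let k , r , x , y , z = rsk-up p q n sp sq in k , r , (λ ()) , x , y , z
rule-up false false p q n sp sq =
  let k , r , x , y , z = rsk-up (dual p) (dual q) (dual n) sp sq in dual k , r , (λ ()) , x , y , z
rule-up true false p q n sp sq =
  let k , r , l , x , y , z = CarryUp.result p q n sp sq in k , r , (λ _ → l) , x , y , z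
rule-up false true p q n sp sq =
  let k , r , l , x , y , z = CarryUp.result q p n sq sp in k , r , (λ _ → l) , y , x , z

rule-down : ∀ a b p q k r → (a xor b ≡ true → r ≤ 1) → Str b k p → Str a k q →
  ∃ λ n → Str a p n × Str b q n × Rule a b p q n k r
rule-down true true p q k r l sp sq = rsk-down p q k r sp sq
rule-down false false p q k r l sp sq =
  let n , x , y , z = rsk-down (dual p) (dual q) (dual k) r sp sq in dual n , x , y , z
rule-down true false p q k r l sp sq = CarryDown.result p q k r (l refl) sp sq
rule-down false true p q k r l sp sq =
  let n , x , y , z = CarryDown.result q p k r (l refl) sq sp in n , y , x , z

rule-size : ∀ a b {p q n k r} → Rule a b p q n k r → size n + size k ≡ size p + size q + r
rule-size true true h = rsk-size h
rule-size false false {p} {q} {n} {k} {r} h =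
  trans (sym (cong₂ _+_ (size-dual n) (size-dual k))) (trans (rsk-size h) (cong (_+ r) (cong₂ _+_ (size-dual p) (size-dual q))))
rule-size true false h = carry-size h
rule-size false true {p} {q} {r = r} h = trans (carry-size h) (cong (_+ r) (+-comm (size q) (size p)))

rule-uniq-k : ∀ a b {p q n k r p' q' n' k' r'} → Rule a b p q n k r → Rule a b p' q' n' k' r' →
  p ≈ p' → q ≈ q' → n ≈ n' → k ≈ k' × r ≡ r'
rule-uniq-k true true = rsk-uniq-k
rule-uniq-k false false {p} {q} {n} {k} {r} {p'} {q'} {n'} {k'} h h' hp hq hn =
  let x , y = rsk-uniq-k h h' (≈-dual {p} {p'} hp) (≈-dual {q} {q'} hq) (≈-dual {n} {n'} hn)
  in ≈-dual {dual k} {dual k'} x , y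
rule-uniq-k true false h h' hp hq hn = CarryUnique.uniq-k h h' hp hq hn
rule-uniq-k false true h h' hp hq hn = CarryUnique.uniq-k h h' hq hp hn

rule-uniq-n : ∀ a b {p q n k r p' q' n' k' r'} → Rule a b p q n k r → Rule a b p' q' n' k' r' →
  p ≈ p' → q ≈ q' → k ≈ k' → r ≡ r' → n ≈ n'
rule-uniq-n true true = rsk-uniq-n
rule-uniq-n false false {p} {q} {n} {k} {r} {p'} {q'} {n'} {k'} h h' hp hq hk hr =
  ≈-dual {dual n} {dual n'} (rsk-uniq-n h h' (≈-dual {p} {p'} hp) (≈-dual {q} {q'} hq) (≈-dual {k} {k'} hk) hr)
rule-uniq-n true false h h' hp hq hk hr = CarryUnique.uniq-n h h' hp hq hk hr
rule-uniq-n false true h h' hp hq hk hr = CarryUnique.uniq-n h h' hq hp hk hr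

-- Sequences of partitions

PartSeq : Set
PartSeq = ℕ → Part

infixr 5 _∷ₛ_
_∷ₛ_ : Part → PartSeq → PartSeq
(p ∷ₛ f) zero = p
(p ∷ₛ f) (suc m) = f m

Step : Bool → Sign → Part → Part → Set
Step b plus p q = Str b p q
Step b minus p q = Str b q p

Seq : Bool → List Sign → PartSeq → Set
Seq b [] f = IsEmpty (f 0)
Seq b (s ∷ ws) f = Step b s (f 0) (f 1) × Seq (not b) ws (f ∘ suc)

-- A normal form in which the letters + act trivially.
Chain : Bool → List Sign → PartSeq → Set
Chain b [] f = IsEmpty (f 0)
Chain b (plus ∷ ws) f = f 0 ≈ f 1 × Chain (not b) ws (f ∘ suc)
Chain b (minus ∷ ws) f = Str b (f 1) (f 0) × Chain (not b) ws (f ∘ suc)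

-- A `PartSeq` is meaningful only up to index `length ws`; later entries are arbitrary and must be
-- ignored.
EqOn : List Sign → PartSeq → PartSeq → Set
EqOn [] f g = f 0 ≈ g 0
EqOn (_ ∷ ws) f g = f 0 ≈ g 0 × EqOn ws (f ∘ suc) (g ∘ suc)

EqOn-head : ∀ ws {f g} → EqOn ws f g → f 0 ≈ g 0
EqOn-head [] h = h
EqOn-head (_ ∷ _) h = proj₁ h

EqOn-sym : ∀ ws {f g} → EqOn ws f g → EqOn ws g f
EqOn-sym [] {f} {g} h = ≈-sym {f 0} {g 0} h
EqOn-sym (_ ∷ ws) {f} {g} (h , k) = ≈-sym {f 0} {g 0} h , EqOn-sym ws k

EqOn-trans : ∀ ws {f g h} → EqOn ws f g → EqOn ws g h → EqOn ws f h
EqOn-trans [] {f} {g} {h} x y = ≈-trans {f 0} {g 0} {h 0} x y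
EqOn-trans (_ ∷ ws) {f} {g} {h} (x , x') (y , y') = ≈-trans {f 0} {g 0} {h 0} x y , EqOn-trans ws x' y'

Weight : List Sign → PartSeq → ℕ
Weight [] f = 0
Weight (_ ∷ ws) f = size (f 1) + Weight ws (f ∘ suc)

Weight-cong : ∀ ws {f g} → EqOn ws f g → Weight ws f ≡ Weight ws g
Weight-cong [] h = refl
Weight-cong (_ ∷ ws) {f} {g} (h , k) = cong₂ _+_ (size-cong {f 1} {g 1} (EqOn-head ws k)) (Weight-cong ws k)

-- The exponents of the factors of the product: 0/1 for an odd distance,
-- arbitrary for an even one.

Expo : Bool → Set
Expo true = Bool
Expo false = ℕ

val : ∀ {o} → Expo o → ℕ
val {true} true = 1
val {true} false = 0
val {false} r = r

mkExpo : ∀ o r → (o ≡ true → r ≤ 1) → Σ (Expo o) λ x → val x ≡ r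
mkExpo false r h = r , refl
mkExpo true zero h = false , refl
mkExpo true (suc zero) h = true , refl
mkExpo true (suc (suc r)) h with h refl
... | s≤s ()

val≤1 : ∀ {o} (x : Expo o) → o ≡ true → val x ≤ 1
val≤1 {true} true _ = ≤-refl
val≤1 {true} false _ = z≤n

val-inj : ∀ {o} (x y : Expo o) → val x ≡ val y → x ≡ y
val-inj {true} true true h = refl
val-inj {true} false false h = refl
val-inj {false} x y h = h

R : ℕ → Set
R d = Expo (oddℕ d)

fillWt : ∀ {ds} → All R ds → ℕ
fillWt [] = 0
fillWt {d ∷ _} (x ∷ xs) = d * val x + fillWt xs

fillWt-++ : ∀ {ds es} (xs : All R ds) (ys : All R es) → fillWt (++⁺ xs ys) ≡ fillWt xs + fillWt ys
fillWt-++ [] ys = refl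
fillWt-++ {d ∷ _} (x ∷ xs) ys = trans (cong (λ t → d * val x + t) (fillWt-++ xs ys)) (sym (+-assoc (d * val x) _ _))

oddℕ-suc : ∀ d → oddℕ (suc d) ≡ not (oddℕ d)
oddℕ-suc zero = refl
oddℕ-suc (suc zero) = refl
oddℕ-suc (suc (suc d)) = trans (per (suc d)) (trans (oddℕ-suc d) (cong not (sym (per d))))
  where
  per : ∀ d → oddℕ (suc (suc d)) ≡ oddℕ d
  per d = cong (Data.Nat._≡ᵇ 1) (trans (cong (Data.Nat._% 2) (+-comm 2 d)) ([m+n]%n≡m%n d 2))

odd-next : ∀ a b d → oddℕ d ≡ a xor b → oddℕ (suc d) ≡ a xor not b
odd-next a b d h = trans (oddℕ-suc d) (trans (cong not h) (lem a b))
  where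
  lem : ∀ a b → not (a xor b) ≡ a xor not b
  lem true true = refl
  lem true false = refl
  lem false true = refl
  lem false false = refl

-- A step + of type a is pushed through a chain, one local rule for each letter -;
-- d is the distance from the letter + to the first letter of ws.

Ins : ∀ a b ws d (n k : PartSeq) → All R (distsFrom ws d) → Set
Ins a b [] d n k xs = ⊤
Ins a b (plus ∷ ws) d n k xs = Ins a (not b) ws (suc d) (n ∘ suc) (k ∘ suc) xs
Ins a b (minus ∷ ws) d n k (x ∷ xs) =
  Rule a b (k 0) (n 1) (n 0) (k 1) (val x) × Ins a (not b) ws (suc d) (n ∘ suc) (k ∘ suc) xs

-- The parity of `d` and the type `b` both alternate from letter to letter, so `oddℕ d ≡ a xor b`
-- persists; it makes the bound `r ≤ 1` available exactly at the odd distances, where `R d` is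
-- `Bool`. At the end of the word the pushed letter + joins two empty partitions.
ins-up : ∀ a b ws d (n : PartSeq) p → oddℕ d ≡ a xor b → Chain b ws n → Str a p (n 0) →
  Σ PartSeq λ k → Σ (All R (distsFrom ws d)) λ xs → k 0 ≡ p × Chain b ws k × Ins a b ws d n k xs
ins-up a b [] d n p o ch s = (λ _ → p) , [] , refl , Str-empty a {p} {n 0} s ch , tt
ins-up a b (plus ∷ ws) d n p o (e , ch) s =
  let k , xs , k0 , ch' , i = ins-up a (not b) ws (suc d) (n ∘ suc) p (odd-next a b d o) ch
                                (Str-cong a {p} {p} {n 0} {n 1} (≈-refl {p}) e s)
  in p ∷ₛ k , xs , refl , ((λ j → cong (λ q → row q j) (sym k0)) , ch') , i
ins-up a b (minus ∷ ws) d n p o (t , ch) s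
  with rule-up a b p (n 1) (n 0) s t
... | q , r , r≤ , sb , sa , rule
  with mkExpo (oddℕ d) r (λ h → r≤ (trans (sym o) h))
... | x , refl
  with ins-up a (not b) ws (suc d) (n ∘ suc) q (odd-next a b d o) ch sa
... | k , xs , refl , ch' , i = p ∷ₛ k , x ∷ xs , refl , (sb , ch') , rule , i

-- The inverse rule needs the partition behind the letter -, so the reconstruction runs from the end
-- of the word, where `n` and `k` are both empty.
ins-down : ∀ a b ws d (k : PartSeq) (xs : All R (distsFrom ws d)) → oddℕ d ≡ a xor b → Chain b ws k →
  Σ PartSeq λ n → Chain b ws n × Str a (k 0) (n 0) × Ins a b ws d n k xs
ins-down a b [] d k xs o ch = k , ch , Str-refl a (k 0) , tt
ins-down a b (plus ∷ ws) d k xs o (e , ch) =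
  let n , ch' , s , i = ins-down a (not b) ws (suc d) (k ∘ suc) xs (odd-next a b d o) ch
  in n 0 ∷ₛ n , (≈-refl {n 0} , ch') ,
     Str-cong a {k 1} {k 0} {n 0} {n 0} (≈-sym {k 0} {k 1} e) (≈-refl {n 0}) s , i
ins-down a b (minus ∷ ws) d k (x ∷ xs) o (t , ch) =
  let n , ch' , s , i = ins-down a (not b) ws (suc d) (k ∘ suc) xs (odd-next a b d o) ch
      p , s1 , s2 , rule = rule-down a b (k 0) (n 0) (k 1) (val x) (λ h → val≤1 x (trans o h)) t s
  in p ∷ₛ n , (s2 , ch') , s1 , rule , i

-- By the local rule the excess in size of `n` over `k` falls by `r` at each letter - and ends at
-- zero, so an `r` met at distance `d` is present in `d` partitions. The factor `d` counts the
-- current excess for all partitions from behind the letter + through `n 0`.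
ins-weight : ∀ a b ws d n k xs → Chain b ws n → Chain b ws k → Ins a b ws d n k xs →
  d * size (n 0) + Weight ws n ≡ d * size (k 0) + Weight ws k + fillWt xs
ins-weight a b [] d n k [] cn ck i
  rewrite size-empty {n 0} cn | size-empty {k 0} ck = sym (+-identityʳ _)
ins-weight a b (plus ∷ ws) d n k xs (en , cn) (ek , ck) i =
  trans (lem (n 0) (n 1) (Weight ws (n ∘ suc)) en)
    (trans (ins-weight a (not b) ws (suc d) (n ∘ suc) (k ∘ suc) xs cn ck i)
      (cong (_+ fillWt xs) (sym (lem (k 0) (k 1) (Weight ws (k ∘ suc)) ek))))
  where
  lem : ∀ p q w → p ≈ q → d * size p + (size q + w) ≡ suc d * size q + w
  lem p q w h rewrite size-cong {p} {q} h = re d (size q) w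
    where
    re : ∀ d a w → d * a + (a + w) ≡ a + d * a + w
    re = ℕS.solve-∀
ins-weight a b (minus ∷ ws) d n k (x ∷ xs) (en , cn) (ek , ck) (rule , i) =
  arith d (size (n 0)) (size (n 1)) (Weight ws (n ∘ suc)) (size (k 0)) (size (k 1)) (Weight ws (k ∘ suc)) (val x) (fillWt xs)
    (rule-size a b rule) (ins-weight a (not b) ws (suc d) (n ∘ suc) (k ∘ suc) xs cn ck i)
  where
  arith : ∀ d n0 n1 wn k0 k1 wk r F → n0 + k1 ≡ k0 + n1 + r →
    suc d * n1 + wn ≡ suc d * k1 + wk + F → d * n0 + (n1 + wn) ≡ d * k0 + (k1 + wk) + (d * r + F)
  arith d n0 n1 wn k0 k1 wk r F h ih = +-cancelʳ-≡ (d * k1) _ _ (begin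
    d * n0 + (n1 + wn) + d * k1 ≡⟨ e1 d n0 n1 wn k1 ⟩
    d * (n0 + k1) + (n1 + wn) ≡⟨ cong (λ t → d * t + (n1 + wn)) h ⟩
    d * (k0 + n1 + r) + (n1 + wn) ≡⟨ e2 d k0 n1 r wn ⟩
    d * k0 + d * r + (suc d * n1 + wn) ≡⟨ cong (λ t → d * k0 + d * r + t) ih ⟩
    d * k0 + d * r + (suc d * k1 + wk + F) ≡⟨ e3 d k0 r k1 wk F ⟩
    d * k0 + (k1 + wk) + (d * r + F) + d * k1 ∎)
    where
    open ≡-Reasoning
    e1 : ∀ d n0 n1 wn k1 → d * n0 + (n1 + wn) + d * k1 ≡ d * (n0 + k1) + (n1 + wn)
    e1 = ℕS.solve-∀
    e2 : ∀ d k0 n1 r wn → d * (k0 + n1 + r) + (n1 + wn) ≡ d * k0 + d * r + (n1 + d * n1 + wn)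
    e2 = ℕS.solve-∀
    e3 : ∀ d k0 r k1 wk F → d * k0 + d * r + (k1 + d * k1 + wk + F) ≡ d * k0 + (k1 + wk) + (d * r + F) + d * k1
    e3 = ℕS.solve-∀

ins-uniq-k : ∀ a b ws d {n k xs n' k' xs'} → Chain b ws k → Chain b ws k' →
  Ins a b ws d n k xs → Ins a b ws d n' k' xs' → EqOn ws n n' → k 0 ≈ k' 0 → xs ≡ xs' × EqOn ws k k'
ins-uniq-k a b [] d {xs = []} {xs' = []} c c' i i' en h = refl , h
ins-uniq-k a b (plus ∷ ws) d {n} {k} {xs} {n'} {k'} (e , c) (e' , c') i i' (_ , en) h =
  let x , y = ins-uniq-k a (not b) ws (suc d) c c' i i' en
                (≈-trans {k 1} {k 0} {k' 1} (≈-sym {k 0} {k 1} e) (≈-trans {k 0} {k' 0} {k' 1} h e'))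
  in x , h , y
ins-uniq-k a b (minus ∷ ws) d {n} {k} {x ∷ xs} {n'} {k'} {x' ∷ xs'} (_ , c) (_ , c') (r , i) (r' , i') (en0 , en) h
  with rule-uniq-k a b r r' h (EqOn-head ws en) en0
... | hk , hv with val-inj x x' hv | ins-uniq-k a (not b) ws (suc d) c c' i i' en hk
... | refl | refl , ek = refl , h , ek

ins-uniq-n : ∀ a b ws d {n k xs n' k'} → Chain b ws n → Chain b ws n' →
  Ins a b ws d n k xs → Ins a b ws d n' k' xs → EqOn ws k k' → EqOn ws n n'
ins-uniq-n a b [] d {n} {n' = n'} c c' i i' ek = ≈-trans {n 0} {∅} {n' 0} c (≈-sym {n' 0} {∅} c')
ins-uniq-n a b (plus ∷ ws) d {n} {n' = n'} (e , c) (e' , c') i i' (_ , ek) =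
  let h = ins-uniq-n a (not b) ws (suc d) c c' i i' ek
  in ≈-trans {n 0} {n 1} {n' 0} e (≈-trans {n 1} {n' 1} {n' 0} (EqOn-head ws h) (≈-sym {n' 0} {n' 1} e')) , h
ins-uniq-n a b (minus ∷ ws) d {xs = x ∷ xs} (_ , c) (_ , c') (r , i) (r' , i') (ek0 , ek) =
  let h = ins-uniq-n a (not b) ws (suc d) c c' i i' ek
  in rule-uniq-n a b r r' ek0 (EqOn-head ws h) (EqOn-head ws ek) refl , h

-- Sorting a sequence into a chain, from the last letter + to the first.

Phi : ∀ b ws (f k : PartSeq) → All R (pairDists ws) → Set
Phi b [] f k xs = f 0 ≈ k 0
Phi b (minus ∷ ws) f k xs = f 0 ≈ k 0 × Phi (not b) ws (f ∘ suc) (k ∘ suc) xs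
Phi b (plus ∷ ws) f k zs = f 0 ≈ k 0 × Σ PartSeq λ n →
  Σ (All R (distsFrom ws 1)) λ xs → Σ (All R (pairDists ws)) λ ys →
  zs ≡ ++⁺ xs ys × Chain (not b) ws n × Phi (not b) ws (f ∘ suc) n ys × Ins b (not b) ws 1 n (k ∘ suc) xs

Phi-head : ∀ b ws {f k xs} → Phi b ws f k xs → f 0 ≈ k 0
Phi-head b [] h = h
Phi-head b (plus ∷ ws) h = proj₁ h
Phi-head b (minus ∷ ws) h = proj₁ h

odd-one : ∀ b → oddℕ 1 ≡ b xor not b
odd-one true = refl
odd-one false = refl

phi-up : ∀ b ws f → Seq b ws f → Σ PartSeq λ k → Σ (All R (pairDists ws)) λ xs → Chain b ws k × Phi b ws f k xs
phi-up b [] f h = f , [] , h , ≈-refl {f 0}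
phi-up b (minus ∷ ws) f (s , h) =
  let k , xs , c , φ = phi-up (not b) ws (f ∘ suc) h
  in f 0 ∷ₛ k , xs , (Str-cong b {f 1} {k 0} {f 0} {f 0} (Phi-head (not b) ws φ) (≈-refl {f 0}) s , c) , ≈-refl {f 0} , φ
phi-up b (plus ∷ ws) f (s , h) =
  let n , ys , c , φ = phi-up (not b) ws (f ∘ suc) h
      k , xs , k0 , c' , i = ins-up b (not b) ws 1 n (f 0) (odd-one b) c
        (Str-cong b {f 0} {f 0} {f 1} {n 0} (≈-refl {f 0}) (Phi-head (not b) ws φ) s)
  in f 0 ∷ₛ k , ++⁺ xs ys , ((λ j → cong (λ q → row q j) (sym k0)) , c') ,
     ≈-refl {f 0} , n , xs , ys , refl , c , φ , i

phi-down : ∀ b ws k xs → Chain b ws k → Σ PartSeq λ f → Seq b ws f × Phi b ws f k xs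
phi-down b [] k xs c = k , c , ≈-refl {k 0}
phi-down b (minus ∷ ws) k xs (t , c) =
  let f , s , φ = phi-down (not b) ws (k ∘ suc) xs c
  in k 0 ∷ₛ f , (Str-cong b {k 1} {f 0} {k 0} {k 0} (≈-sym {f 0} {k 1} (Phi-head (not b) ws φ)) (≈-refl {k 0}) t , s) ,
     ≈-refl {k 0} , φ
phi-down b (plus ∷ ws) k zs (t , c) =
  let xs , ys = ++⁻ (distsFrom ws 1) zs
      n , cn , s , i = ins-down b (not b) ws 1 (k ∘ suc) xs (odd-one b) c
      f , sf , φ = phi-down (not b) ws n ys cn
  in k 0 ∷ₛ f ,
     (Str-cong b {k 1} {k 0} {n 0} {f 0} (≈-sym {k 0} {k 1} t) (≈-sym {f 0} {n 0} (Phi-head (not b) ws φ)) s , sf) ,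
     ≈-refl {k 0} , n , xs , ys , sym (Inverse.strictlyInverseˡ (++↔ {P = R} {xs = distsFrom ws 1}) zs) , cn , φ , i

phi-weight : ∀ b ws f k xs → Chain b ws k → Phi b ws f k xs → Weight ws f ≡ Weight ws k + fillWt xs
phi-weight b [] f k [] c φ = refl
phi-weight b (minus ∷ ws) f k xs (_ , c) (_ , φ) =
  trans (cong₂ _+_ (size-cong {f 1} {k 1} (Phi-head (not b) ws φ)) (phi-weight (not b) ws (f ∘ suc) (k ∘ suc) xs c φ))
    (sym (+-assoc (size (k 1)) _ _))
phi-weight b (plus ∷ ws) f k _ (_ , c) (_ , n , xs , ys , refl , cn , φ , i) = begin
  size (f 1) + Weight ws (f ∘ suc)
    ≡⟨ cong₂ _+_ (size-cong {f 1} {n 0} (Phi-head (not b) ws φ)) (phi-weight (not b) ws (f ∘ suc) n ys cn φ) ⟩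
  size (n 0) + (Weight ws n + fillWt ys)
    ≡⟨ re (size (n 0)) (Weight ws n) (fillWt ys) ⟩
  1 * size (n 0) + Weight ws n + fillWt ys
    ≡⟨ cong (_+ fillWt ys) (ins-weight b (not b) ws 1 n (k ∘ suc) xs cn c i) ⟩
  1 * size (k 1) + Weight ws (k ∘ suc) + fillWt xs + fillWt ys
    ≡⟨ re' (size (k 1)) (Weight ws (k ∘ suc)) (fillWt xs) (fillWt ys) ⟩
  size (k 1) + Weight ws (k ∘ suc) + (fillWt xs + fillWt ys)
    ≡⟨ cong (λ t → size (k 1) + Weight ws (k ∘ suc) + t) (sym (fillWt-++ xs ys)) ⟩
  size (k 1) + Weight ws (k ∘ suc) + fillWt (++⁺ xs ys) ∎
  where
  open ≡-Reasoning
  re : ∀ a b c → a + (b + c) ≡ 1 * a + b + c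
  re = ℕS.solve-∀
  re' : ∀ a b c d → 1 * a + b + c + d ≡ a + b + (c + d)
  re' = ℕS.solve-∀

phi-uniq-k : ∀ b ws {f k xs f' k' xs'} → Chain b ws k → Chain b ws k' → Phi b ws f k xs → Phi b ws f' k' xs' →
  EqOn ws f f' → xs ≡ xs' × EqOn ws k k'
phi-uniq-k b [] {f} {k} {[]} {f'} {k'} {[]} c c' φ φ' h =
  refl , ≈-trans {k 0} {f 0} {k' 0} (≈-sym {f 0} {k 0} φ) (≈-trans {f 0} {f' 0} {k' 0} h φ')
phi-uniq-k b (minus ∷ ws) {f} {k} {xs} {f'} {k'} (_ , c) (_ , c') (e , φ) (e' , φ') (h0 , h) =
  let x , y = phi-uniq-k (not b) ws c c' φ φ' h
  in x , ≈-trans {k 0} {f 0} {k' 0} (≈-sym {f 0} {k 0} e) (≈-trans {f 0} {f' 0} {k' 0} h0 e') , y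
phi-uniq-k b (plus ∷ ws) {f} {k} {zs} {f'} {k'} {zs'} (t , c) (t' , c')
  (e , n , xs , ys , refl , cn , φ , i) (e' , n' , xs' , ys' , refl , cn' , φ' , i') (h0 , h) =
  let hy , hn = phi-uniq-k (not b) ws cn cn' φ φ' h
      k0 = ≈-trans {k 0} {f 0} {k' 0} (≈-sym {f 0} {k 0} e) (≈-trans {f 0} {f' 0} {k' 0} h0 e')
      k1 = ≈-trans {k 1} {k 0} {k' 1} (≈-sym {k 0} {k 1} t) (≈-trans {k 0} {k' 0} {k' 1} k0 t')
      hx , hk = ins-uniq-k b (not b) ws 1 c c' i i' hn k1
  in cong₂ ++⁺ hx hy , k0 , hk

phi-uniq-f : ∀ b ws {f k xs f' k'} → Phi b ws f k xs → Phi b ws f' k' xs → EqOn ws k k' → EqOn ws f f'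
phi-uniq-f b [] {f} {k} {xs} {f'} {k'} φ φ' h =
  ≈-trans {f 0} {k 0} {f' 0} φ (≈-trans {k 0} {k' 0} {f' 0} h (≈-sym {f' 0} {k' 0} φ'))
phi-uniq-f b (minus ∷ ws) {f} {k} {xs} {f'} {k'} (e , φ) (e' , φ') (h0 , h) =
  ≈-trans {f 0} {k 0} {f' 0} e (≈-trans {k 0} {k' 0} {f' 0} h0 (≈-sym {f' 0} {k' 0} e')) , phi-uniq-f (not b) ws φ φ' h
phi-uniq-f b (plus ∷ ws) {f} {k} {zs} {f'} {k'} (e , n , xs , ys , hz , cn , φ , i) (e' , n' , xs' , ys' , hz' , cn' , φ' , i') (h0 , h)
  with trans (sym (Inverse.strictlyInverseʳ (++↔ {P = R}) (xs , ys)))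
         (trans (cong (++⁻ (distsFrom ws 1)) (trans (sym hz) hz')) (Inverse.strictlyInverseʳ (++↔ {P = R}) (xs' , ys')))
... | refl =
  ≈-trans {f 0} {k 0} {f' 0} e (≈-trans {k 0} {k' 0} {f' 0} h0 (≈-sym {f' 0} {k' 0} e')) ,
  phi-uniq-f (not b) ws φ φ' (ins-uniq-n b (not b) ws 1 cn cn' i i' h)

∅s : PartSeq
∅s _ = ∅

chain-∅ : ∀ b ws → Chain b ws ∅s
chain-∅ b [] = ≈-refl {∅}
chain-∅ b (plus ∷ ws) = ≈-refl {∅} , chain-∅ (not b) ws
chain-∅ b (minus ∷ ws) = Str-refl b ∅ , chain-∅ (not b) ws

seq-∅ : ∀ b ws → Seq b ws ∅s
seq-∅ b [] = ≈-refl {∅}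
seq-∅ b (plus ∷ ws) = Str-refl b ∅ , seq-∅ (not b) ws
seq-∅ b (minus ∷ ws) = Str-refl b ∅ , seq-∅ (not b) ws

weight-∅ : ∀ ws → Weight ws ∅s ≡ 0
weight-∅ [] = refl
weight-∅ (_ ∷ ws) = weight-∅ ws

-- A chain never grows, so it cannot leave the empty partition. All information of a sequence that
-- starts empty is therefore in its numbers `r`.
chain-empty : ∀ b ws k → Chain b ws k → IsEmpty (k 0) → EqOn ws k ∅s
chain-empty b [] k c h = h
chain-empty b (plus ∷ ws) k (e , c) h = h , chain-empty (not b) ws (k ∘ suc) c (≈-trans {k 1} {k 0} {∅} (≈-sym {k 0} {k 1} e) h)
chain-empty b (minus ∷ ws) k (s , c) h = h , chain-empty (not b) ws (k ∘ suc) c (Str-empty b {k 1} {k 0} s h)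

Coded : ∀ ws → PartSeq → All R (pairDists ws) → Set
Coded ws f xs = Σ PartSeq λ k → Chain true ws k × EqOn ws k ∅s × Phi true ws f k xs

encode : ∀ ws f → Seq true ws f → IsEmpty (f 0) → ∃ (Coded ws f)
encode ws f s h =
  let k , xs , c , φ = phi-up true ws f s
  in xs , k , c , chain-empty true ws k c (≈-trans {k 0} {f 0} {∅} (≈-sym {f 0} {k 0} (Phi-head true ws φ)) h) , φ

decode : ∀ ws xs → Σ PartSeq λ f → Seq true ws f × IsEmpty (f 0) × Coded ws f xs
decode ws xs =
  let f , s , φ = phi-down true ws ∅s xs (chain-∅ true ws)
  in f , s , Phi-head true ws φ , ∅s , chain-∅ true ws , chain-empty true ws ∅s (chain-∅ true ws) (≈-refl {∅}) , φ

coded-weight : ∀ ws {f xs} → Coded ws f xs → Weight ws f ≡ fillWt xs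
coded-weight ws {f} {xs} (k , c , e , φ) =
  trans (phi-weight true ws f k xs c φ) (cong (_+ fillWt xs) (trans (Weight-cong ws e) (weight-∅ ws)))

coded-uniq : ∀ ws {f f' xs xs'} → Coded ws f xs → Coded ws f' xs' → EqOn ws f f' → xs ≡ xs'
coded-uniq ws (k , c , e , φ) (k' , c' , e' , φ') h = proj₁ (phi-uniq-k true ws c c' φ φ' h)

coded-inj : ∀ ws {f f' xs} → Coded ws f xs → Coded ws f' xs → EqOn ws f f'
coded-inj ws (k , c , e , φ) (k' , c' , e' , φ') = phi-uniq-f true ws φ φ' (EqOn-trans ws e (EqOn-sym ws e'))

-- Enumerations with a given generating series

record Enum {A : Set} (wt : A → ℕ) (s : Series) : Set where
  field
    elem : ∀ n → Fin (s n) → A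
    elem-wt : ∀ n i → wt (elem n i) ≡ n
    elem-inj : ∀ n i j → elem n i ≡ elem n j → i ≡ j
    elem-surj : ∀ n a → wt a ≡ n → ∃ λ i → elem n i ≡ a
open Enum

-- The Cauchy product sums over `upTo (suc n)`, which unfolds as `applyUpTo` of ever more shifted
-- functions; hence the generality in `g`.
split-sum : ∀ k (g h : ℕ → ℕ) → Fin (sum (map h (applyUpTo g k))) → Σ ℕ (Fin ∘ h ∘ g)
split-sum (suc k) g h i =
  [ (λ x → 0 , x) , (λ y → let m , x = split-sum k (g ∘ suc) h y in suc m , x) ]′ (splitAt (h (g 0)) i)

split-sum-< : ∀ k (g h : ℕ → ℕ) (i : Fin (sum (map h (applyUpTo g k)))) → proj₁ (split-sum k g h i) < k
split-sum-< (suc k) g h i with splitAt (h (g 0)) i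
... | inj₁ x = s≤s z≤n
... | inj₂ y = s≤s (split-sum-< k (g ∘ suc) h y)

join-sum : ∀ k (g h : ℕ → ℕ) m → m < k → Fin (h (g m)) → Fin (sum (map h (applyUpTo g k)))
join-sum (suc k) g h zero l x = x ↑ˡ _
join-sum (suc k) g h (suc m) l x = h (g 0) ↑ʳ join-sum k (g ∘ suc) h m (≤-pred l) x

split-join-sum : ∀ k (g h : ℕ → ℕ) m (l : m < k) (x : Fin (h (g m))) → split-sum k g h (join-sum k g h m l x) ≡ (m , x)
split-join-sum (suc k) g h zero l x
  rewrite Fin.splitAt-↑ˡ (h (g 0)) x (sum (map h (applyUpTo (g ∘ suc) k))) = refl
split-join-sum (suc k) g h (suc m) l x
  rewrite Fin.splitAt-↑ʳ (h (g 0)) (sum (map h (applyUpTo (g ∘ suc) k))) (join-sum k (g ∘ suc) h m (≤-pred l) x)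
        | split-join-sum k (g ∘ suc) h m (≤-pred l) x = refl

split-sum-inj : ∀ k (g h : ℕ → ℕ) (i j : Fin (sum (map h (applyUpTo g k)))) → split-sum k g h i ≡ split-sum k g h j → i ≡ j
split-sum-inj (suc k) g h i j e = trans (sym (Fin.join-splitAt (h (g 0)) _ i))
  (trans (cong (join (h (g 0)) _) (lem (splitAt (h (g 0)) i) (splitAt (h (g 0)) j) e)) (Fin.join-splitAt (h (g 0)) _ j))
  where
  F : Fin (h (g 0)) ⊎ Fin (sum (map h (applyUpTo (g ∘ suc) k))) → Σ ℕ (Fin ∘ h ∘ g)
  F = [ (λ x → 0 , x) , (λ y → let m , x = split-sum k (g ∘ suc) h y in suc m , x) ]′
  unsuc : ∀ {m m'} {x : Fin (h (g (suc m)))} {x' : Fin (h (g (suc m')))} →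
    _≡_ {A = Σ ℕ (Fin ∘ h ∘ g)} (suc m , x) (suc m' , x') → _≡_ {A = Σ ℕ (Fin ∘ h ∘ g ∘ suc)} (m , x) (m' , x')
  unsuc refl = refl
  lem : ∀ u v → F u ≡ F v → u ≡ v
  lem (inj₁ x) (inj₁ y) refl = refl
  lem (inj₂ x) (inj₂ y) e = cong inj₂ (split-sum-inj k (g ∘ suc) h x y (unsuc e))

enum-⋆ : ∀ {A B : Set} {wa : A → ℕ} {wb : B → ℕ} {s t} → Enum wa s → Enum wb t →
  Enum {A × B} (λ (a , b) → wa a + wb b) (s ⋆ t)
enum-⋆ {A} {B} {wa} {wb} {s} {t} ea eb = record
  { elem = λ n i → pick n (split-sum (suc n) id (h n) i)
  ; elem-wt = λ n i → pick-wt n (split-sum (suc n) id (h n) i) (≤-pred (split-sum-< (suc n) id (h n) i))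
  ; elem-inj = λ n i j e → split-sum-inj (suc n) id (h n) i j (pick-inj n _ _ e)
  ; elem-surj = surj }
  where
  h : ℕ → ℕ → ℕ
  h n k = s k * t (n ∸ k)
  pick : ∀ n → Σ ℕ (Fin ∘ h n) → A × B
  pick n (k , x) = elem ea k (proj₁ (remQuot (t (n ∸ k)) x)) , elem eb (n ∸ k) (proj₂ (remQuot {s k} (t (n ∸ k)) x))
  pick-wt : ∀ n kx → proj₁ kx ≤ n → wa (proj₁ (pick n kx)) + wb (proj₂ (pick n kx)) ≡ n
  pick-wt n (k , x) l = trans (cong₂ _+_ (elem-wt ea k _) (elem-wt eb (n ∸ k) _)) (m+[n∸m]≡n l)
  pick-inj : ∀ n u v → pick n u ≡ pick n v → u ≡ v
  pick-inj n (k , x) (k' , x') e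
    with trans (sym (elem-wt ea k _)) (trans (cong (wa ∘ proj₁) e) (elem-wt ea k' _))
  ... | refl = cong (k ,_) (trans (sym (Fin.combine-remQuot {s k} (t (n ∸ k)) x))
      (trans (cong (uncurry combine) (cong₂ _,_ (elem-inj ea k _ _ (cong proj₁ e)) (elem-inj eb (n ∸ k) _ _ (cong proj₂ e))))
        (Fin.combine-remQuot {s k} (t (n ∸ k)) x')))
  surj : ∀ n ab → wa (proj₁ ab) + wb (proj₂ ab) ≡ n → ∃ λ i → pick n (split-sum (suc n) id (h n) i) ≡ ab
  surj n (a , b) e with elem-surj ea (wa a) a refl
    | elem-surj eb (n ∸ wa a) b (trans (sym (m+n∸m≡n (wa a) (wb b))) (cong (_∸ wa a) e))
  ... | x , ex | y , ey = join-sum (suc n) id (h n) (wa a) l (combine x y) ,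
      trans (cong (pick n) (split-join-sum (suc n) id (h n) (wa a) l (combine x y)))
        (cong₂ _,_ (trans (cong (elem ea (wa a) ∘ proj₁) (Fin.remQuot-combine x y)) ex)
                   (trans (cong (elem eb (n ∸ wa a) ∘ proj₂) (Fin.remQuot-combine x y)) ey))
    where
    l : wa a < suc n
    l = s≤s (≤-trans (m≤m+n _ _) (≤-reflexive e))

fin-if : ∀ {b} → Fin (if b then 1 else 0) → T b
fin-if {true} _ = tt

fin-if-unique : ∀ {b} (x y : Fin (if b then 1 else 0)) → x ≡ y
fin-if-unique {true} zero zero = refl

if-fin : ∀ {b} → T b → Fin (if b then 1 else 0)
if-fin {true} _ = zero

enum-expo : ∀ d → 1 ≤ d → Enum {R d} (λ x → d * val x) (factor d)
enum-expo d 1≤d with oddℕ d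
... | true = record { elem = λ n i → el n (sp n i) ; elem-wt = λ n i → wt n (sp n i)
                    ; elem-inj = λ n i j e → inj n i j (injs n (sp n i) (sp n j) e) ; elem-surj = surj }
  where
  sp : ∀ n → Fin (onePlus d n) → Fin (if n ≡ᵇ 0 then 1 else 0) ⊎ Fin (if n ≡ᵇ d then 1 else 0)
  sp n = splitAt (if n ≡ᵇ 0 then 1 else 0)
  el : ∀ n → Fin (if n ≡ᵇ 0 then 1 else 0) ⊎ Fin (if n ≡ᵇ d then 1 else 0) → Bool
  el n (inj₁ _) = false
  el n (inj₂ _) = true
  wt : ∀ n x → d * val {true} (el n x) ≡ n
  wt n (inj₁ x) = trans (*-zeroʳ d) (sym (≡ᵇ⇒≡ n 0 (fin-if x)))
  wt n (inj₂ x) = trans (*-identityʳ d) (sym (≡ᵇ⇒≡ n d (fin-if x)))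
  injs : ∀ n x y → el n x ≡ el n y → x ≡ y
  injs n (inj₁ x) (inj₁ y) _ = cong inj₁ (fin-if-unique x y)
  injs n (inj₂ x) (inj₂ y) _ = cong inj₂ (fin-if-unique x y)
  inj : ∀ n i j → sp n i ≡ sp n j → i ≡ j
  inj n i j e = trans (sym (Fin.join-splitAt (if n ≡ᵇ 0 then 1 else 0) (if n ≡ᵇ d then 1 else 0) i))
    (trans (cong (join _ _) e) (Fin.join-splitAt (if n ≡ᵇ 0 then 1 else 0) (if n ≡ᵇ d then 1 else 0) j))
  surj : ∀ n x → d * val {true} x ≡ n → ∃ λ i → el n (sp n i) ≡ x
  surj n false e = if-fin (≡⇒≡ᵇ n 0 (trans (sym e) (*-zeroʳ d))) ↑ˡ _ ,
    cong (el n) (Fin.splitAt-↑ˡ (if n ≡ᵇ 0 then 1 else 0) _ _)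
  surj n true e = (if n ≡ᵇ 0 then 1 else 0) ↑ʳ if-fin (≡⇒≡ᵇ n d (trans (sym e) (*-identityʳ d))) ,
    cong (el n) (Fin.splitAt-↑ʳ (if n ≡ᵇ 0 then 1 else 0) _ _)
... | false = record { elem = el ; elem-wt = wt ; elem-inj = inj ; elem-surj = surj }
  where
  el : ∀ n → Fin (geom d n) → ℕ
  el n i with d ∣? n
  ... | yes x = quotient x
  wt : ∀ n i → d * el n i ≡ n
  wt n i with d ∣? n
  ... | yes (divides q e) = trans (*-comm d q) (sym e)
  inj : ∀ n i j → el n i ≡ el n j → i ≡ j
  inj n i j e with d ∣? n
  inj n zero zero e | yes _ = refl
  surj : ∀ n r → d * r ≡ n → ∃ λ i → el n i ≡ r
  surj n r e with d ∣? n
  ... | yes (divides q e') = zero , *-cancelˡ-≡ q r d {{Data.Nat.>-nonZero 1≤d}} (trans (*-comm d q) (trans (sym e') (sym e)))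
  ... | no h = ⊥-elim (h (divides r (trans (sym e) (*-comm d r))))

enum-fill : ∀ ds → All (1 ≤_) ds → Enum (fillWt {ds}) (foldr (λ d acc → factor d ⋆ acc) one ds)
enum-fill [] [] = record
  { elem = λ _ _ → [] ; elem-wt = λ { zero _ → refl } ; elem-inj = λ { zero zero zero _ → refl }
  ; elem-surj = λ { zero [] _ → zero , refl } }
enum-fill (d ∷ ds) (p ∷ ps) = record
  { elem = λ n i → cons (elem e n i)
  ; elem-wt = λ n i → elem-wt e n i
  ; elem-inj = λ n i j h → elem-inj e n i j (cong uncons h)
  ; elem-surj = λ { n (x ∷ xs) h → let i , q = elem-surj e n (x , xs) h in i , cong cons q } }
  where
  e = enum-⋆ (enum-expo d p) (enum-fill ds ps)
  cons : R d × All R ds → All R (d ∷ ds)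
  cons (x , xs) = x ∷ xs
  uncons : All R (d ∷ ds) → R d × All R ds
  uncons (x ∷ xs) = x , xs

distsFrom-pos : ∀ ws d → All (1 ≤_) (distsFrom ws (suc d))
distsFrom-pos [] d = []
distsFrom-pos (plus ∷ ws) d = distsFrom-pos ws (suc d)
distsFrom-pos (minus ∷ ws) d = s≤s z≤n ∷ distsFrom-pos ws (suc d)

pairDists-pos : ∀ ws → All (1 ≤_) (pairDists ws)
pairDists-pos [] = []
pairDists-pos (plus ∷ ws) = ++⁺ (distsFrom-pos ws 0) (pairDists-pos ws)
pairDists-pos (minus ∷ ws) = pairDists-pos ws

enum-product : ∀ w → Enum (fillWt {pairDists w}) (productFormula w)
enum-product w = enum-fill (pairDists w) (pairDists-pos w)

-- Edges

par : ℕ → Bool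
par zero = true
par (suc m) = not (par m)

infixl 6 _⊕_
_⊕_ : ℤ → Bool → ℤ
n ⊕ true = n ℤ.+ + 1
n ⊕ false = n

Domino : Set
Domino = Orient × ℤ × ℤ

-- The domino joining the squares (n , n - m) and (n ⊕ b , n ⊕ b - (m + 1)).
edgeDom : ℕ → ℤ → Bool → Domino
edgeDom m n true = hor , n , n ℤ.- + m
edgeDom m n false = ver , n , n ℤ.- + suc m

_∋_ : Tiling → Domino → Set
T ∋ (o , x , y) = T o x y ≡ true

edge : Tiling → ℕ → ℤ → Bool → Bool
edge T m n b = let o , x , y = edgeDom m n b in T o x y

-- Edges have a natural number as level, so they say nothing about dominos that start on a diagonal
-- of negative index. Excluding these makes a tiling determined by its edges.
Supported : Tiling → Set
Supported T = ∀ o x y → T o x y ≡ true → ∃ λ m → ∃ λ n → ∃ λ b → (o , x , y) ≡ edgeDom m n b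

m+n-n : ∀ m n → m ℤ.+ n ℤ.- n ≡ m
m+n-n = ℤS.solve-∀

-- Linear consequences of one hypothesis: the hypothesis enters as `l ≡ r`, and what remains is an
-- identity for the ring solver. `≤-from` does the same for inequalities.
≡-from : ∀ {a b l r} → l ≡ r → a ℤ.+ r ≡ b ℤ.+ l → a ≡ b
≡-from {a} {b} {l} {r} refl h = begin
  a ≡⟨ e a l ⟩
  a ℤ.+ l ℤ.- l ≡⟨ cong (ℤ._- l) h ⟩
  b ℤ.+ l ℤ.- l ≡⟨ sym (e b l) ⟩
  b ∎
  where
  open ≡-Reasoning
  e : ∀ a l → a ≡ a ℤ.+ l ℤ.- l
  e = ℤS.solve-∀

≤-from : ∀ {a b l r} → l ℤ.≤ r → a ℤ.+ r ≡ b ℤ.+ l → a ℤ.≤ b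
≤-from {a} {b} {l} {r} h e = subst₂ ℤ._≤_ (m+n-n a r) (m+n-n b r)
  (ℤP.+-monoˡ-≤ (ℤ.- r) (ℤP.≤-trans (ℤP.≤-reflexive e) (ℤP.+-monoʳ-≤ b h)))

≤+∣∣ : ∀ a → a ℤ.≤ + ∣ a ∣
≤+∣∣ (+ a) = ℤP.≤-refl
≤+∣∣ -[1+ a ] = ℤ.-≤+

+suc : ∀ m → + suc m ≡ + m ℤ.+ + 1
+suc m = cong +_ (+-comm 1 m)

level-inj : ∀ n m m' → n ℤ.- + m ≡ n ℤ.- + m' → m ≡ m'
level-inj n m m' h = ℤP.+-injective (≡-from (sym h) (e n (+ m) (+ m')))
  where
  e : ∀ n m m' → m ℤ.+ (n ℤ.- m) ≡ m' ℤ.+ (n ℤ.- m')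
  e = ℤS.solve-∀

n-suc : ∀ n m → n ℤ.+ + 1 ℤ.- + suc m ≡ n ℤ.- + m
n-suc n m = trans (cong (λ t → n ℤ.+ + 1 ℤ.- t) (+suc m)) (e n (+ m))
  where
  e : ∀ n m → n ℤ.+ + 1 ℤ.- (m ℤ.+ + 1) ≡ n ℤ.- m
  e = ℤS.solve-∀

n-suc+1 : ∀ n m → n ℤ.- + suc m ℤ.+ + 1 ≡ n ℤ.- + m
n-suc+1 n m = trans (cong (λ t → n ℤ.- t ℤ.+ + 1) (+suc m)) (e n (+ m))
  where
  e : ∀ n m → n ℤ.- (m ℤ.+ + 1) ℤ.+ + 1 ≡ n ℤ.- m
  e = ℤS.solve-∀

n-[n-m] : ∀ n m → n ℤ.- (n ℤ.- m) ≡ m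
n-[n-m] = ℤS.solve-∀

⊕-cancel : ∀ n n' b → n ⊕ b ≡ n' ⊕ b → n ≡ n'
⊕-cancel n n' true e = ≡-from e (lem n n')
  where
  lem : ∀ n n' → n ℤ.+ (n' ℤ.+ + 1) ≡ n' ℤ.+ (n ℤ.+ + 1)
  lem = ℤS.solve-∀
⊕-cancel n n' false e = e

n≢n+1 : ∀ n → ¬ n ≡ n ℤ.+ + 1
n≢n+1 n h with ≡-from {+ 0} {+ 1} h (e n)
  where
  e : ∀ n → + 0 ℤ.+ (n ℤ.+ + 1) ≡ + 1 ℤ.+ n
  e = ℤS.solve-∀
... | ()

+-lin : ∀ {m n} → + m ℤ.≤ + n → m ≤ n
+-lin (ℤ.+≤+ h) = h

edgeDom-inj : ∀ m n b m' n' b' → edgeDom m n b ≡ edgeDom m' n' b' → m ≡ m' × n ≡ n' × b ≡ b'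
edgeDom-inj m n true m' n' true h with cong (proj₁ ∘ proj₂) h
... | refl = level-inj n m m' (cong (proj₂ ∘ proj₂) h) , refl , refl
edgeDom-inj m n false m' n' false h with cong (proj₁ ∘ proj₂) h
... | refl = suc-injective (level-inj n (suc m) (suc m') (cong (proj₂ ∘ proj₂) h)) , refl , refl
edgeDom-inj m n true m' n' false h with cong proj₁ h
... | ()
edgeDom-inj m n false m' n' true h with cong proj₁ h
... | ()

dirE : Bool → Bool → Dir
dirE true true = N
dirE true false = E
dirE false true = S
dirE false false = W

dirOf : Domino → Dir
dirOf (o , x , y) = dir o x y

evenℕ-suc : ∀ k → (suc k Data.Nat.% 2 Data.Nat.≡ᵇ 0) ≡ not (k Data.Nat.% 2 Data.Nat.≡ᵇ 0)
evenℕ-suc zero = refl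
evenℕ-suc (suc zero) = refl
evenℕ-suc (suc (suc k)) = trans (per (suc k)) (trans (evenℕ-suc k) (cong not (sym (per k))))
  where
  open import Data.Nat.DivMod using ([m+n]%n≡m%n)
  per : ∀ k → (suc (suc k) Data.Nat.% 2 Data.Nat.≡ᵇ 0) ≡ (k Data.Nat.% 2 Data.Nat.≡ᵇ 0)
  per k = cong (Data.Nat._≡ᵇ 0) (trans (cong (Data.Nat._% 2) (+-comm 2 k)) ([m+n]%n≡m%n k 2))

not-not : ∀ b → not (not b) ≡ b
not-not true = refl
not-not false = refl

even-suc : ∀ z → evenℤ (z ℤ.+ + 1) ≡ not (evenℤ z)
even-suc (+ k) = trans (cong (λ t → (t Data.Nat.% 2) Data.Nat.≡ᵇ 0) (+-comm k 1)) (evenℕ-suc k)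
even-suc -[1+ zero ] = refl
even-suc -[1+ suc k ] = trans (sym (not-not _)) (cong not (sym (evenℕ-suc (suc k))))

even-pred : ∀ z → evenℤ (z ℤ.- + 1) ≡ not (evenℤ z)
even-pred z = trans (sym (not-not _)) (cong not (trans (sym (even-suc (z ℤ.- + 1))) (cong evenℤ (e z))))
  where
  e : ∀ z → z ℤ.- + 1 ℤ.+ + 1 ≡ z
  e = ℤS.solve-∀

even-double : ∀ n → evenℤ (n ℤ.+ n) ≡ true
even-double (+ k) = go k
  where
  go : ∀ k → ((k + k) Data.Nat.% 2 Data.Nat.≡ᵇ 0) ≡ true
  go zero = refl
  go (suc k) = trans (evenℕ-suc (k + suc k)) (trans (cong not (trans (cong (λ t → t Data.Nat.% 2 Data.Nat.≡ᵇ 0) (+-suc k k)) (evenℕ-suc (k + k)))) (trans (not-not _) (go k)))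
even-double -[1+ k ] = trans (evenℕ-suc (suc (k + k))) (trans (cong not (evenℕ-suc (k + k))) (trans (not-not _) (even-double (+ k))))

even-level : ∀ n m → evenℤ (n ℤ.+ (n ℤ.- + m)) ≡ par m
even-level n zero = trans (cong evenℤ (e n)) (even-double n)
  where
  e : ∀ n → n ℤ.+ (n ℤ.- + 0) ≡ n ℤ.+ n
  e = ℤS.solve-∀
even-level n (suc m) = trans (cong evenℤ (trans (cong (λ t → n ℤ.+ (n ℤ.- t)) (+suc m)) (e n (+ m))))
  (trans (even-pred (n ℤ.+ (n ℤ.- + m))) (cong not (even-level n m)))
  where
  e : ∀ n m → n ℤ.+ (n ℤ.- (m ℤ.+ + 1)) ≡ n ℤ.+ (n ℤ.- m) ℤ.- + 1
  e = ℤS.solve-∀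

-- The lower left corner of the domino has coordinate sum `2n - m` or `2n - m - 1`, so its parity is
-- decided by `m` and the orientation: north and east leave even diagonals, south and west odd ones.
dir-edge : ∀ m n b → dirOf (edgeDom m n b) ≡ dirE (par m) b
dir-edge m n true rewrite even-level n m with par m
... | true = refl
... | false = refl
dir-edge m n false rewrite even-level n (suc m) with par m
... | true = refl
... | false = refl

covers-tail : ∀ m n b → let o , x , y = edgeDom m n b in Covers o x y n (n ℤ.- + m)
covers-tail m n true = inj₁ refl , refl
covers-tail m n false = refl , inj₂ (sym (n-suc+1 n m))

covers-head : ∀ m n b → let o , x , y = edgeDom m n b in Covers o x y (n ⊕ b) (n ⊕ b ℤ.- + suc m)
covers-head m n true = inj₂ refl , n-suc n m
covers-head m n false = refl , inj₁ refl

covers-inv : ∀ m n b a a' → (let o , x , y = edgeDom m n b in Covers o x y a a') →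
  (a ≡ n × a' ≡ n ℤ.- + m) ⊎ (a ≡ n ⊕ b × a' ≡ n ⊕ b ℤ.- + suc m)
covers-inv m n true a a' (inj₁ e , e') = inj₁ (e , e')
covers-inv m n true a a' (inj₂ e , e') = inj₂ (e , trans e' (sym (n-suc n m)))
covers-inv m n false a a' (e , inj₁ e') = inj₂ (e , e')
covers-inv m n false a a' (e , inj₂ e') = inj₁ (e , trans e' (n-suc+1 n m))

data Meets (m : ℕ) (n : ℤ) : ℕ → ℤ → Bool → Set where
  tail : ∀ {b} → Meets m n m n b
  head : ∀ {m' n' b} → m ≡ suc m' → n ≡ n' ⊕ b → Meets m n m' n' b

site : ∀ m n m' n' b → (let o , x , y = edgeDom m' n' b in Covers o x y n (n ℤ.- + m)) → Meets m n m' n' b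
site m n m' n' b h with covers-inv m' n' b n (n ℤ.- + m) h
... | inj₁ (refl , e) with level-inj n m m' e
...   | refl = tail
site m n m' n' b h | inj₂ (refl , e) = head (level-inj (n' ⊕ b) m (suc m') e) refl

HasOut : (ℕ → ℤ → Bool → Bool) → ℕ → ℤ → Set
HasOut G m n = ∃ λ b → G m n b ≡ true

HasIn : (ℕ → ℤ → Bool → Bool) → ℕ → ℤ → Set
HasIn G m n = ∃ λ n' → ∃ λ b → G m n' b ≡ true × n ≡ n' ⊕ b

far : Bool → ℤ → ℤ → Set
far true X n = X ℤ.≤ n
far false X n = n ℤ.≤ X

-- The orientation seen at infinity. As a number it equals `incr`, the growth of the charge, so a
-- part that does not change makes exactly this hop.
hop : Bool → Sign → Bool
hop true plus = true
hop true minus = false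
hop false plus = false
hop false minus = true

-- The conditions on a tiling, read on its edges. By `cover` and `in-out` an inner site is either a
-- head or a tail, never both: heads keep the kind, hole or particle, that moves on their level, and
-- the tails are the sites of the other kind, which move on the next level.
record EdgeGood (L : ℕ) (w : List Sign) (G : ℕ → ℤ → Bool → Bool) : Set where
  field
    bounded : ∀ m n b → G m n b ≡ true → m < L
    out-uniq : ∀ m n b b' → G m n b ≡ true → G m n b' ≡ true → b ≡ b'
    in-uniq : ∀ m n b n' b' → G m n b ≡ true → G m n' b' ≡ true → n ⊕ b ≡ n' ⊕ b' → b ≡ b'
    in-out : ∀ m n b b' → G m n b ≡ true → G (suc m) (n ⊕ b) b' ≡ true → ⊥
    cover : ∀ m n → suc m < L → HasOut G (suc m) n ⊎ HasIn G m n
    asym : ∀ m s → nth w m s → ∃ λ X → ∀ n → far (par m) X n → G m n (hop (par m) s) ≡ true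
    left : ∃ λ A → ∀ n → HasOut G 0 n ⇔ A ℤ.≤ n
    right : ∃ λ B → ∀ m n → suc m ≡ L → HasIn G m n ⇔ n ℤ.≤ B

halve : ∀ m → (∃ λ k → m ≡ 2 * k × par m ≡ true) ⊎ (∃ λ k → m ≡ suc (2 * k) × par m ≡ false)
halve zero = inj₁ (0 , refl , refl)
halve (suc m) with halve m
... | inj₁ (k , e , p) = inj₂ (k , cong suc e , cong not p)
... | inj₂ (k , e , p) = inj₁ (suc k , trans (cong suc e) (sym (*-suc 2 k)) , cong not p)

nth-< : ∀ w m s → nth w m s → m < length w
nth-< (t ∷ w) zero s h = s≤s z≤n
nth-< (t ∷ w) (suc m) s h = s≤s (nth-< w m s h)

par-double : ∀ k → par (2 * k) ≡ true
par-double k with halve (2 * k)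
... | inj₁ (_ , _ , p) = p
... | inj₂ (j , e , p) = ⊥-elim (even≢odd k j e)

par-last : ∀ {m} ℓ → suc m ≡ 2 * ℓ → par m ≡ false
par-last {m} ℓ e = trans (sym (not-not (par m))) (cong not (trans (cong par e) (par-double ℓ)))

no-pred : ∀ {A : Set} {P : ℕ → Set} → A ⊎ (∃ λ m → 0 ≡ suc m × P m) → A
no-pred (inj₁ x) = x

dirE-inj : ∀ p b b' → dirE p b ≡ dirE p b' → b ≡ b'
dirE-inj true true true h = refl
dirE-inj true false false h = refl
dirE-inj false true true h = refl
dirE-inj false false false h = refl

dirE-par : ∀ p b b' → ¬ dirE p b ≡ dirE (not p) b'
dirE-par true true true ()
dirE-par true true false ()
dirE-par true false true ()
dirE-par true false false ()
dirE-par false true true ()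
dirE-par false true false ()
dirE-par false false true ()
dirE-par false false false ()

dirOf+≡ : ∀ s → dirOf+ s ≡ dirE true (hop true s)
dirOf+≡ plus = refl
dirOf+≡ minus = refl

dirOf-≡ : ∀ s → dirOf- s ≡ dirE false (hop false s)
dirOf-≡ plus = refl
dirOf-≡ minus = refl

module _ {T : Tiling} (sup : Supported T) where

  covered-inv : ∀ m n → Covered T n (n ℤ.- + m) → HasOut (edge T) m n ⊎ (∃ λ m' → m ≡ suc m' × HasIn (edge T) m' n)
  covered-inv m n (o , x , y , t , cv) with sup o x y t
  ... | m' , n' , b , refl with site m n m' n' b cv
  ...   | tail = inj₁ (b , t)
  ...   | head e e' = inj₂ (m' , e , n' , b , t , e')

  coveredBy-inv : ∀ m n p b → CoveredBy T n (n ℤ.- + m) (dirE p b) →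
    (p ≡ par m × edge T m n b ≡ true) ⊎ (∃ λ m' → m ≡ suc m' × p ≡ par m' × ∃ λ n' → edge T m' n' b ≡ true × n ≡ n' ⊕ b)
  coveredBy-inv m n p b (o , x , y , t , cv , d) with sup o x y t
  ... | m' , n' , b' , refl with same p b (par m') b' (trans (sym d) (dir-edge m' n' b'))
    where
    same : ∀ p b p' b' → dirE p b ≡ dirE p' b' → p ≡ p' × b ≡ b'
    same true b true b' h = refl , dirE-inj true b b' h
    same false b false b' h = refl , dirE-inj false b b' h
    same true b false b' h = ⊥-elim (dirE-par true b b' h)
    same false b true b' h = ⊥-elim (dirE-par false b b' h)
  ...   | e , refl with site m n m' n' b' cv
  ...     | tail = inj₁ (e , t)
  ...     | head u v = inj₂ (m' , u , e , n' , t , v)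

covered-tail : ∀ T m n b → edge T m n b ≡ true → CoveredBy T n (n ℤ.- + m) (dirE (par m) b)
covered-tail T m n b t = _ , _ , _ , t , covers-tail m n b , dir-edge m n b

covered-head : ∀ T m n b → edge T m n b ≡ true → CoveredBy T (n ⊕ b) (n ⊕ b ℤ.- + suc m) (dirE (par m) b)
covered-head T m n b t = _ , _ , _ , t , covers-head m n b , dir-edge m n b

forget : ∀ {T a b d} → CoveredBy T a b d → Covered T a b
forget (o , x , y , t , cv , _) = o , x , y , t , cv

strip-supported : ∀ ℓ T → IsStripTiling ℓ T → Supported T
strip-supported ℓ T (_ , _ , st) hor x y t
  with x ℤ.- y in e | proj₁ (st x y (hor , x , y , t , inj₁ refl , refl))
... | + m | _ = m , x , true , cong (λ z → hor , x , z) (trans (sym (n-[n-m] x y)) (cong (λ z → x ℤ.- z) e))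
strip-supported ℓ T (_ , _ , st) ver x y t
  with x ℤ.- (y ℤ.+ + 1) in e | proj₁ (st x (y ℤ.+ + 1) (ver , x , y , t , refl , inj₂ refl))
... | + m | _ = m , x , false , cong (λ z → ver , x , z) (≡-from (trans (+suc m) (cong (ℤ._+ + 1) (sym e))) (lem x y (+ suc m)))
  where
  lem : ∀ x y m → y ℤ.+ (x ℤ.- (y ℤ.+ + 1) ℤ.+ + 1) ≡ x ℤ.- m ℤ.+ m
  lem = ℤS.solve-∀

n-0 : ∀ n → n ℤ.- + 0 ≡ n
n-0 = ℤS.solve-∀

good⇒edge : ∀ ℓ w T → length w ≡ 2 * ℓ → IsStripTiling ℓ T → HasAsymptoticData ℓ w T → Pure ℓ T → EdgeGood (2 * ℓ) w (edge T)
good⇒edge ℓ w T len strip@(disj , cov , st) asy (A , B , pure) = record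
  { bounded = bd
  ; out-uniq = λ m n b b' t t' → proj₂ (proj₂ (edgeDom-inj m n b m n b'
      (same m n b m n b' n (n ℤ.- + m) t t' (covers-tail m n b) (covers-tail m n b'))))
  ; in-uniq = λ m n b n' b' t t' e → proj₂ (proj₂ (edgeDom-inj m n b m n' b'
      (same m n b m n' b' (n ⊕ b) (n ⊕ b ℤ.- + suc m) t t' (covers-head m n b)
        (subst (λ z → let o , x , y = edgeDom m n' b' in Covers o x y z (z ℤ.- + suc m)) (sym e) (covers-head m n' b')))))
  ; in-out = λ m n b b' t t' → 1+n≢n (sym (proj₁ (edgeDom-inj m n b (suc m) (n ⊕ b) b'
      (same m n b (suc m) (n ⊕ b) b' (n ⊕ b) (n ⊕ b ℤ.- + suc m) t t' (covers-head m n b) (covers-tail (suc m) (n ⊕ b) b')))))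
  ; cover = cv
  ; asym = as
  ; left = A , λ n → mk⇔
      (λ (b , t) → Equivalence.to (proj₁ (pure n)) (subst (Covered T n) (n-0 n) (forget {T} (covered-tail T 0 n b t))))
      (λ h → no-pred (covered-inv sup 0 n (subst (Covered T n) (sym (n-0 n)) (Equivalence.from (proj₁ (pure n)) h))))
  ; right = B , λ m n e → mk⇔
      (λ { (n' , b , t , refl) → Equivalence.to (proj₂ (pure (n' ⊕ b)))
             (subst (λ z → Covered T (n' ⊕ b) (n' ⊕ b ℤ.- + z)) e (forget {T} (covered-head T m n' b t))) })
      (λ h → inL m n e (covered-inv sup (2 * ℓ) n (Equivalence.from (proj₂ (pure n)) h)))
  }
  where
  sup = strip-supported ℓ T strip
  same : ∀ m n b m' n' b' x y → edge T m n b ≡ true → edge T m' n' b' ≡ true →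
    (let o , p , q = edgeDom m n b in Covers o p q x y) → (let o , p , q = edgeDom m' n' b' in Covers o p q x y) →
    edgeDom m n b ≡ edgeDom m' n' b'
  same m n b m' n' b' x y t t' c1 c2 =
    let e1 , e2 , e3 = disj _ _ _ _ _ _ x y t t' c1 c2 in cong₂ _,_ e1 (cong₂ _,_ e2 e3)
  bd : ∀ m n b → edge T m n b ≡ true → m < 2 * ℓ
  bd m n b t = +-lin (subst (ℤ._≤ + (2 * ℓ)) (n-[n-m] (n ⊕ b) (+ suc m))
                 (proj₂ (st _ _ (forget {T} (covered-head T m n b t)))))
  cv : ∀ m n → suc m < 2 * ℓ → HasOut (edge T) (suc m) n ⊎ HasIn (edge T) m n
  cv m n h with covered-inv sup (suc m) n (cov n (n ℤ.- + suc m)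
      (subst (+ 1 ℤ.≤_) (sym (n-[n-m] n (+ suc m))) (ℤ.+≤+ (s≤s z≤n)))
      (≤-from (ℤ.+≤+ h) (trans (cong (ℤ._+ + (2 * ℓ)) (n-[n-m] n (+ suc m)))
         (trans (lem (+ suc m) (+ (2 * ℓ))) (cong (λ z → + (2 * ℓ) ℤ.- + 1 ℤ.+ z) (sym (+suc (suc m))))))))
    where
    lem : ∀ m l → m ℤ.+ l ≡ l ℤ.- + 1 ℤ.+ (m ℤ.+ + 1)
    lem = ℤS.solve-∀
  ... | inj₁ x = inj₁ x
  ... | inj₂ (_ , refl , x) = inj₂ x
  inL : ∀ m n → suc m ≡ 2 * ℓ → HasOut (edge T) (2 * ℓ) n ⊎ (∃ λ m' → 2 * ℓ ≡ suc m' × HasIn (edge T) m' n) → HasIn (edge T) m n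
  inL m n e (inj₁ (b , t)) = ⊥-elim (<-irrefl refl (bd (2 * ℓ) n b t))
  inL m n e (inj₂ (m' , e' , x)) = subst (λ z → HasIn (edge T) z n) (suc-injective (trans (sym e') (sym e))) x
  as : ∀ m s → nth w m s → ∃ λ X → ∀ n → far (par m) X n → edge T m n (hop (par m) s) ≡ true
  as m s h with halve m
  ... | inj₁ (k , refl , p) rewrite p =
    let k<ℓ = *-cancelˡ-< 2 k ℓ (≤-trans (nth-< w (2 * k) s h) (≤-reflexive len))
        X , f = proj₁ (asy k k<ℓ) s h
    -- The prescribed square is the head of the edge, on diagonal `suc (2 * k)`; the abscissa of its
    -- bottom right corner is one more than that of the head, hence still at least `X`.
    in X , λ n X≤n → go n (f (n ⊕ hop true s ℤ.+ + 1) (ℤP.≤-trans X≤n (≤n⊕ n (hop true s))))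
    where
    ≤n⊕ : ∀ n b → n ℤ.≤ n ⊕ b ℤ.+ + 1
    ≤n⊕ n true = ≤-from {l = + 0} {r = + 2} (ℤ.+≤+ z≤n) (l n)
      where
      l : ∀ n → n ℤ.+ + 2 ≡ n ℤ.+ + 1 ℤ.+ + 1 ℤ.+ + 0
      l = ℤS.solve-∀
    ≤n⊕ n false = ℤP.i≤i+j n (+ 1)
    lvl : ∀ z → z ℤ.+ + 1 ℤ.- + (2 * suc k) ≡ z ℤ.- + suc (2 * k)
    lvl z = trans (cong (λ t → z ℤ.+ + 1 ℤ.- + t) (*-suc 2 k)) (n-suc z (suc (2 * k)))
    go : ∀ n → (let x = n ⊕ hop true s ℤ.+ + 1 in CoveredBy T (x ℤ.- + 1) (x ℤ.- + (2 * suc k)) (dirOf+ s)) →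
         edge T (2 * k) n (hop true s) ≡ true
    go n cb with coveredBy-inv sup (suc (2 * k)) (n ⊕ hop true s) true (hop true s)
        (subst₂ (λ u v → CoveredBy T u v (dirE true (hop true s))) (m+n-n (n ⊕ hop true s) (+ 1)) (lvl (n ⊕ hop true s))
          (subst (CoveredBy T _ _) (dirOf+≡ s) cb))
    ... | inj₁ (e , _) = ⊥-elim (lem (trans e (cong not p)))
      where
      lem : ¬ true ≡ false
      lem ()
    ... | inj₂ (_ , refl , _ , n' , t , e) rewrite ⊕-cancel n n' (hop true s) e = t
  as m s h | inj₂ (k , refl , p) rewrite p =
    let k<ℓ = *-cancelˡ-< 2 k ℓ (<-trans (n<1+n _) (≤-trans (nth-< w (suc (2 * k)) s h) (≤-reflexive len)))
        X , f = proj₂ (asy k k<ℓ) s h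
    in X , λ n n≤X → go n (f n n≤X)
    where
    lvl : ∀ z → z ℤ.- + (2 * suc k) ℤ.+ + 1 ≡ z ℤ.- + suc (2 * k)
    lvl z = trans (cong (λ t → z ℤ.- + t ℤ.+ + 1) (*-suc 2 k)) (n-suc+1 z (suc (2 * k)))
    go : ∀ n → CoveredBy T n (n ℤ.- + (2 * suc k) ℤ.+ + 1) (dirOf- s) → edge T (suc (2 * k)) n (hop false s) ≡ true
    go n cb with coveredBy-inv sup (suc (2 * k)) n false (hop false s)
        (subst₂ (CoveredBy T n) (lvl n) (dirOf-≡ s) cb)
    ... | inj₁ (_ , t) = t
    ... | inj₂ (_ , refl , e , _) = ⊥-elim (lem (trans e (par-double k)))
      where
      lem : ¬ false ≡ true
      lem ()

solve-level : ∀ x y d → x ℤ.- y ≡ d → y ≡ x ℤ.- d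
solve-level x y d e = trans (sym (n-[n-m] x y)) (cong (λ z → x ℤ.- z) e)

module _ (G : ℕ → ℤ → Bool → Bool) where
  horAt verAt : ℤ → ℤ → Bool
  horAt x (+ m) = G m x true
  horAt x -[1+ _ ] = false
  verAt x (+ suc m) = G m x false
  verAt x (+ zero) = false
  verAt x -[1+ _ ] = false

  tile : Tiling
  tile hor x y = horAt x (x ℤ.- y)
  tile ver x y = verAt x (x ℤ.- y)

  edge-tile : ∀ m n b → edge tile m n b ≡ G m n b
  edge-tile m n true = cong (horAt n) (n-[n-m] n (+ m))
  edge-tile m n false = cong (verAt n) (n-[n-m] n (+ suc m))

  tile-supported : Supported tile
  tile-supported hor x y t with x ℤ.- y in e
  ... | + m = m , x , true , cong (λ z → hor , x , z) (solve-level x y (+ m) e)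
  tile-supported ver x y t with x ℤ.- y in e
  ... | + suc m = m , x , false , cong (λ z → ver , x , z) (solve-level x y (+ suc m) e)

bool-ext : ∀ {a b} → (a ≡ true → b ≡ true) → (b ≡ true → a ≡ true) → a ≡ b
bool-ext {true} {b} f g = sym (f refl)
bool-ext {false} {true} f g = g refl
bool-ext {false} {false} f g = refl

supported-ext : ∀ {T T'} → Supported T → Supported T' → (∀ m n b → edge T m n b ≡ edge T' m n b) →
  ∀ o x y → T o x y ≡ T' o x y
supported-ext {T} {T'} s s' h o x y = bool-ext (go {T} {T'} s h) (go {T'} {T} s' (λ m n b → sym (h m n b)))
  where
  go : ∀ {T T'} → Supported T → (∀ m n b → edge T m n b ≡ edge T' m n b) → T o x y ≡ true → T' o x y ≡ true
  go s h t with s o x y t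
  ... | m , n , b , refl = trans (sym (h m n b)) t

-- From edges to tilings

EdgeBound : (ℕ → ℤ → Bool → Bool) → Set
EdgeBound G = ∃ λ (B : ℕ) → ∀ m n b → G m n b ≡ true →
  (par m ≡ false → n ℤ.≤ + B) × (par m ≡ true → ℤ.- (+ B) ℤ.≤ n)

drop : Bool → ℕ
drop true = 0
drop false = 1

sum-edge : ∀ m n b → let o , x , y = edgeDom m n b in x ℤ.+ y ≡ n ℤ.+ (n ℤ.- + (drop b + m))
sum-edge m n true = refl
sum-edge m n false = refl

module _ where
  open EdgeGood

  edge⇒strip : ∀ ℓ w T → Supported T → EdgeGood (2 * ℓ) w (edge T) → IsStripTiling ℓ T
  edge⇒strip ℓ w T sup eg = disj , cov , st
    where
    level : ∀ m n b x y → (let o , p , q = edgeDom m n b in Covers o p q x y) → ∃ λ l → y ≡ x ℤ.- + l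
    level m n b x y cv with covers-inv m n b x y cv
    ... | inj₁ (refl , e) = m , e
    ... | inj₂ (refl , e) = suc m , e
    meet : ∀ l z m n b m' n' b' → edge T m n b ≡ true → edge T m' n' b' ≡ true →
      Meets l z m n b → Meets l z m' n' b' → edgeDom m n b ≡ edgeDom m' n' b'
    meet l z m n b m' n' b' t t' tail tail = cong (edgeDom m n) (out-uniq eg m n b b' t t')
    meet l z m n b m' n' b' t t' tail (head refl refl) = ⊥-elim (in-out eg m' n' b' b t' t)
    meet l z m n b m' n' b' t t' (head refl refl) tail = ⊥-elim (in-out eg m n b b' t t')
    meet l z m n b m' n' b' t t' (head refl refl) (head refl e) with in-uniq eg m n b n' b' t t' e
    ... | refl with ⊕-cancel n n' b e
    ...   | refl = refl
    disj : DisjointInteriors T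
    disj o x y o' x' y' a a' t t' cv cv' with sup o x y t | sup o' x' y' t'
    ... | m , n , b , refl | m' , n' , b' , refl with level m n b a a' cv
    ...   | l , refl with meet l a m n b m' n' b' t t' (site l a m n b cv) (site l a m' n' b' cv')
    ...     | e = cong proj₁ e , cong (proj₁ ∘ proj₂) e , cong (proj₂ ∘ proj₂) e
    cov : ∀ a a' → + 1 ℤ.≤ a ℤ.- a' → a ℤ.- a' ℤ.≤ + (2 * ℓ) ℤ.- + 1 → Covered T a a'
    cov a a' h h' with a ℤ.- a' in e
    cov a a' (ℤ.+≤+ ()) h' | + zero
    ... | + suc m rewrite solve-level a a' (+ suc m) e with cover eg m a
            (+-lin (≤-from h' (trans (cong (ℤ._+ (+ (2 * ℓ) ℤ.- + 1)) (+suc (suc m))) (lem (+ suc m) (+ (2 * ℓ))))))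
      where
      lem : ∀ m l → m ℤ.+ + 1 ℤ.+ (l ℤ.- + 1) ≡ l ℤ.+ m
      lem = ℤS.solve-∀
    ...   | inj₁ (b , t) = forget {T} (covered-tail T (suc m) a b t)
    ...   | inj₂ (n' , b , t , refl) = forget {T} (covered-head T m n' b t)
    st : ∀ a a' → Covered T a a' → + 0 ℤ.≤ a ℤ.- a' × a ℤ.- a' ℤ.≤ + (2 * ℓ)
    st a a' (o , x , y , t , cv) with sup o x y t
    ... | m , n , b , refl with covers-inv m n b a a' cv
    ...   | inj₁ (refl , refl) rewrite n-[n-m] n (+ m) = ℤ.+≤+ z≤n , ℤ.+≤+ (<⇒≤ (bounded eg m n b t))
    ...   | inj₂ (refl , refl) rewrite n-[n-m] (n ⊕ b) (+ suc m) = ℤ.+≤+ z≤n , ℤ.+≤+ (bounded eg m n b t)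

  edge⇒pure : ∀ ℓ w T → 1 ≤ ℓ → Supported T → EdgeGood (2 * ℓ) w (edge T) → Pure ℓ T
  edge⇒pure ℓ w T 1≤ℓ sup eg = proj₁ (left eg) , proj₁ (right eg) , λ n →
    mk⇔ (λ cv → Equivalence.to (proj₂ (left eg) n) (no-pred (covered-inv sup 0 n (subst (Covered T n) (sym (n-0 n)) cv))))
        (λ h → let b , t = Equivalence.from (proj₂ (left eg) n) h
               in subst (Covered T n) (n-0 n) (forget {T} (covered-tail T 0 n b t))) ,
    mk⇔ (λ cv → atTop n (covered-inv sup (2 * ℓ) n cv))
        (λ h → fromTop n h)
    where
    pred' : ∃ λ m → suc m ≡ 2 * ℓ
    pred' = _ , m+[n∸m]≡n {1} (≤-trans 1≤ℓ (m≤m+n ℓ _))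
    atTop : ∀ n → HasOut (edge T) (2 * ℓ) n ⊎ (∃ λ m' → 2 * ℓ ≡ suc m' × HasIn (edge T) m' n) → n ℤ.≤ proj₁ (right eg)
    atTop n (inj₁ (b , t)) = ⊥-elim (<-irrefl refl (bounded eg (2 * ℓ) n b t))
    atTop n (inj₂ (m , e , x)) = Equivalence.to (proj₂ (right eg) m n (sym e)) x
    fromTop : ∀ n → n ℤ.≤ proj₁ (right eg) → Covered T n (n ℤ.- + (2 * ℓ))
    fromTop n h with Equivalence.from (proj₂ (right eg) (proj₁ pred') n (proj₂ pred')) h
    ... | n' , b , t , refl = subst (λ z → Covered T (n' ⊕ b) (n' ⊕ b ℤ.- + z)) (proj₂ pred') (forget {T} (covered-head T _ n' b t))

  edge⇒steep : ∀ ℓ w T → Supported T → EdgeGood (2 * ℓ) w (edge T) → EdgeBound (edge T) → Steep T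
  edge⇒steep ℓ w T sup eg (B , bd) = B' , go
    where
    -- Coordinate sums are `2n` minus at most `2 * ℓ`, with `n` bounded by `B` on the side that
    -- matters.
    B' = + B ℤ.+ + B ℤ.+ + (2 * ℓ)
    dirs : ∀ p b → (p ≡ true × (dirE p b ≡ N ⊎ dirE p b ≡ E)) ⊎ (p ≡ false × (dirE p b ≡ S ⊎ dirE p b ≡ W))
    dirs true true = inj₁ (refl , inj₁ refl)
    dirs true false = inj₁ (refl , inj₂ refl)
    dirs false true = inj₂ (refl , inj₁ refl)
    dirs false false = inj₂ (refl , inj₂ refl)
    lower : ∀ n m' → ℤ.- (+ B) ℤ.≤ n → m' ≤ 2 * ℓ → ℤ.- B' ℤ.≤ n ℤ.+ (n ℤ.- + m')
    lower n m' h k = ≤-from (ℤP.+-mono-≤ (ℤP.+-mono-≤ h h) (ℤ.+≤+ k)) (lem n (+ m') (+ B) (+ (2 * ℓ)))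
      where
      lem : ∀ n m B l → ℤ.- (B ℤ.+ B ℤ.+ l) ℤ.+ (n ℤ.+ n ℤ.+ l) ≡ n ℤ.+ (n ℤ.- m) ℤ.+ (ℤ.- B ℤ.+ ℤ.- B ℤ.+ m)
      lem = ℤS.solve-∀
    upper : ∀ n m' → n ℤ.≤ + B → n ℤ.+ (n ℤ.- + m') ℤ.≤ B'
    upper n m' h = ℤP.≤-trans (ℤP.+-mono-≤ h (ℤP.≤-trans (ℤP.i-j≤i n (+ m')) h)) (ℤP.i≤i+j _ (+ (2 * ℓ)))
    drop≤ : ∀ m b → m < 2 * ℓ → drop b + m ≤ 2 * ℓ
    drop≤ m true h = <⇒≤ h
    drop≤ m false h = h
    go : ∀ o x y → T o x y ≡ true →
      (B' ℤ.< x ℤ.+ y → (dir o x y ≡ N ⊎ dir o x y ≡ E)) ×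
      (x ℤ.+ y ℤ.+ + 3 ℤ.< ℤ.- B' → (dir o x y ≡ S ⊎ dir o x y ≡ W))
    go o x y t with sup o x y t
    ... | m , n , b , refl rewrite dir-edge m n b | sum-edge m n b with dirs (par m) b
    ...   | inj₁ (p , d) = (λ _ → d) , λ h → ⊥-elim (ℤP.<-irrefl refl (ℤP.<-≤-trans h
              (ℤP.≤-trans (lower n (drop b + m) (proj₂ (bd m n b t) p) (drop≤ m b (bounded eg m n b t))) (ℤP.i≤i+j _ (+ 3)))))
    ...   | inj₂ (p , d) = (λ h → ⊥-elim (ℤP.<-irrefl refl (ℤP.<-≤-trans h
              (upper n (drop b + m) (proj₁ (bd m n b t) p))))) , λ _ → d

  edge⇒asym : ∀ ℓ w T → Supported T → EdgeGood (2 * ℓ) w (edge T) → HasAsymptoticData ℓ w T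
  edge⇒asym ℓ w T sup eg k k<ℓ = even , odd
    where
    even : ∀ s → nth w (2 * k) s → ∃ λ X → ∀ x → X ℤ.≤ x → CoveredBy T (x ℤ.- + 1) (x ℤ.- + (2 * suc k)) (dirOf+ s)
    even s h with asym eg (2 * k) s h
    -- The square at `x - 1` is the head; its tail is at `x - 1` or `x - 2`, whence the margin of
    -- two.
    ... | X , f rewrite par-double k = X ℤ.+ + 2 , λ x Xx → go x (f (x ℤ.- + 1 ℤ.- step (hop true s)) (far' x (hop true s) Xx))
      where
      step : Bool → ℤ
      step true = + 1
      step false = + 0
      far' : ∀ x b → X ℤ.+ + 2 ℤ.≤ x → X ℤ.≤ x ℤ.- + 1 ℤ.- step b
      far' x true h = ≤-from h (l X x)
        where
        l : ∀ X x → X ℤ.+ x ≡ x ℤ.- + 1 ℤ.- + 1 ℤ.+ (X ℤ.+ + 2)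
        l = ℤS.solve-∀
      far' x false h = ≤-from (ℤP.≤-trans (ℤP.+-monoʳ-≤ X (ℤ.+≤+ (s≤s z≤n))) h) (l X x)
        where
        l : ∀ X x → X ℤ.+ x ≡ x ℤ.- + 1 ℤ.- + 0 ℤ.+ (X ℤ.+ + 1)
        l = ℤS.solve-∀
      back : ∀ x b → x ℤ.- + 1 ℤ.- step b ⊕ b ≡ x ℤ.- + 1
      back x true = l (x ℤ.- + 1)
        where
        l : ∀ x → x ℤ.- + 1 ℤ.+ + 1 ≡ x
        l = ℤS.solve-∀
      back x false = n-0 (x ℤ.- + 1)
      lvl : ∀ x → x ℤ.- + 1 ℤ.- + suc (2 * k) ≡ x ℤ.- + (2 * suc k)
      lvl x = trans (l x (+ suc (2 * k))) (cong (λ t → x ℤ.- t) (trans (sym (+suc (suc (2 * k)))) (cong +_ (sym (*-suc 2 k)))))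
        where
        l : ∀ x m → x ℤ.- + 1 ℤ.- m ≡ x ℤ.- (m ℤ.+ + 1)
        l = ℤS.solve-∀
      go : ∀ x → edge T (2 * k) (x ℤ.- + 1 ℤ.- step (hop true s)) (hop true s) ≡ true →
        CoveredBy T (x ℤ.- + 1) (x ℤ.- + (2 * suc k)) (dirOf+ s)
      go x t = subst (CoveredBy T _ _) (trans (cong (λ p → dirE p (hop true s)) (par-double k)) (sym (dirOf+≡ s)))
        (subst₂ (λ u v → CoveredBy T u v (dirE (par (2 * k)) (hop true s))) (back x (hop true s))
          (trans (cong (ℤ._- + suc (2 * k)) (back x (hop true s))) (lvl x)) (covered-head T (2 * k) _ (hop true s) t))
    odd : ∀ s → nth w (suc (2 * k)) s → ∃ λ X → ∀ x → x ℤ.≤ X → CoveredBy T x (x ℤ.- + (2 * suc k) ℤ.+ + 1) (dirOf- s)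
    odd s h with asym eg (suc (2 * k)) s h
    ... | X , f rewrite par-double k = X , λ x xX → go x (f x xX)
      where
      go : ∀ x → edge T (suc (2 * k)) x (hop false s) ≡ true → CoveredBy T x (x ℤ.- + (2 * suc k) ℤ.+ + 1) (dirOf- s)
      go x t = subst₂ (CoveredBy T x)
        (sym (trans (cong (λ z → x ℤ.- + z ℤ.+ + 1) (*-suc 2 k)) (n-suc+1 x (suc (2 * k)))))
        (trans (cong (λ p → dirE (not p) (hop false s)) (par-double k)) (sym (dirOf-≡ s)))
        (covered-tail T (suc (2 * k)) x (hop false s) t)

  edge⇒good : ∀ ℓ w T → 1 ≤ ℓ → Supported T → EdgeGood (2 * ℓ) w (edge T) → EdgeBound (edge T) → Good ℓ w T
  edge⇒good ℓ w T 1≤ℓ sup eg eb = edge⇒strip ℓ w T sup eg , edge⇒steep ℓ w T sup eg eb ,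
    edge⇒asym ℓ w T sup eg , edge⇒pure ℓ w T 1≤ℓ sup eg

-- Flips

isDom-sound : ∀ o x y o' x' y' → isDom o x y o' x' y' ≡ true → (o' , x' , y') ≡ (o , x , y)
isDom-sound hor x y hor x' y' h with x ℤ.≟ x' | y ℤ.≟ y'
... | yes refl | yes refl = refl
isDom-sound ver x y ver x' y' h with x ℤ.≟ x' | y ℤ.≟ y'
... | yes refl | yes refl = refl

isDom-refl : ∀ o x y → isDom o x y o x y ≡ true
isDom-refl hor x y with x ℤ.≟ x | y ℤ.≟ y
... | yes _ | yes _ = refl
... | no h | _ = ⊥-elim (h refl)
... | yes _ | no h = ⊥-elim (h refl)
isDom-refl ver x y with x ℤ.≟ x | y ℤ.≟ y
... | yes _ | yes _ = refl
... | no h | _ = ⊥-elim (h refl)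
... | yes _ | no h = ⊥-elim (h refl)

∨-true : ∀ {a b} → a ∨ b ≡ true → a ≡ true ⊎ b ≡ true
∨-true {true} h = inj₁ refl
∨-true {false} h = inj₂ h

∨-left : ∀ {a b} → a ≡ true → a ∨ b ≡ true
∨-left refl = refl

∨-right : ∀ {a b} → b ≡ true → a ∨ b ≡ true
∨-right {true} _ = refl
∨-right {false} h = h

horPairAt verPairAt : ℕ → ℤ → Orient → ℤ → ℤ → Bool
horPairAt m n = horPair n (n ℤ.- + suc m)
verPairAt m n = verPair n (n ℤ.- + suc m)

-- The 2 by 2 square with lower left corner `(n , n - suc m)` meets the diagonals `m`, `suc m`
-- (twice) and `suc (suc m)`. Either pair of dominos thus has one edge entering diagonal `suc m`,
-- with index `true`, and one leaving it, with index `false`.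
flipEdge : Bool → Bool → ℕ → ℤ → Domino
flipEdge true true m n = edgeDom m n true
flipEdge true false m n = edgeDom (suc m) n true
flipEdge false true m n = edgeDom m n false
flipEdge false false m n = edgeDom (suc m) (n ℤ.+ + 1) false

pairAt : Bool → ℕ → ℤ → Orient → ℤ → ℤ → Bool
pairAt true = horPairAt
pairAt false = verPairAt

pairAt-sound : ∀ h m n o x y → pairAt h m n o x y ≡ true → ∃ λ i → (o , x , y) ≡ flipEdge h i m n
pairAt-sound true m n o x y e with ∨-true {isDom hor n (n ℤ.- + suc m) o x y} e
... | inj₁ p = false , isDom-sound hor _ _ o x y p
... | inj₂ p = true , trans (isDom-sound hor _ _ o x y p) (cong (λ z → hor , n , z) (n-suc+1 n m))
pairAt-sound false m n o x y e with ∨-true {isDom ver n (n ℤ.- + suc m) o x y} e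
... | inj₁ p = true , isDom-sound ver _ _ o x y p
... | inj₂ p = false , trans (isDom-sound ver _ _ o x y p) (cong (λ z → ver , n ℤ.+ + 1 , z) (sym (n-suc n (suc m))))

pairAt-complete : ∀ h m n i → let o , x , y = flipEdge h i m n in pairAt h m n o x y ≡ true
pairAt-complete true m n true = ∨-right {isDom hor n (n ℤ.- + suc m) hor n (n ℤ.- + m)}
  (subst (λ z → isDom hor n z hor n (n ℤ.- + m) ≡ true) (sym (n-suc+1 n m)) (isDom-refl hor n (n ℤ.- + m)))
pairAt-complete true m n false = ∨-left (isDom-refl hor n _)
pairAt-complete false m n true = ∨-left (isDom-refl ver n _)
pairAt-complete false m n false = ∨-right {isDom ver n (n ℤ.- + suc m) ver (n ℤ.+ + 1) (n ℤ.+ + 1 ℤ.- + suc (suc m))}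
  (subst (λ z → isDom ver (n ℤ.+ + 1) (n ℤ.- + suc m) ver (n ℤ.+ + 1) z ≡ true) (sym (n-suc n (suc m)))
    (isDom-refl ver (n ℤ.+ + 1) (n ℤ.- + suc m)))

replace-bool : ∀ {t t' r a} → (r ≡ true → t ≡ true × t' ≡ false) → (a ≡ true → t ≡ false × t' ≡ true) →
  (r ≡ false → a ≡ false → t ≡ t') → t' ≡ ((t ∧ not r) ∨ a)
replace-bool {t} {t'} {true} {true} f g k with trans (sym (proj₁ (f refl))) (proj₁ (g refl))
... | ()
replace-bool {t} {t'} {true} {false} f g k rewrite proj₁ (f refl) | proj₂ (f refl) = refl
replace-bool {t} {t'} {false} {true} f g k rewrite proj₁ (g refl) | proj₂ (g refl) = refl
replace-bool {true} {t'} {false} {false} f g k = sym (k refl refl)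
replace-bool {false} {t'} {false} {false} f g k = sym (k refl refl)

flipRel : Bool → ℕ → ℤ → Tiling → Tiling → Set
flipRel h m n T T' = (∀ i → T ∋ flipEdge h i m n) × Replace (pairAt h m n) (pairAt (not h) m n) T T'

flipRel⇒Flip : ∀ h m n T T' → flipRel h m n T T' → Flip T T'
flipRel⇒Flip true m n T T' (t , r) = n , n ℤ.- + suc m ,
  inj₁ (t false , subst (λ z → T hor n z ≡ true) (sym (n-suc+1 n m)) (t true) , r)
flipRel⇒Flip false m n T T' (t , r) = n , n ℤ.- + suc m ,
  inj₂ (t true , subst (λ z → T ver (n ℤ.+ + 1) z ≡ true) (n-suc n (suc m)) (t false) , r)

Flip⇒flipRel : ∀ {T T'} → Supported T → Flip T T' → ∃ λ h → ∃ λ m → ∃ λ n → flipRel h m n T T'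
Flip⇒flipRel {T} {T'} sup (a , b , inj₁ (t₁ , t₂ , r)) with sup hor a b t₁ | sup hor a (b ℤ.+ + 1) t₂
... | m , n , true , refl | m' , n' , true , e with cong (proj₁ ∘ proj₂) e
...   | refl with level-inj n m (suc m') (trans (sym (m+n-n (n ℤ.- + m) (+ 1))) (trans (cong (ℤ._- + 1) (cong (proj₂ ∘ proj₂) e)) (lem n m')))
  where
  lem : ∀ n m' → n ℤ.- + m' ℤ.- + 1 ≡ n ℤ.- + suc m'
  lem n m' = trans (cong (ℤ._- + 1) (sym (n-suc+1 n m'))) (m+n-n _ (+ 1))
...     | refl = true , m' , n , (λ { true → subst (λ z → T hor n z ≡ true) (n-suc+1 n m') t₂ ; false → t₁ }) , r
Flip⇒flipRel {T} {T'} sup (a , b , inj₁ (t₁ , t₂ , r)) | _ , _ , false , () | _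
Flip⇒flipRel {T} {T'} sup (a , b , inj₁ (t₁ , t₂ , r)) | _ , _ , true , _ | _ , _ , false , ()
Flip⇒flipRel {T} {T'} sup (a , b , inj₂ (t₁ , t₂ , r)) with sup ver a b t₁
... | m , n , false , refl = false , m , n ,
  (λ { true → t₁ ; false → subst (λ z → T ver (n ℤ.+ + 1) z ≡ true) (sym (n-suc n (suc m))) t₂ }) , r
Flip⇒flipRel {T} {T'} sup (a , b , inj₂ (t₁ , t₂ , r)) | _ , _ , true , ()

Replace-unique : ∀ {r a T T' T''} → Replace r a T T' → Replace r a T T'' → ∀ o x y → T' o x y ≡ T'' o x y
Replace-unique h k o x y = trans (h o x y) (sym (k o x y))

mkFlipRel : ∀ h m n T T' → Supported T → Supported T' →
  (∀ i → T ∋ flipEdge h i m n) → (∀ i → T' ∋ flipEdge (not h) i m n) →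
  (∀ i → ¬ T' ∋ flipEdge h i m n) → (∀ i → ¬ T ∋ flipEdge (not h) i m n) →
  (∀ m' n' b → (∀ g i → ¬ edgeDom m' n' b ≡ flipEdge g i m n) → edge T m' n' b ≡ edge T' m' n' b) →
  flipRel h m n T T'
mkFlipRel h m n T T' sup sup' th t'v t'h tv same = th , λ o x y → replace-bool (rem o x y) (add o x y) (rest o x y)
  where
  ¬true : ∀ {b} → ¬ b ≡ true → b ≡ false
  ¬true {true} k = ⊥-elim (k refl)
  ¬true {false} k = refl
  rem : ∀ o x y → pairAt h m n o x y ≡ true → T o x y ≡ true × T' o x y ≡ false
  rem o x y e with pairAt-sound h m n o x y e
  ... | i , refl = th i , ¬true (t'h i)
  add : ∀ o x y → pairAt (not h) m n o x y ≡ true → T o x y ≡ false × T' o x y ≡ true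
  add o x y e with pairAt-sound (not h) m n o x y e
  ... | i , refl = ¬true (tv i) , t'v i
  off : ∀ o x y → pairAt h m n o x y ≡ false → pairAt (not h) m n o x y ≡ false →
    ∀ g i → ¬ (o , x , y) ≡ flipEdge g i m n
  off o x y p q g i refl with trichotomy h g
    where
    trichotomy : ∀ h g → g ≡ h ⊎ g ≡ not h
    trichotomy true true = inj₁ refl
    trichotomy true false = inj₂ refl
    trichotomy false true = inj₂ refl
    trichotomy false false = inj₁ refl
  ... | inj₁ refl with trans (sym p) (pairAt-complete g m n i)
  ...   | ()
  off o x y p q g i refl | inj₂ refl with trans (sym q) (pairAt-complete (not h) m n i)
  ...   | ()
  rest : ∀ o x y → pairAt h m n o x y ≡ false → pairAt (not h) m n o x y ≡ false → T o x y ≡ T' o x y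
  rest o x y p q = bool-ext to from
    where
    to : T o x y ≡ true → T' o x y ≡ true
    to t with sup o x y t
    ... | m' , n' , b , refl = trans (sym (same m' n' b (off _ _ _ p q))) t
    from : T' o x y ≡ true → T o x y ≡ true
    from t with sup' o x y t
    ... | m' , n' , b , refl = trans (same m' n' b (off _ _ _ p q)) t

-- Positions of particles and holes

part : Bool → Part → ℕ → ℕ
part p l = row (orient p l)

-- pos true lists the holes from left to right, pos false the particles from
-- right to left, in the configuration of charge z and partition l.
pos : Bool → ℤ → Part → ℕ → ℤ
pos true z l k = z ℤ.+ + k ℤ.- + col l k
pos false z l k = z ℤ.- + suc k ℤ.+ + row l k

part-anti : ∀ p l {k k'} → k ≤ k' → part p l k' ≤ part p l k
part-anti p l = row-anti (orient p l)

part-cong : ∀ p {l l'} → l ≈ l' → ∀ k → part p l k ≡ part p l' k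
part-cong p {l} {l'} h = orient-cong p {l} {l'} h

pos-cong : ∀ p z l z' l' k → z ≡ z' → part p l k ≡ part p l' k → pos p z l k ≡ pos p z' l' k
pos-cong true z l z' l' k refl e = cong (λ t → z ℤ.+ + k ℤ.- + t) e
pos-cong false z l z' l' k refl e = cong (λ t → z ℤ.- + suc k ℤ.+ + t) e

pos-true-≡ : ∀ z j a j' a' → z ℤ.+ + j ℤ.- + a ≡ z ℤ.+ + j' ℤ.- + a' → j + a' ≡ j' + a
pos-true-≡ z j a j' a' h = ℤP.+-injective (≡-from h (lem z (+ j) (+ a) (+ j') (+ a')))
  where
  lem : ∀ z j a j' a' → j ℤ.+ a' ℤ.+ (z ℤ.+ j' ℤ.- a') ≡ j' ℤ.+ a ℤ.+ (z ℤ.+ j ℤ.- a)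
  lem = ℤS.solve-∀

pos-false-≡ : ∀ z i a i' a' → z ℤ.- + i ℤ.+ + a ≡ z ℤ.- + i' ℤ.+ + a' → i' + a ≡ i + a'
pos-false-≡ z i a i' a' h = ℤP.+-injective (≡-from h (lem z (+ i) (+ a) (+ i') (+ a')))
  where
  lem : ∀ z i a i' a' → i' ℤ.+ a ℤ.+ (z ℤ.- i' ℤ.+ a') ≡ i ℤ.+ a' ℤ.+ (z ℤ.- i ℤ.+ a)
  lem = ℤS.solve-∀

pos-mixed-≡ : ∀ z j a i b → z ℤ.+ + j ℤ.- + a ≡ z ℤ.- + i ℤ.+ + b → j + i ≡ b + a
pos-mixed-≡ z j a i b h = ℤP.+-injective (≡-from h (lem z (+ j) (+ a) (+ i) (+ b)))
  where
  lem : ∀ z j a i b → j ℤ.+ i ℤ.+ (z ℤ.- i ℤ.+ b) ≡ b ℤ.+ a ℤ.+ (z ℤ.+ j ℤ.- a)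
  lem = ℤS.solve-∀

pos-<-≢ : ∀ p z l {k k'} → k < k' → ¬ pos p z l k ≡ pos p z l k'
pos-<-≢ true z l {k} {k'} h e = <-irrefl (pos-true-≡ z k _ k' _ e) (+-mono-<-≤ h (row-anti (dual l) (<⇒≤ h)))
pos-<-≢ false z l {k} {k'} h e =
  <-irrefl (sym (pos-false-≡ z (suc k) _ (suc k') _ e)) (+-mono-<-≤ (s≤s h) (row-anti l (<⇒≤ h)))

pos-inj : ∀ p z l {k k'} → pos p z l k ≡ pos p z l k' → k ≡ k'
pos-inj p z l {k} {k'} e with <-cmp k k'
... | tri< h _ _ = ⊥-elim (pos-<-≢ p z l h e)
... | tri≈ _ h _ = h
... | tri> _ _ h = ⊥-elim (pos-<-≢ p z l h (sym e))

-- Equal positions would mean that row `i` and column `j` have total length `i + j + 1`. If the box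
-- `(i , j)` is present the total is at least `i + j + 2`, otherwise at most `i + j`.
holes-particles : ∀ z l j i → ¬ pos true z l j ≡ pos false z l i
holes-particles z l j i e with j <? row l i
... | yes h = <-irrefl (pos-mixed-≡ z j (col l j) (suc i) (row l i) e) (+-mono-<-≤ h (r→c l h))
... | no h = <-irrefl (sym (pos-mixed-≡ z j (col l j) (suc i) (row l i) e))
        (≤-trans (s≤s (+-mono-≤ (≮⇒≥ h) (≮⇒≥ (h ∘ c→r l)))) (≤-reflexive (sym (+-suc j i))))

pos-excl : ∀ p z l k k' → ¬ pos p z l k ≡ pos (not p) z l k'
pos-excl true z l k k' e = holes-particles z l k k' e
pos-excl false z l k k' e = holes-particles z l k' k (sym e)

module _ (z : ℤ) (l : Part) (n : ℤ) where
  private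
    Found : Set
    Found = (∃ λ j → n ≡ pos true z l j) ⊎ (∃ λ i → n ≡ pos false z l i)

    -- With `i` particles to the right of `n`, the hole at `n` must have the number `j` with
    -- `n = z + j - i`. That particle `i` lies to the left and its predecessor to the right of `n`
    -- says that column `j` has length `i`.
    hole : ∀ i → (∀ i' → i ≡ suc i' → n ℤ.< pos false z l i') → pos false z l i ℤ.< n → Found
    hole i above below = inj₁ (j , trans nj (cong (λ t → z ℤ.+ + j ℤ.- + t) (sym col≡)))
      where
      row≤ : + row l i ℤ.≤ n ℤ.- z ℤ.+ + i
      row≤ = ≤-from (ℤP.i<j⇒suc[i]≤j below)
        (trans (lem z n (+ i) (+ row l i)) (cong (λ t → n ℤ.- z ℤ.+ + i ℤ.+ (+ 1 ℤ.+ (z ℤ.- t ℤ.+ + row l i))) (sym (+suc i))))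
        where
        lem : ∀ z n i r → r ℤ.+ n ≡ n ℤ.- z ℤ.+ i ℤ.+ (+ 1 ℤ.+ (z ℤ.- (i ℤ.+ + 1) ℤ.+ r))
        lem = ℤS.solve-∀
      nat : ∀ {r d} → + r ℤ.≤ d → ∃ λ j → + j ≡ d
      nat (ℤ.+≤+ {n = j} _) = j , refl
      j : ℕ
      j = proj₁ (nat row≤)
      nj : n ≡ z ℤ.+ + j ℤ.- + i
      nj = sym (trans (cong (λ t → z ℤ.+ t ℤ.- + i) (proj₂ (nat row≤))) (lem z n (+ i)))
        where
        lem : ∀ z n i → z ℤ.+ (n ℤ.- z ℤ.+ i) ℤ.- i ≡ n
        lem = ℤS.solve-∀
      row≤j : row l i ≤ j
      row≤j = +-lin (subst (+ row l i ℤ.≤_) (sym (proj₂ (nat row≤))) row≤)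
      i≤col : i ≤ col l j
      i≤col = lower i refl
        where
        lower : ∀ i' → i ≡ i' → i' ≤ col l j
        lower zero e = z≤n
        lower (suc i') refl = r→c l (+-lin (≤-from (ℤP.i<j⇒suc[i]≤j (subst (ℤ._< pos false z l i') nj (above i' refl)))
          (lem z (+ j) (+ suc i') (+ row l i'))))
          where
          lem : ∀ z j i r → (+ 1 ℤ.+ j) ℤ.+ (z ℤ.- i ℤ.+ r) ≡ r ℤ.+ (+ 1 ℤ.+ (z ℤ.+ j ℤ.- i))
          lem = ℤS.solve-∀
      col≡ : col l j ≡ i
      col≡ = ≤-antisym (≮⇒≥ (λ h → <-irrefl refl (<-≤-trans (c→r l h) row≤j))) i≤col

    search : ∀ fuel i → (∀ i' → i ≡ suc i' → n ℤ.< pos false z l i') → pos false z l (fuel + i) ℤ.≤ n → Found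
    search fuel i above end with ℤP.<-cmp (pos false z l i) n
    ... | tri≈ _ e _ = inj₂ (i , sym e)
    ... | tri< h _ _ = hole i above h
    search zero i above end | tri> _ _ h = ⊥-elim (ℤP.<-irrefl refl (ℤP.<-≤-trans h end))
    search (suc fuel) i above end | tri> _ _ h =
      search fuel (suc i) (λ { _ refl → h }) (subst (λ t → pos false z l t ℤ.≤ n) (sym (+-suc fuel i)) end)

    -- No part exceeds `row l 0`, so the particle with this number is already at or to the left of
    -- `n`.
    start : ℕ
    start = ∣ z ℤ.- n ∣ + row l 0

    start-≤ : pos false z l (start + 0) ℤ.≤ n
    start-≤ rewrite +-identityʳ start =
      ≤-from (ℤP.+-mono-≤ (≤+∣∣ (z ℤ.- n)) (ℤP.≤-trans (ℤ.+≤+ (row-anti l z≤n)) (ℤP.i≤i+j (+ row l 0) (+ 1))))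
        (trans (cong (λ t → z ℤ.- t ℤ.+ + row l start ℤ.+ (+ ∣ z ℤ.- n ∣ ℤ.+ (+ row l 0 ℤ.+ + 1))) (+suc start))
          (lem z n (+ ∣ z ℤ.- n ∣) (+ row l 0) (+ row l start)))
      where
      lem : ∀ z n a r s → z ℤ.- (a ℤ.+ r ℤ.+ + 1) ℤ.+ s ℤ.+ (a ℤ.+ (r ℤ.+ + 1)) ≡ n ℤ.+ (z ℤ.- n ℤ.+ s)
      lem = ℤS.solve-∀

  hole-or-particle : (∃ λ j → n ≡ pos true z l j) ⊎ (∃ λ i → n ≡ pos false z l i)
  hole-or-particle = search start 0 (λ _ ()) start-≤

pos-cover : ∀ p z l n → (∃ λ k → n ≡ pos p z l k) ⊎ (∃ λ k → n ≡ pos (not p) z l k)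
pos-cover true z l n = hole-or-particle z l n
pos-cover false z l n with hole-or-particle z l n
... | inj₁ x = inj₂ x
... | inj₂ x = inj₁ x

data Move (s : Sign) (a b : ℕ) : Bool → Set where
  still : a ≡ b → Move s a b true
  grow : s ≡ plus → b ≡ suc a → Move s a b false
  shrink : s ≡ minus → a ≡ suc b → Move s a b false

agree : Bool → Bool → Bool
agree true b = b
agree false b = not b

-- The charge grows by `incr p s`, the hop of an unchanged part. A part that changes by one box
-- makes the opposite hop, for holes as well as for particles; this is what `agree e` expresses.
move-pos : ∀ p s z l l' k e → Move s (part p l k) (part p l' k) e →
  pos p z l k ⊕ agree e (hop p s) ≡ pos p (z ℤ.+ + incr p s) l' k
move-pos true plus z l l' k true (still h) rewrite h = lem z (+ k) (+ col l' k)
  where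
  lem : ∀ z k a → z ℤ.+ k ℤ.- a ℤ.+ + 1 ≡ z ℤ.+ + 1 ℤ.+ k ℤ.- a
  lem = ℤS.solve-∀
move-pos true plus z l l' k false (grow _ h) rewrite h = sym
  (trans (cong (λ t → z ℤ.+ + 1 ℤ.+ + k ℤ.- t) (+suc (col l k))) (lem z (+ k) (+ col l k)))
  where
  lem : ∀ z k a → z ℤ.+ + 1 ℤ.+ k ℤ.- (a ℤ.+ + 1) ≡ z ℤ.+ k ℤ.- a
  lem = ℤS.solve-∀
move-pos true minus z l l' k true (still h) rewrite h = cong (λ t → t ℤ.+ + k ℤ.- + col l' k) (sym (ℤP.+-identityʳ z))
move-pos true minus z l l' k false (shrink _ h) rewrite h =
  trans (n-suc+1 (z ℤ.+ + k) (col l' k)) (cong (λ t → t ℤ.+ + k ℤ.- + col l' k) (sym (ℤP.+-identityʳ z)))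
move-pos false plus z l l' k true (still h) rewrite h = cong (λ t → t ℤ.- + suc k ℤ.+ + row l' k) (sym (ℤP.+-identityʳ z))
move-pos false plus z l l' k false (grow _ h) rewrite h =
  trans (ℤP.+-assoc (z ℤ.- + suc k) (+ row l k) (+ 1))
    (cong₂ (λ t u → t ℤ.- + suc k ℤ.+ u) (sym (ℤP.+-identityʳ z)) (sym (+suc (row l k))))
move-pos false minus z l l' k true (still h) rewrite h = lem z (+ suc k) (+ row l' k)
  where
  lem : ∀ z k a → z ℤ.- k ℤ.+ a ℤ.+ + 1 ≡ z ℤ.+ + 1 ℤ.- k ℤ.+ a
  lem = ℤS.solve-∀
move-pos false minus z l l' k false (shrink _ h) rewrite h =
  trans (cong (λ t → z ℤ.- + suc k ℤ.+ t) (+suc (row l' k))) (lem z (+ suc k) (+ row l' k))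
  where
  lem : ∀ z k a → z ℤ.- k ℤ.+ (a ℤ.+ + 1) ≡ z ℤ.+ + 1 ℤ.- k ℤ.+ a
  lem = ℤS.solve-∀

≤-suc-cases : ∀ {a b} → a ≤ b → b ≤ suc a → a ≡ b ⊎ b ≡ suc a
≤-suc-cases {a} {b} h h' with b ≤? a
... | yes k = inj₁ (≤-antisym h k)
... | no k = inj₂ (≤-antisym h' (≰⇒> k))

step-move : ∀ p s l l' → Step p s l l' → ∀ k → ∃ (Move s (part p l k) (part p l' k))
step-move p plus l l' st k with ≤-suc-cases (proj₁ (st k)) (proj₂ (st k))
... | inj₁ e = true , still e
... | inj₂ e = false , grow refl e
step-move p minus l l' st k with ≤-suc-cases (proj₁ (st k)) (proj₂ (st k))
... | inj₁ e = true , still (sym e)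
... | inj₂ e = false , shrink refl e

move-step : ∀ p s l l' → (∀ k → ∃ (Move s (part p l k) (part p l' k))) → Step p s l l'
move-step p plus l l' h k with h k
... | true , still e = ≤-reflexive e , ≤-trans (≤-reflexive (sym e)) (n≤1+n _)
... | false , grow _ e = ≤-trans (n≤1+n _) (≤-reflexive (sym e)) , ≤-reflexive e
move-step p minus l l' h k with h k
... | true , still e = ≤-reflexive (sym e) , ≤-trans (≤-reflexive e) (n≤1+n _)
... | false , shrink _ e = ≤-trans (n≤1+n _) (≤-reflexive (sym e)) , ≤-reflexive e

letter : ∀ w m → m < length w → ∃ (nth w m)
letter (s ∷ w) zero h = s , refl
letter (s ∷ w) (suc m) h = letter w m (≤-pred h)

nth-unique : ∀ w m {s s'} → nth w m s → nth w m s' → s ≡ s'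
nth-unique (t ∷ w) zero refl refl = refl
nth-unique (t ∷ w) (suc m) h h' = nth-unique w m h h'

parFrom : Bool → ℕ → Bool
parFrom b m = agree b (par m)

parFrom-suc : ∀ b m → parFrom b (suc m) ≡ parFrom (not b) m
parFrom-suc true m = refl
parFrom-suc false m = not-not _

c'-suc : ∀ b w m s → nth w m s → c' b w (suc m) ≡ c' b w m + incr (parFrom b m) s
c'-suc true (t ∷ w) zero s refl = +-identityʳ _
c'-suc false (t ∷ w) zero s refl = +-identityʳ _
c'-suc b (t ∷ w) (suc m) s h = trans (cong (λ z → incr b t + z) (c'-suc (not b) w m s h))
  (trans (sym (+-assoc (incr b t) _ _)) (cong (λ p → incr b t + c' (not b) w m + incr p s) (sym (parFrom-suc b m))))

seq-step : ∀ b w f → Seq b w f → ∀ m s → nth w m s → Step (parFrom b m) s (f m) (f (suc m))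
seq-step true (t ∷ w) f (st , _) zero s refl = st
seq-step false (t ∷ w) f (st , _) zero s refl = st
seq-step b (t ∷ w) f (_ , sq) (suc m) s h =
  subst (λ p → Step p s (f (suc m)) (f (suc (suc m)))) (sym (parFrom-suc b m)) (seq-step (not b) w (f ∘ suc) sq m s h)

seq-last : ∀ b w f → Seq b w f → IsEmpty (f (length w))
seq-last b [] f h = h
seq-last b (_ ∷ w) f (_ , h) = seq-last (not b) w (f ∘ suc) h

mkSeq : ∀ b w f → (∀ m s → nth w m s → Step (parFrom b m) s (f m) (f (suc m))) → IsEmpty (f (length w)) → Seq b w f
mkSeq b [] f h e = e
mkSeq true (t ∷ w) f h e = h 0 t refl , mkSeq false w (f ∘ suc) (λ m s x →
  subst (λ p → Step p s (f (suc m)) (f (suc (suc m)))) (parFrom-suc true m) (h (suc m) s x)) e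
mkSeq false (t ∷ w) f h e = h 0 t refl , mkSeq true w (f ∘ suc) (λ m s x →
  subst (λ p → Step p s (f (suc m)) (f (suc (suc m)))) (parFrom-suc false m) (h (suc m) s x)) e

-- The edges of a sequence of partitions

module Edges (w : List Sign) (A : ℤ) (f : PartSeq) where

  charge : ℕ → ℤ
  charge m = A ℤ.+ + c w m

  tailPos headPos : ℕ → ℕ → ℤ
  tailPos m k = pos (par m) (charge m) (f m) k
  headPos m k = pos (par m) (charge (suc m)) (f (suc m)) k

  IsEdge : ℕ → ℤ → Bool → Set
  IsEdge m n b = m < length w × ∃ λ k → n ≡ tailPos m k × n ⊕ b ≡ headPos m k

  -- The index `k` ranges over all natural numbers. The search is made finite by `pos-cover`: it
  -- either finds the only possible index or shows that the site is of the other kind.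
  isEdge? : ∀ m n b → Dec (IsEdge m n b)
  isEdge? m n b with m <? length w
  ... | no h = no (h ∘ proj₁)
  ... | yes h with pos-cover (par m) (charge m) (f m) n
  ...   | inj₂ (k , e) = no λ { (_ , k' , e' , _) → pos-excl (par m) (charge m) (f m) k' k (trans (sym e') e) }
  ...   | inj₁ (k , e) with n ⊕ b ℤ.≟ headPos m k
  ...     | yes e' = yes (h , k , e , e')
  ...     | no e' = no λ { (_ , k' , u , v) →
              e' (trans v (cong (headPos m) (pos-inj (par m) (charge m) (f m) (trans (sym u) e)))) }

  edges : ℕ → ℤ → Bool → Bool
  edges m n b = ⌊ isEdge? m n b ⌋

  edges-sound : ∀ m n b → edges m n b ≡ true → IsEdge m n b
  edges-sound m n b h with isEdge? m n b
  ... | yes e = e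

  edges-complete : ∀ m n b → IsEdge m n b → edges m n b ≡ true
  edges-complete m n b h with isEdge? m n b
  ... | yes _ = refl
  ... | no k = ⊥-elim (k h)

  charge-suc : ∀ m s → nth w m s → charge (suc m) ≡ charge m ℤ.+ + incr (par m) s
  charge-suc m s h = trans (cong (λ t → A ℤ.+ + t) (c'-suc true w m s h)) (sym (ℤP.+-assoc A (+ c w m) (+ incr (par m) s)))

  module _ (sq : Seq true w f) where

    hop-exists : ∀ m → m < length w → ∀ k → ∃ λ b → tailPos m k ⊕ b ≡ headPos m k
    hop-exists m h k with letter w m h
    ... | s , x with step-move (par m) s (f m) (f (suc m)) (seq-step true w f sq m s x) k
    ...   | e , mv = agree e (hop (par m) s) ,
              trans (move-pos (par m) s (charge m) (f m) (f (suc m)) k e mv)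
                (pos-cong (par m) _ (f (suc m)) _ (f (suc m)) k (sym (charge-suc m s x)) refl)

    still-hop : ∀ m s → nth w m s → ∀ k → part (par m) (f m) k ≡ part (par m) (f (suc m)) k →
      edges m (tailPos m k) (hop (par m) s) ≡ true
    still-hop m s x k e = edges-complete m _ _ (nth-< w m s x , k , refl ,
      trans (move-pos (par m) s (charge m) (f m) (f (suc m)) k true (still e))
        (pos-cong (par m) _ (f (suc m)) _ (f (suc m)) k (sym (charge-suc m s x)) refl))

⊕-inj : ∀ n b b' → n ⊕ b ≡ n ⊕ b' → b ≡ b'
⊕-inj n true true e = refl
⊕-inj n false false e = refl
⊕-inj n true false e = ⊥-elim (n≢n+1 n (sym e))
⊕-inj n false true e = ⊥-elim (n≢n+1 n e)

Σ<-term : ∀ k g m → m < k → g m ≤ Σ< k g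
Σ<-term (suc k) g m h with m <? k
... | yes h' = ≤-trans (Σ<-term k g m h') (m≤m+n _ _)
... | no h' rewrite ≤-antisym (≤-pred h) (≮⇒≥ h') = m≤n+m _ _

≤⇒+ : ∀ {a b} → a ℤ.≤ b → ∃ λ k → b ≡ a ℤ.+ + k
≤⇒+ {a} {b} h with b ℤ.- a in e | ℤP.i≤j⇒0≤j-i h
... | + k | _ = k , trans (lem b a) (cong (λ t → a ℤ.+ t) e)
  where
  lem : ∀ b a → b ≡ a ℤ.+ (b ℤ.- a)
  lem = ℤS.solve-∀

module SeqEdges (ℓ : ℕ) (1≤ℓ : 1 ≤ ℓ) (w : List Sign) (len : length w ≡ 2 * ℓ) (A : ℤ) (f : PartSeq)
    (sq : Seq true w f) (f0 : IsEmpty (f 0)) where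
  open Edges w A f

  vanish : ∀ p l {k} → part p l 0 ≡ 0 ⊎ part (not p) l 0 ≤ k → part p l k ≡ 0
  vanish p l (inj₁ e) = n≤0⇒n≡0 (≤-trans (part-anti p l z≤n) (≤-reflexive e))
  vanish true l (inj₂ h) = row-zero (dual l) h
  vanish false l (inj₂ h) = row-zero l h

  asym' : ∀ m s → nth w m s → ∃ λ X → ∀ n → far (par m) X n → edges m n (hop (par m) s) ≡ true
  asym' m s x = far-bound (par m) , λ n h → let k , K≤k , e = far-index n h in
      subst (λ t → edges m t (hop (par m) s) ≡ true) (sym (trans e (zero-pos k K≤k)))
        (still-hop sq m s x k (trans (vanish (par m) (f m) (inj₂ (≤-trans (m≤m+n _ _) K≤k)))
          (sym (vanish (par m) (f (suc m)) (inj₂ (≤-trans (m≤n+m _ (part (not (par m)) (f m) 0)) K≤k))))))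
    where
    -- From index `K` on both partitions have no part left, so the move is `still`.
    K = part (not (par m)) (f m) 0 + part (not (par m)) (f (suc m)) 0
    at : Bool → ℕ → ℤ
    at p = pos p (charge m) ∅
    far-bound : Bool → ℤ
    far-bound true = charge m ℤ.+ + K
    far-bound false = charge m ℤ.- + suc K
    far-idx : ∀ p n → far p (far-bound p) n → ∃ λ k → K ≤ k × n ≡ at p k
    far-idx true n h with ≤⇒+ h
    ... | j , refl = K + j , m≤m+n K j , trans (ℤP.+-assoc (charge m) (+ K) (+ j)) (sym (n-0 _))
    far-idx false n h with ≤⇒+ h
    ... | j , e = K + j , m≤m+n K j , trans (≡-from {b = charge m ℤ.- (+ suc K ℤ.+ + j)} (sym e) (lem n (charge m) (+ suc K) (+ j)))
      (sym (ℤP.+-identityʳ (charge m ℤ.- + suc (K + j))))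
      where
      lem : ∀ n z K j → n ℤ.+ (z ℤ.- K) ≡ z ℤ.- (K ℤ.+ j) ℤ.+ (n ℤ.+ j)
      lem = ℤS.solve-∀
    far-index : ∀ n → far (par m) (far-bound (par m)) n → ∃ λ k → K ≤ k × n ≡ at (par m) k
    far-index = far-idx (par m)
    zero-pos : ∀ k → K ≤ k → at (par m) k ≡ tailPos m k
    zero-pos k h = pos-cong (par m) _ ∅ _ (f m) k refl (trans (∅-part (par m) k) (sym (vanish (par m) (f m) (inj₂ (≤-trans (m≤m+n _ _) h)))))
      where
      ∅-part : ∀ p k → part p ∅ k ≡ 0
      ∅-part true k = refl
      ∅-part false k = refl

  0<L : 0 < length w
  0<L = subst (0 <_) (sym len) (≤-trans 1≤ℓ (m≤m+n ℓ _))

  tail0 : ∀ k → tailPos 0 k ≡ A ℤ.+ + k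
  tail0 k = trans (pos-cong true _ (f 0) _ ∅ k (ℤP.+-identityʳ A) (dual-empty {f 0} f0 k)) (n-0 _)

  left' : ∀ n → HasOut edges 0 n ⇔ A ℤ.≤ n
  left' n = mk⇔ to from
    where
    to : HasOut edges 0 n → A ℤ.≤ n
    to (b , t) with edges-sound 0 n b t
    ... | _ , k , refl , _ = subst (A ℤ.≤_) (sym (tail0 k)) (ℤP.i≤i+j A (+ k))
    from : A ℤ.≤ n → HasOut edges 0 n
    from h with ≤⇒+ h
    ... | k , refl = let b , e = hop-exists sq 0 0<L k in b , edges-complete 0 _ b
            (0<L , k , sym (tail0 k) , trans (cong (_⊕ b) (sym (tail0 k))) e)

  right' : ∀ m n → suc m ≡ 2 * ℓ → HasIn edges m n ⇔ n ℤ.≤ charge (2 * ℓ) ℤ.- + 1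
  right' m n e = mk⇔ to from
    where
    pm : par m ≡ false
    pm = par-last ℓ e
    head≡ : ∀ k → headPos m k ≡ charge (2 * ℓ) ℤ.- + suc k
    head≡ k rewrite pm | e = trans (pos-cong false (charge (2 * ℓ)) (f (2 * ℓ)) (charge (2 * ℓ)) ∅ k refl
      (subst (λ t → IsEmpty (f t)) len (seq-last true w f sq) k)) (ℤP.+-identityʳ (charge (2 * ℓ) ℤ.- + suc k))
    m<L : m < length w
    m<L = ≤-reflexive (trans e (sym len))
    pred≡ : ∀ z k → z ℤ.- + suc k ≡ z ℤ.- + 1 ℤ.- + k
    pred≡ z k = trans (cong (λ t → z ℤ.- t) (+suc k)) (lem z (+ k))
      where
      lem : ∀ z k → z ℤ.- (k ℤ.+ + 1) ≡ z ℤ.- + 1 ℤ.- k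
      lem = ℤS.solve-∀
    to : HasIn edges m n → n ℤ.≤ charge (2 * ℓ) ℤ.- + 1
    to (n' , b , t , refl) with edges-sound m n' b t
    ... | _ , k , _ , h = subst (ℤ._≤ charge (2 * ℓ) ℤ.- + 1) (sym (trans h (trans (head≡ k) (pred≡ (charge (2 * ℓ)) k)))) (ℤP.i-j≤i _ (+ k))
    from : n ℤ.≤ charge (2 * ℓ) ℤ.- + 1 → HasIn edges m n
    from h with ≤⇒+ h
    ... | k , h' = let b , e = hop-exists sq m m<L k in tailPos m k , b ,
            edges-complete m _ b (m<L , k , refl , e) ,
            trans (≡-from {b = charge (2 * ℓ) ℤ.- + 1 ℤ.- + k} (sym h') (lem n (charge (2 * ℓ) ℤ.- + 1) (+ k))) (sym (trans e (trans (head≡ k) (pred≡ (charge (2 * ℓ)) k))))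
      where
      lem : ∀ n z k → n ℤ.+ z ≡ z ℤ.- k ℤ.+ (n ℤ.+ k)
      lem = ℤS.solve-∀

  edgeGood : EdgeGood (2 * ℓ) w edges
  edgeGood = record
    { bounded = λ m n b t → subst (m <_) len (proj₁ (edges-sound m n b t))
    ; out-uniq = λ m n b b' t t' → out m n b b' (edges-sound m n b t) (edges-sound m n b' t')
    ; in-uniq = λ m n b n' b' t t' → inn m n b n' b' (edges-sound m n b t) (edges-sound m n' b' t')
    ; in-out = λ m n b b' t t' → io m n b b' (edges-sound m n b t) (edges-sound (suc m) (n ⊕ b) b' t')
    ; cover = cov
    ; asym = asym'
    ; left = A , left'
    ; right = charge (2 * ℓ) ℤ.- + 1 , right' }
    where
    out : ∀ m n b b' → IsEdge m n b → IsEdge m n b' → b ≡ b'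
    out m n b b' (_ , k , e , h) (_ , k' , e' , h') with pos-inj (par m) (charge m) (f m) (trans (sym e) e')
    ... | refl = ⊕-inj n b b' (trans h (sym h'))
    inn : ∀ m n b n' b' → IsEdge m n b → IsEdge m n' b' → n ⊕ b ≡ n' ⊕ b' → b ≡ b'
    inn m n b n' b' (_ , k , e , h) (_ , k' , e' , h') x
      with pos-inj (par m) (charge (suc m)) (f (suc m)) (trans (sym h) (trans x h'))
    ... | refl with trans e (sym e')
    ...   | refl = ⊕-inj n b b' x
    io : ∀ m n b b' → IsEdge m n b → IsEdge (suc m) (n ⊕ b) b' → ⊥
    io m n b b' (_ , k , e , h) (_ , k' , e' , h') = pos-excl (par m) (charge (suc m)) (f (suc m)) k k' (trans (sym h) e')
    cov : ∀ m n → suc m < 2 * ℓ → HasOut edges (suc m) n ⊎ HasIn edges m n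
    cov m n h with pos-cover (par m) (charge (suc m)) (f (suc m)) n
    ... | inj₁ (k , refl) = let b , e = hop-exists sq m (subst (m <_) (sym len) (<-trans (n<1+n m) h)) k in
            inj₂ (tailPos m k , b , edges-complete m _ b (subst (m <_) (sym len) (<-trans (n<1+n m) h) , k , refl , e) , sym e)
    ... | inj₂ (k , refl) = let b , e = hop-exists sq (suc m) (subst (suc m <_) (sym len) h) k in
            inj₁ (b , edges-complete (suc m) _ b (subst (suc m <_) (sym len) h , k , refl , e))

  edgeBound : EdgeBound edges
  edgeBound = B , bd
    where
    g : ℕ → ℕ
    g m = ∣ charge m ∣ + (row (f m) 0 + col (f m) 0)
    -- The sum dominates the bound of each level and so serves all of them at once.
    B = Σ< (length w) g
    -∣∣≤ : ∀ a → ℤ.- (+ ∣ a ∣) ℤ.≤ a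
    -∣∣≤ (+ zero) = ℤP.≤-refl
    -∣∣≤ (+ suc a) = ℤ.-≤+
    -∣∣≤ -[1+ a ] = ℤP.≤-refl
    hi : ∀ m k → g m ≤ B → pos false (charge m) (f m) k ℤ.≤ + B
    hi m k h = ℤP.≤-trans (ℤP.+-mono-≤ (ℤP.≤-trans (ℤP.i-j≤i (charge m) (+ suc k)) (≤+∣∣ (charge m)))
      (ℤ.+≤+ (≤-trans (row-anti (f m) z≤n) (m≤m+n _ (col (f m) 0))))) (ℤ.+≤+ h)
    lo : ∀ m k → g m ≤ B → ℤ.- (+ B) ℤ.≤ pos true (charge m) (f m) k
    lo m k h = ≤-from (ℤP.+-mono-≤ (-∣∣≤ (charge m)) (ℤ.+≤+ h'))
        (trans (lem1 (+ B) (charge m)) (lem2 (charge m) (+ k) (+ col (f m) k) (+ ∣ charge m ∣)))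
      where
      h' : ∣ charge m ∣ + col (f m) k ≤ k + B
      h' = ≤-trans (≤-trans (+-monoʳ-≤ ∣ charge m ∣ (≤-trans (row-anti (dual (f m)) {0} {k} z≤n) (m≤n+m _ (row (f m) 0)))) h) (m≤n+m B k)
      lem1 : ∀ B z → ℤ.- B ℤ.+ (z ℤ.+ (+ k ℤ.+ B)) ≡ z ℤ.+ + k
      lem1 B z = l B z (+ k)
        where
        l : ∀ B z k → ℤ.- B ℤ.+ (z ℤ.+ (k ℤ.+ B)) ≡ z ℤ.+ k
        l = ℤS.solve-∀
      lem2 : ∀ z k c a → z ℤ.+ k ≡ z ℤ.+ k ℤ.- c ℤ.+ (ℤ.- a ℤ.+ (a ℤ.+ c))
      lem2 = ℤS.solve-∀
    bd : ∀ m n b → edges m n b ≡ true → (par m ≡ false → n ℤ.≤ + B) × (par m ≡ true → ℤ.- (+ B) ℤ.≤ n)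
    bd m n b t with edges-sound m n b t
    ... | h , k , refl , _ = up (Σ<-term (length w) g m h) , dn (Σ<-term (length w) g m h)
      where
      up : g m ≤ B → par m ≡ false → tailPos m k ℤ.≤ + B
      up h p rewrite p = hi m k h
      dn : g m ≤ B → par m ≡ true → ℤ.- (+ B) ℤ.≤ tailPos m k
      dn h p rewrite p = lo m k h

  tiling : Tiling
  tiling = tile edges

  tiling-good : Good ℓ w tiling
  tiling-good = edge⇒good ℓ w tiling 1≤ℓ (tile-supported edges) (transport edgeGood) bound
    where
    E≡ : ∀ m n b → edges m n b ≡ edge tiling m n b
    E≡ m n b = sym (edge-tile edges m n b)
    to : ∀ {m n b} → edges m n b ≡ true → edge tiling m n b ≡ true
    to {m} {n} {b} = trans (edge-tile edges m n b)
    fro : ∀ {m n b} → edge tiling m n b ≡ true → edges m n b ≡ true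
    fro {m} {n} {b} = trans (E≡ m n b)
    transport : EdgeGood (2 * ℓ) w edges → EdgeGood (2 * ℓ) w (edge tiling)
    transport g = record
      { bounded = λ m n b t → bounded g m n b (fro t)
      ; out-uniq = λ m n b b' t t' → out-uniq g m n b b' (fro t) (fro t')
      ; in-uniq = λ m n b n' b' t t' → in-uniq g m n b n' b' (fro t) (fro t')
      ; in-out = λ m n b b' t t' → in-out g m n b b' (fro t) (fro t')
      ; cover = λ m n h → Sum.map (λ (b , t) → b , to t) (λ (n' , b , t , e) → n' , b , to t , e) (cover g m n h)
      ; asym = λ m s x → let X , h = asym g m s x in X , λ n y → to (h n y)
      ; left = proj₁ (left g) , λ n → mk⇔ (λ (b , t) → Equivalence.to (proj₂ (left g) n) (b , fro t))
                 (λ h → let b , t = Equivalence.from (proj₂ (left g) n) h in b , to t)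
      ; right = proj₁ (right g) , λ m n e → mk⇔
                 (λ (n' , b , t , x) → Equivalence.to (proj₂ (right g) m n e) (n' , b , fro t , x))
                 (λ h → let n' , b , t , x = Equivalence.from (proj₂ (right g) m n e) h in n' , b , to t , x) }
      where open EdgeGood
    bound : EdgeBound (edge tiling)
    bound = proj₁ edgeBound , λ m n b t → proj₂ edgeBound m n b (fro t)

-- From edges to partitions

bit : Bool → ℕ
bit true = 1
bit false = 0

orient-part : ∀ p l k → part p (orient p l) k ≡ row l k
orient-part true l k = refl
orient-part false l k = refl

-- Equal consecutive parts sit on adjacent sites. Holes are numbered to the right and particles to
-- the left, so the one that must not run into the other hops by `p` in both cases.
collide : ∀ p z l k → part p l k ≡ part p l (suc k) → pos p z l k ⊕ p ≡ pos p z l (suc k) ⊕ not p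
collide true z l k h rewrite h = trans (lem z (+ k) (+ col l (suc k))) (cong (λ t → z ℤ.+ t ℤ.- + col l (suc k)) (sym (+suc k)))
  where
  lem : ∀ z k a → z ℤ.+ k ℤ.- a ℤ.+ + 1 ≡ z ℤ.+ (k ℤ.+ + 1) ℤ.- a
  lem = ℤS.solve-∀
collide false z l k h rewrite h = trans (lem z (+ suc k) (+ row l (suc k))) (cong (λ t → z ℤ.- t ℤ.+ + row l (suc k) ℤ.+ + 1) (sym (+suc (suc k))))
  where
  lem : ∀ z k a → z ℤ.- k ℤ.+ a ≡ z ℤ.- (k ℤ.+ + 1) ℤ.+ a ℤ.+ + 1
  lem = ℤS.solve-∀

pos-far : ∀ p z l X → ∃ λ K → ∀ k → K ≤ k → far p X (pos p z l k)
pos-far true z l X = ∣ X ℤ.- z ∣ + col l 0 , λ k h →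
  ≤-from (ℤP.+-mono-≤ (≤+∣∣ (X ℤ.- z)) (ℤ.+≤+ (≤-trans (+-monoʳ-≤ ∣ X ℤ.- z ∣ (row-anti (dual l) {0} {k} z≤n)) h)))
    (lem X z (+ ∣ X ℤ.- z ∣) (+ k) (+ col l k))
  where
  lem : ∀ X z a k r → X ℤ.+ (a ℤ.+ k) ≡ z ℤ.+ k ℤ.- r ℤ.+ (X ℤ.- z ℤ.+ (a ℤ.+ r))
  lem = ℤS.solve-∀
pos-far false z l X = ∣ z ℤ.- X ∣ + row l 0 , λ k h →
  ≤-from (ℤP.+-mono-≤ (≤+∣∣ (z ℤ.- X)) (ℤ.+≤+ (≤-trans (+-monoʳ-≤ ∣ z ℤ.- X ∣ (row-anti l {0} {k} z≤n)) (≤-trans h (n≤1+n k)))))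
    (lem X z (+ ∣ z ℤ.- X ∣) (+ suc k) (+ row l k))
  where
  lem : ∀ X z a k r → z ℤ.- k ℤ.+ r ℤ.+ (a ℤ.+ k) ≡ X ℤ.+ (z ℤ.- X ℤ.+ (a ℤ.+ r))
  lem = ℤS.solve-∀

-- The hop b k raises part k, relative to the other hop, iff b k differs from p;
-- the asymptotic value of this excess is subtracted so that almost all parts vanish.
module NewPart (p : Bool) (s : Sign) (l : Part) (b : ℕ → Bool)
    (no-collision : ∀ k → part p l k ≡ part p l (suc k) → b k ≡ p → ¬ b (suc k) ≡ not p)
    (K : ℕ) (tame : ∀ k → K ≤ k → b k ≡ hop p s) where
  F : ℕ → ℕ
  F k = part p l k + bit (b k xor p)

  -- A raise by at most one can break the order only between equal parts, when part `suc k` is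
  -- raised and part `k` is not; then both would land on the same site.
  F-anti : ∀ k → F (suc k) ≤ F k
  F-anti k with <-cmp (part p l (suc k)) (part p l k)
  ... | tri< h _ _ = ≤-trans (+-monoʳ-≤ _ (bit≤1 (b (suc k) xor p))) (≤-trans (≤-reflexive (+-comm _ 1)) (≤-trans h (m≤m+n _ _)))
    where
    bit≤1 : ∀ x → bit x ≤ 1
    bit≤1 true = ≤-refl
    bit≤1 false = z≤n
  ... | tri> _ _ h = ⊥-elim (<-irrefl refl (<-≤-trans h (part-anti p l (n≤1+n k))))
  ... | tri≈ _ e _ rewrite e = +-monoʳ-≤ (part p l k) (lem p (b k) (b (suc k)) (no-collision k (sym e)))
    where
    lem : ∀ p x y → (x ≡ p → ¬ y ≡ not p) → bit (y xor p) ≤ bit (x xor p)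
    lem true true true h = ≤-refl
    lem true true false h = ⊥-elim (h refl refl)
    lem true false true h = z≤n
    lem true false false h = ≤-refl
    lem false true true h = ≤-refl
    lem false true false h = z≤n
    lem false false true h = ⊥-elim (h refl refl)
    lem false false false h = ≤-refl

  M = K + (col l 0 + row l 0)

  part-M : ∀ k → M ≤ k → part p l k ≡ 0
  part-M k h = zero' p
    where
    zero' : ∀ p → part p l k ≡ 0
    zero' true = row-zero (dual l) (≤-trans (≤-trans (m≤n+m _ (col l 0)) (m≤n+m _ K)) h)
    zero' false = row-zero l (≤-trans (≤-trans (m≤m+n _ (row l 0)) (m≤n+m _ K)) h)

  F-M : ∀ k → M ≤ k → F k ≡ bit (hop p s xor p)
  F-M k h rewrite part-M k h | tame k (≤-trans (m≤m+n K _) h) = refl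

  New : Sign → Set
  New s = Σ Part λ l' → ∀ k → ∃ λ e → Move s (part p l k) (part p l' k) e × b k ≡ agree e (hop p s)

  -- For a letter - the excess is 1 at infinity. As `F` is antitone it is at least 1 everywhere, so
  -- subtracting 1 loses nothing.
  F-inv : ∀ k → bit (hop p s xor p) ≡ 1 → 1 ≤ F k
  F-inv k h with M ≤? k
  ... | yes x = ≤-reflexive (sym (trans (F-M k x) h))
  ... | no x = ≤-trans (≤-reflexive (sym (trans (F-M M ≤-refl) h))) (anti≤ F F-anti (<⇒≤ (≰⇒> x)))

  go : ∀ s' → s ≡ s' → New s'
  go plus es = orient p l' , λ k → mv k (b k) refl
    where
    l' = mkPart F F-anti M (trans (F-M M ≤-refl) (trans (cong (λ s → bit (hop p s xor p)) es) (z p)))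
      where
      z : ∀ p → bit (hop p plus xor p) ≡ 0
      z true = refl
      z false = refl
    mv : ∀ k x → b k ≡ x → ∃ λ e → Move plus (part p l k) (part p (orient p l') k) e × b k ≡ agree e (hop p plus)
    mv k x h rewrite orient-part p l' k | h = cases p x
      where
      cases : ∀ p x → ∃ λ e → Move plus (part p l k) (part p l k + bit (x xor p)) e × x ≡ agree e (hop p plus)
      cases true true = true , still (sym (+-identityʳ _)) , refl
      cases true false = false , grow refl (+-comm _ 1) , refl
      cases false true = false , grow refl (+-comm _ 1) , refl
      cases false false = true , still (sym (+-identityʳ _)) , refl
  go minus es = orient p l' , λ k → mv k (b k) refl
    where
    δ : bit (hop p s xor p) ≡ 1
    δ = trans (cong (λ s → bit (hop p s xor p)) es) (z p)
      where
      z : ∀ p → bit (hop p minus xor p) ≡ 1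
      z true = refl
      z false = refl
    l' = mkPart (λ k → F k ∸ 1) (λ k → ∸-monoˡ-≤ 1 (F-anti k)) M (cong (_∸ 1) (trans (F-M M ≤-refl) δ))
    mv : ∀ k x → b k ≡ x → ∃ λ e → Move minus (part p l k) (part p (orient p l') k) e × b k ≡ agree e (hop p minus)
    mv k x h rewrite orient-part p l' k = subst (λ x → ∃ λ e → Move minus (part p l k) (F k ∸ 1) e × x ≡ agree e (hop p minus)) (sym h)
        (subst (λ y → ∃ λ e → Move minus (part p l k) (part p l k + bit (y xor p) ∸ 1) e × x ≡ agree e (hop p minus)) (sym h)
          (cases p x (subst (λ y → 1 ≤ part p l k + bit (y xor p)) h (F-inv k δ))))
      where
      cases : ∀ p x → 1 ≤ part p l k + bit (x xor p) → ∃ λ e → Move minus (part p l k) (part p l k + bit (x xor p) ∸ 1) e × x ≡ agree e (hop p minus)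
      st : ∀ a → a ≡ a + 1 ∸ 1
      st a = sym (m+n∸n≡m a 1)
      sh : ∀ a → 1 ≤ a + 0 → a ≡ suc (a + 0 ∸ 1)
      sh (suc a) h = cong suc (sym (+-identityʳ a))
      cases true true h = false , shrink refl (sh _ h) , refl
      cases true false h = true , still (st _) , refl
      cases false true h = true , still (st _) , refl
      cases false false h = false , shrink refl (sh _ h) , refl

  new : New s
  new = go s refl

module Decompose (ℓ : ℕ) (1≤ℓ : 1 ≤ ℓ) (w : List Sign) (len : length w ≡ 2 * ℓ)
    (G : ℕ → ℤ → Bool → Bool) (eg : EdgeGood (2 * ℓ) w G) where
  open EdgeGood eg

  A : ℤ
  A = proj₁ left

  charge : ℕ → ℤ
  charge m = A ℤ.+ + c w m

  record Level (m : ℕ) (l : Part) : Set where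
    field
      outs : m < 2 * ℓ → ∀ k → HasOut G m (pos (par m) (charge m) l k)
      only : ∀ n → HasOut G m n → ∃ λ k → n ≡ pos (par m) (charge m) l k
  open Level

  record Next (m : ℕ) (l l' : Part) : Set where
    field
      step : ∀ s → nth w m s → Step (par m) s l l'
      link : ∀ k → ∃ λ b → G m (pos (par m) (charge m) l k) b ≡ true ×
               pos (par m) (charge m) l k ⊕ b ≡ pos (par m) (charge (suc m)) l' k
      level : Level (suc m) l'
  open Next

  -- The hops out of diagonal `m` define the new partition, whose positions of the same kind are
  -- exactly the heads. Every other site of diagonal `suc m` must be a tail by `cover`, and no head
  -- is one by `in-out`, which restores the invariant with the kinds exchanged.
  next : ∀ m l → m < 2 * ℓ → Level m l → Σ Part (Next m l)
  next m l m<L lv = l' , record { step = st ; link = lk ; level = record { outs = outs' ; only = only' } }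
    where
    p = par m
    s : Sign
    s = proj₁ (letter w m (subst (m <_) (sym len) m<L))
    x : nth w m s
    x = proj₂ (letter w m (subst (m <_) (sym len) m<L))
    t : ℕ → ℤ
    t k = pos p (charge m) l k
    b : ℕ → Bool
    b k = proj₁ (outs lv m<L k)
    g : ∀ k → G m (t k) (b k) ≡ true
    g k = proj₂ (outs lv m<L k)
    no-collision : ∀ k → part p l k ≡ part p l (suc k) → b k ≡ p → ¬ b (suc k) ≡ not p
    no-collision k e h h' = clash p (trans (sym h) (trans (in-uniq m (t k) (b k) (t (suc k)) (b (suc k)) (g k) (g (suc k))
        (trans (cong (t k ⊕_) h) (trans (collide p (charge m) l k e) (cong (t (suc k) ⊕_) (sym h'))))) h'))
      where
      clash : ∀ p → ¬ p ≡ not p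
      clash true ()
      clash false ()
    X = proj₁ (asym m s x)
    K = proj₁ (pos-far p (charge m) l X)
    tame : ∀ k → K ≤ k → b k ≡ hop p s
    tame k h = out-uniq m (t k) (b k) (hop p s) (g k) (proj₂ (asym m s x) (t k) (proj₂ (pos-far p (charge m) l X) k h))
    open NewPart p s l b no-collision K tame using (new)
    l' = proj₁ new
    st : ∀ s → nth w m s → Step (par m) s l l'
    st s' x' rewrite nth-unique w m x' x = move-step p s l l' (λ k → let e , mv , _ = proj₂ new k in e , mv)
    lnk : ∀ k → t k ⊕ b k ≡ pos p (charge (suc m)) l' k
    lnk k = let e , mv , h = proj₂ new k in
      trans (cong (t k ⊕_) h) (trans (move-pos p s (charge m) l l' k e mv)
        (pos-cong p _ l' _ l' k (sym (Edges.charge-suc w A (λ _ → l) m s x)) refl))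
    lk : ∀ k → ∃ λ b → G m (t k) b ≡ true × t k ⊕ b ≡ pos p (charge (suc m)) l' k
    lk k = b k , g k , lnk k
    ins : ∀ n → HasIn G m n → ∃ λ k → n ≡ pos p (charge (suc m)) l' k
    ins n (n' , b' , h , refl) with only lv n' (b' , h)
    ... | k , refl = k , trans (cong (t k ⊕_) (out-uniq m (t k) b' (b k) h (g k))) (lnk k)
    outs' : suc m < 2 * ℓ → ∀ k → HasOut G (suc m) (pos (par (suc m)) (charge (suc m)) l' k)
    outs' h k with cover m (pos (not p) (charge (suc m)) l' k) h
    ... | inj₁ y = y
    ... | inj₂ y with ins _ y
    ...   | k' , e = ⊥-elim (pos-excl p (charge (suc m)) l' k' k (sym e))
    only' : ∀ n → HasOut G (suc m) n → ∃ λ k → n ≡ pos (not p) (charge (suc m)) l' k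
    only' n (b' , h) with pos-cover p (charge (suc m)) l' n
    ... | inj₂ y = y
    ... | inj₁ (k , e) = ⊥-elim (in-out m (t k) (b k) b' (g k) (subst (λ z → G (suc m) z b' ≡ true) (trans e (sym (lnk k))) h))

  level0 : Level 0 ∅
  level0 = record
    { outs = λ _ k → Equivalence.from (proj₂ left (t k)) (subst (A ℤ.≤_) (sym (t≡ k)) (ℤP.i≤i+j A (+ k)))
    ; only = λ n h → let k , e = ≤⇒+ (Equivalence.to (proj₂ left n) h) in k , trans e (sym (t≡ k)) }
    where
    t : ℕ → ℤ
    t k = pos true (charge 0) ∅ k
    t≡ : ∀ k → t k ≡ A ℤ.+ + k
    t≡ k = trans (n-0 _) (cong (ℤ._+ + k) (ℤP.+-identityʳ A))

  state : ∀ m → Σ Part λ l → m ≤ 2 * ℓ → Level m l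
  state zero = ∅ , λ _ → level0
  state (suc m) with m <? 2 * ℓ
  ... | yes h = let l' , nx = next m (proj₁ (state m)) h (proj₂ (state m) (<⇒≤ h)) in l' , λ _ → Next.level nx
  ... | no h = ∅ , λ h' → ⊥-elim (h h')

  parts : PartSeq
  parts m = proj₁ (state m)

  level-at : ∀ m → m ≤ 2 * ℓ → Level m (parts m)
  level-at m h = proj₂ (state m) h

  next-at : ∀ m → m < 2 * ℓ → Next m (parts m) (parts (suc m))
  next-at m h with m <? 2 * ℓ
  ... | yes h' = proj₂ (next m (parts m) h' (level-at m (<⇒≤ h')))
  ... | no h' = ⊥-elim (h' h)

  last-level : ∃ λ m → suc m ≡ 2 * ℓ
  last-level = _ , m+[n∸m]≡n {1} (≤-trans 1≤ℓ (m≤m+n ℓ _))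

  -- Purity makes the heads on the last diagonal, that is its particles, a set closed to the left.
  -- In a nonempty partition the first hole lies to the left of the first particle, so this hole
  -- would be a particle too.
  last-empty : IsEmpty (parts (2 * ℓ))
  last-empty with last-level
  ... | m , e = subst (λ t → IsEmpty (parts t)) e (empty-from-first l' (≮0⇒≡0 absurd))
    where
    ≮0⇒≡0 : ∀ {a} → ¬ 0 < a → a ≡ 0
    ≮0⇒≡0 {zero} _ = refl
    ≮0⇒≡0 {suc a} h = ⊥-elim (h (s≤s z≤n))
    l' = parts (suc m)
    z = charge (suc m)
    m<L = ≤-reflexive e
    nx = next-at m m<L
    pm : par m ≡ false
    pm = par-last ℓ e
    B = proj₁ right
    isIn : ∀ k → HasIn G m (pos false z l' k)
    isIn k = let b , g , lk = link nx k in
      pos (par m) (charge m) (parts m) k , b , g , sym (trans lk (cong (λ p → pos p z l' k) pm))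
    ins : ∀ n → HasIn G m n → ∃ λ k → n ≡ pos false z l' k
    ins n (n' , b' , h , refl) with only (level-at m (<⇒≤ m<L)) n' (b' , h)
    ... | k , refl = let b , g , lk = link nx k in
      k , trans (cong (pos (par m) (charge m) (parts m) k ⊕_) (out-uniq m _ b' b h g)) (trans lk (cong (λ p → pos p z l' k) pm))
    absurd : ¬ 0 < row l' 0
    absurd h = holes-particles z l' 0 (proj₁ bad) (proj₂ bad)
      where
      hole≤ : pos true z l' 0 ℤ.≤ pos false z l' 0
      hole≤ = ≤-from (ℤ.+≤+ {1} (≤-trans h (m≤n+m (row l' 0) (col l' 0)))) (lem z (+ col l' 0) (+ row l' 0))
        where
        lem : ∀ z a r → z ℤ.+ + 0 ℤ.- a ℤ.+ (a ℤ.+ r) ≡ z ℤ.- + 1 ℤ.+ r ℤ.+ + 1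
        lem = ℤS.solve-∀
      bad : ∃ λ k → pos true z l' 0 ≡ pos false z l' k
      bad = ins _ (Equivalence.from (proj₂ right m _ e) (ℤP.≤-trans hole≤ (Equivalence.to (proj₂ right m _ e) (isIn 0))))

  open Edges w A parts using (edges; edges-sound; edges-complete)

  parts-seq : Seq true w parts
  parts-seq = mkSeq true w parts (λ m s x → step (next-at m (subst (m <_) len (nth-< w m s x))) s x)
    (subst (λ t → IsEmpty (parts t)) (sym len) last-empty)

  edges≡ : ∀ m n b → G m n b ≡ edges m n b
  edges≡ m n b = bool-ext to from
    where
    to : G m n b ≡ true → edges m n b ≡ true
    to h with only (level-at m (<⇒≤ (bounded m n b h))) n (b , h)
    ... | k , refl = let b' , g , lk = link (next-at m (bounded m n b h)) k in
      edges-complete m n b (subst (m <_) (sym len) (bounded m n b h) , k , refl ,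
        trans (cong (pos (par m) (charge m) (parts m) k ⊕_) (out-uniq m _ b b' h g)) lk)
    from : edges m n b ≡ true → G m n b ≡ true
    from h with edges-sound m n b h
    ... | m<L , k , refl , e = let b' , g , lk = link (next-at m (subst (m <_) len m<L)) k in
      subst (λ z → G m n z ≡ true) (⊕-inj n b' b (trans lk (sym e))) g

-- Adding a box: particle k false hops over hole k true.

record AddBox (l l⁺ : Part) (k : Bool → ℕ) : Set where
  field
    at : ∀ p → part p l (k p) ≡ k (not p)
    at⁺ : ∀ p → part p l⁺ (k p) ≡ suc (k (not p))
    off : ∀ p {x} → ¬ x ≡ k p → part p l x ≡ part p l⁺ x

upd : (ℕ → ℕ) → ℕ → ℕ → ℕ → ℕ
upd g i v x with x ≟ i
... | yes _ = v
... | no _ = g x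

upd-at : ∀ g i v → upd g i v i ≡ v
upd-at g i v with i ≟ i
... | yes _ = refl
... | no h = ⊥-elim (h refl)

upd-off : ∀ g i v {x} → ¬ x ≡ i → upd g i v x ≡ g x
upd-off g i v {x} h with x ≟ i
... | yes e = ⊥-elim (h e)
... | no _ = refl

modify : ∀ l i j r s → (∀ y → ¬ y ≡ j → y < r ⇔ y < row l i) → (∀ x → ¬ x ≡ i → x < s ⇔ x < col l j) → (j < r ⇔ i < s) → Part
modify l i j r s hr hs hb = record { row = upd (row l) i r ; col = upd (col l) j s ; r→c = λ {x} {y} → rc x y ; c→r = λ {x} {y} → cr x y }
  where
  open Equivalence
  rc : ∀ x y → y < upd (row l) i r x → x < upd (col l) j s y
  rc x y h with x ≟ i | y ≟ j
  ... | yes refl | yes refl = to hb h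
  ... | yes refl | no y≢ = r→c l (to (hr y y≢) h)
  ... | no x≢ | yes refl = from (hs x x≢) (r→c l h)
  ... | no x≢ | no y≢ = r→c l h
  cr : ∀ x y → x < upd (col l) j s y → y < upd (row l) i r x
  cr x y h with x ≟ i | y ≟ j
  ... | yes refl | yes refl = from hb h
  ... | yes refl | no y≢ = from (hr y y≢) (c→r l h)
  ... | no x≢ | yes refl = c→r l (to (hs x x≢) h)
  ... | no x≢ | no y≢ = c→r l h

<-suc-≢ : ∀ {v} y → ¬ y ≡ v → y < suc v ⇔ y < v
<-suc-≢ y h = mk⇔ (λ p → ≤∧≢⇒< (≤-pred p) h) (λ p → m<n⇒m<1+n p)

⇔-sym : ∀ {A B : Set} → A ⇔ B → B ⇔ A
⇔-sym e = mk⇔ (Equivalence.from e) (Equivalence.to e)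

box : ℕ → ℕ → Bool → ℕ
box i j true = j
box i j false = i

add-box : ∀ l i j → row l i ≡ j → col l j ≡ i → Σ Part λ l⁺ → AddBox l l⁺ (box i j)
add-box l i j refl e = modify l i j (suc j) (suc i) (λ y → <-suc-≢ y) (λ x h → subst (λ t → x < suc i ⇔ x < t) (sym e) (<-suc-≢ x h))
    (mk⇔ (λ _ → ≤-refl) (λ _ → ≤-refl)) , record
  { at = λ { true → e ; false → refl }
  ; at⁺ = λ { true → upd-at (col l) j (suc i) ; false → upd-at (row l) i (suc j) }
  ; off = λ { true h → sym (upd-off (col l) j (suc i) h) ; false h → sym (upd-off (row l) i (suc j) h) } }

remove-box : ∀ l i j → row l i ≡ suc j → col l j ≡ suc i → Σ Part λ l⁻ → AddBox l⁻ l (box i j)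
remove-box l i j e e' = modify l i j j i
    (λ y h → subst (λ t → y < j ⇔ y < t) (sym e) (⇔-sym (<-suc-≢ y h)))
    (λ x h → subst (λ t → x < i ⇔ x < t) (sym e') (⇔-sym (<-suc-≢ x h)))
    (mk⇔ (λ h → ⊥-elim (<-irrefl refl h)) (λ h → ⊥-elim (<-irrefl refl h))) , record
  { at = λ { true → upd-at (col l) j i ; false → upd-at (row l) i j }
  ; at⁺ = λ { true → e' ; false → e }
  ; off = λ { true h → upd-off (col l) j i h ; false h → upd-off (row l) i j h } }

Σ<-bump : ∀ k g g' i → i < k → g' i ≡ suc (g i) → (∀ x → ¬ x ≡ i → g x ≡ g' x) → Σ< k g' ≡ suc (Σ< k g)
Σ<-bump (suc k) g g' i h e d with i ≟ k
... | yes refl = trans (cong₂ _+_ (Σ<-cong k (λ x x<k → sym (d x (<⇒≢ x<k)))) e) (+-suc (Σ< k g) (g k))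
... | no i≢k = cong₂ _+_ (Σ<-bump k g g' i (≤∧≢⇒< (≤-pred h) i≢k) e d) (sym (d k (i≢k ∘ sym)))

add-size : ∀ {l l⁺ k} → AddBox l l⁺ k → size l⁺ ≡ suc (size l)
add-size {l} {l⁺} {k} a = trans (sym (size-rows l⁺ {K} (m≤n+m _ _)))
  (trans (Σ<-bump K (row l) (row l⁺) (k false) i<K (trans (at⁺ false) (cong suc (sym (at false)))) (λ x h → off false h))
    (cong suc (size-rows l {K} (m≤m+n _ _))))
  where
  open AddBox a
  K = col l 0 + col l⁺ 0
  i<K : k false < K
  i<K = ≤-trans (r→c l⁺ (≤-trans (s≤s z≤n) (≤-reflexive (sym (at⁺ false))))) (m≤n+m _ (col l 0))

⊕-bit : ∀ n b → n ⊕ b ≡ n ℤ.+ + bit b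
⊕-bit n true = refl
⊕-bit n false = sym (ℤP.+-identityʳ n)

pos-move : ∀ p s z l l' k b → pos p z l k ⊕ b ≡ pos p (z ℤ.+ + incr p s) l' k → ∃ (Move s (part p l k) (part p l' k))
pos-move true s z l l' k b h = cases s b (ℤP.+-injective (≡-from (trans (sym (⊕-bit _ b)) h)
    (lem z (+ k) (+ col l k) (+ col l' k) (+ bit b) (+ incr true s))))
  where
  lem : ∀ z k a a' b i → a' ℤ.+ b ℤ.+ (z ℤ.+ i ℤ.+ k ℤ.- a') ≡ a ℤ.+ i ℤ.+ (z ℤ.+ k ℤ.- a ℤ.+ b)
  lem = ℤS.solve-∀
  cases : ∀ s b → col l' k + bit b ≡ col l k + incr true s → ∃ (Move s (col l k) (col l' k))
  cases plus true e = true , still (sym (+-cancelʳ-≡ 1 _ _ e))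
  cases plus false e = false , grow refl (trans (sym (+-identityʳ _)) (trans e (+-comm _ 1)))
  cases minus true e = false , shrink refl (trans (sym (+-identityʳ _)) (trans (sym e) (+-comm _ 1)))
  cases minus false e = true , still (sym (+-cancelʳ-≡ 0 _ _ e))
pos-move false s z l l' k b h = cases s b (ℤP.+-injective (≡-from (trans (sym (⊕-bit _ b)) h)
    (lem z (+ suc k) (+ row l k) (+ row l' k) (+ bit b) (+ incr false s))))
  where
  lem : ∀ z k a a' b i → a ℤ.+ b ℤ.+ (z ℤ.+ i ℤ.- k ℤ.+ a') ≡ a' ℤ.+ i ℤ.+ (z ℤ.- k ℤ.+ a ℤ.+ b)
  lem = ℤS.solve-∀
  cases : ∀ s b → row l k + bit b ≡ row l' k + incr false s → ∃ (Move s (row l k) (row l' k))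
  cases plus true e = false , grow refl (trans (sym (+-identityʳ _)) (trans (sym e) (+-comm _ 1)))
  cases plus false e = true , still (+-cancelʳ-≡ 0 _ _ e)
  cases minus true e = true , still (+-cancelʳ-≡ 1 _ _ e)
  cases minus false e = false , shrink refl (trans (sym (+-identityʳ _)) (trans e (+-comm _ 1)))

-- An addable (removable) box is a particle with a hole to its right (left).

addable : ∀ z l i j → pos true z l j ≡ pos false z l i ℤ.+ + 1 → row l i ≡ j × col l j ≡ i
addable z l i j h = fits (ℤP.+-injective (≡-from (sym h)
    (trans (lem z (+ i) (+ j) (+ row l i) (+ col l j)) (cong (λ t → + i ℤ.+ + j ℤ.+ (z ℤ.- t ℤ.+ + row l i ℤ.+ + 1)) (sym (+suc i))))))
  where
  lem : ∀ z i j r s → r ℤ.+ s ℤ.+ (z ℤ.+ j ℤ.- s) ≡ i ℤ.+ j ℤ.+ (z ℤ.- (i ℤ.+ + 1) ℤ.+ r ℤ.+ + 1)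
  lem = ℤS.solve-∀
  fits : row l i + col l j ≡ i + j → row l i ≡ j × col l j ≡ i
  fits e with j <? row l i
  ... | yes x = ⊥-elim (<-irrefl (sym e) (<-≤-trans (+-mono-< (r→c l x) x) (≤-reflexive (+-comm (col l j) _))))
  ... | no x = r≡ , +-cancelˡ-≡ j _ _ (trans (cong (_+ col l j) (sym r≡)) (trans e (+-comm i j)))
    where
    r≡ : row l i ≡ j
    r≡ = ≤-antisym (≮⇒≥ x) (+-cancelˡ-≤ i j (row l i) (≤-trans (≤-reflexive (sym e))
           (≤-trans (+-monoʳ-≤ (row l i) (≮⇒≥ (x ∘ c→r l))) (≤-reflexive (+-comm _ i)))))

removable : ∀ z l i j → pos false z l i ≡ pos true z l j ℤ.+ + 1 → row l i ≡ suc j × col l j ≡ suc i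
removable z l i j h = fits (ℤP.+-injective (≡-from h
    (trans (lem z (+ i) (+ j) (+ row l i) (+ col l j))
      (cong₂ (λ t u → t ℤ.+ u ℤ.+ (z ℤ.- t ℤ.+ + row l i)) (sym (+suc i)) (sym (+suc j))))))
  where
  lem : ∀ z i j r s → r ℤ.+ s ℤ.+ (z ℤ.+ j ℤ.- s ℤ.+ + 1) ≡ i ℤ.+ + 1 ℤ.+ (j ℤ.+ + 1) ℤ.+ (z ℤ.- (i ℤ.+ + 1) ℤ.+ r)
  lem = ℤS.solve-∀
  fits : row l i + col l j ≡ suc i + suc j → row l i ≡ suc j × col l j ≡ suc i
  fits e with j <? row l i
  ... | no x = ⊥-elim (<-irrefl e (≤-<-trans (+-mono-≤ (≮⇒≥ x) (≮⇒≥ (x ∘ c→r l)))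
                 (≤-trans (≤-reflexive (cong suc (+-comm j i))) (+-monoʳ-≤ (suc i) (n≤1+n j)))))
  ... | yes x = r≡ , +-cancelˡ-≡ (suc j) _ _ (trans (cong (_+ col l j) (sym r≡)) (trans e (+-comm (suc i) (suc j))))
    where
    r≡ : row l i ≡ suc j
    r≡ = ≤-antisym (+-cancelʳ-≤ (suc i) (row l i) (suc j) (≤-trans (+-monoʳ-≤ (row l i) (r→c l x)) (≤-trans (≤-reflexive e) (≤-reflexive (+-comm (suc i) (suc j)))))) x

-- Flips of a sequence of partitions

AddBox-cong : ∀ {l l⁺ k k'} → (∀ q → k q ≡ k' q) → AddBox l l⁺ k → AddBox l l⁺ k'
AddBox-cong {l} {l⁺} {k} {k'} h a = record
  { at = λ q → trans (cong (part q l) (sym (h q))) (trans (at q) (h (not q)))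
  ; at⁺ = λ q → trans (cong (part q l⁺) (sym (h q))) (trans (at⁺ q) (cong suc (h (not q))))
  ; off = λ q n → off q (λ e → n (trans e (h q))) }
  where open AddBox a

box-eta : ∀ (k : Bool → ℕ) q → box (k false) (k true) q ≡ k q
box-eta k true = refl
box-eta k false = refl

box-pos : ∀ {l l⁺ k} z → AddBox l l⁺ k → ∃ λ n → (∀ q → pos q z l (k q) ≡ n ⊕ q) × (∀ q → pos q z l⁺ (k q) ≡ n ⊕ not q)
box-pos {l} {l⁺} {k} z a = n , (λ { true → p1 ; false → p2 }) , (λ { true → p3 ; false → p4 })
  where
  open AddBox a
  n = z ℤ.- + suc (k false) ℤ.+ + k true
  lem : ∀ z i j → z ℤ.+ j ℤ.- i ≡ z ℤ.- (i ℤ.+ + 1) ℤ.+ j ℤ.+ + 1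
  lem = ℤS.solve-∀
  lem' : ∀ z i j → z ℤ.+ j ℤ.- i ≡ z ℤ.- i ℤ.+ j
  lem' = ℤS.solve-∀
  p1 : pos true z l (k true) ≡ n ℤ.+ + 1
  p1 = trans (cong (λ t → z ℤ.+ + k true ℤ.- + t) (at true))
    (trans (lem z (+ k false) (+ k true)) (cong (λ t → z ℤ.- t ℤ.+ + k true ℤ.+ + 1) (sym (+suc (k false)))))
  p2 : pos false z l (k false) ≡ n
  p2 = cong (λ t → z ℤ.- + suc (k false) ℤ.+ + t) (at false)
  p3 : pos true z l⁺ (k true) ≡ n
  p3 = trans (cong (λ t → z ℤ.+ + k true ℤ.- + t) (at⁺ true)) (lem' z (+ suc (k false)) (+ k true))
  p4 : pos false z l⁺ (k false) ≡ n ℤ.+ + 1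
  p4 = trans (cong (λ t → z ℤ.- + suc (k false) ℤ.+ + t) (at⁺ false))
    (trans (cong (λ t → z ℤ.- + suc (k false) ℤ.+ t) (+suc (k true))) (sym (ℤP.+-assoc (z ℤ.- + suc (k false)) (+ k true) (+ 1))))

add-box-at : ∀ z l k n → (∀ q → pos q z l (k q) ≡ n ⊕ q) → Σ Part λ l⁺ → AddBox l l⁺ k
add-box-at z l k n h =
  let r , s = addable z l (k false) (k true) (trans (h true) (cong (ℤ._+ + 1) (sym (h false))))
      l⁺ , a = add-box l (k false) (k true) r s
  in l⁺ , AddBox-cong {l} {l⁺} (box-eta k) a

remove-box-at : ∀ z l k n → (∀ q → pos q z l (k q) ≡ n ⊕ not q) → Σ Part λ l⁻ → AddBox l⁻ l k
remove-box-at z l k n h =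
  let r , s = removable z l (k false) (k true) (trans (h false) (cong (ℤ._+ + 1) (sym (h true))))
      l⁻ , a = remove-box l (k false) (k true) r s
  in l⁻ , AddBox-cong {l⁻} {l} (box-eta k) a

flipEdge-low : ∀ h m n → flipEdge h true m n ≡ edgeDom m n h
flipEdge-low true m n = refl
flipEdge-low false m n = refl

flipEdge-high : ∀ h m n → flipEdge h false m n ≡ edgeDom (suc m) (n ⊕ not h) h
flipEdge-high true m n = refl
flipEdge-high false m n = refl

⊕-not : ∀ n h → n ⊕ not h ⊕ h ≡ n ℤ.+ + 1
⊕-not n true = refl
⊕-not n false = refl

b≢not : ∀ b → ¬ b ≡ not b
b≢not true ()
b≢not false ()

n+2≢n : ∀ n → ¬ n ℤ.+ + 1 ℤ.+ + 1 ≡ n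
n+2≢n n h with ≡-from {+ 2} {+ 0} h (lem n)
  where
  lem : ∀ n → + 2 ℤ.+ n ≡ + 0 ℤ.+ (n ℤ.+ + 1 ℤ.+ + 1)
  lem = ℤS.solve-∀
... | ()

squeeze-tail : ∀ p t n b b' → t ⊕ b ≡ n ⊕ p → t ⊕ b' ≡ n ⊕ not p → t ≡ n
squeeze-tail true t n b b' e e' = core b b' e e'
  where
  core : ∀ b b' → t ⊕ b ≡ n ℤ.+ + 1 → t ⊕ b' ≡ n → t ≡ n
  core b false e e' = e'
  core true true e e' = ⊕-cancel t n true e
  core false true refl e' = ⊥-elim (n+2≢n n e')
squeeze-tail false t n b b' e e' = squeeze-tail true t n b' b e' e

squeeze-head : ∀ p t n b b' → n ⊕ p ⊕ b ≡ t → n ⊕ not p ⊕ b' ≡ t → t ≡ n ℤ.+ + 1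
squeeze-head true t n b b' e e' = core b b' e e'
  where
  core : ∀ b b' → n ℤ.+ + 1 ⊕ b ≡ t → n ⊕ b' ≡ t → t ≡ n ℤ.+ + 1
  core false b' e e' = sym e
  core true true e e' = sym e'
  core true false e refl = ⊥-elim (n+2≢n n e)
squeeze-head false t n b b' e e' = squeeze-head true t n b' b e' e

module FlipSeq (w : List Sign) (A : ℤ) where

  module Eg = Edges w A

  charge : ℕ → ℤ
  charge m = A ℤ.+ + c w m

  Rep : Tiling → PartSeq → Set
  Rep T f = Supported T × (∀ m n b → edge T m n b ≡ Eg.edges f m n b)

  tilingOf : PartSeq → Tiling
  tilingOf f = tile (Eg.edges f)

  rep-tiling : ∀ f → Rep (tilingOf f) f
  rep-tiling f = tile-supported (Eg.edges f) , edge-tile (Eg.edges f)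

  rep-ext : ∀ {T T' f} → (∀ o x y → T o x y ≡ T' o x y) → Rep T f → Rep T' f
  rep-ext {T} {T'} h (s , e) = (λ o x y t → s o x y (trans (h o x y) t)) ,
    λ m n b → let o , x , y = edgeDom m n b in trans (sym (h o x y)) (e m n b)

  rep-∋ : ∀ {T f} → Rep T f → ∀ m n b → Eg.IsEdge f m n b → T ∋ edgeDom m n b
  rep-∋ {f = f} (_ , e) m n b h = trans (e m n b) (Eg.edges-complete f m n b h)

  rep-∈ : ∀ {T f} → Rep T f → ∀ m n b → T ∋ edgeDom m n b → Eg.IsEdge f m n b
  rep-∈ {f = f} (_ , e) m n b h = Eg.edges-sound f m n b (trans (sym (e m n b)) h)

  -- The two edges of a flippable square on level suc m; h tells whether they are horizontal.
  record State (f : PartSeq) (h : Bool) (m : ℕ) (n : ℤ) (k : Bool → ℕ) : Set where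
    field
      tail₁ : Eg.tailPos f m (k (par m)) ≡ n
      head₁ : Eg.headPos f m (k (par m)) ≡ n ⊕ h
      tail₂ : Eg.tailPos f (suc m) (k (not (par m))) ≡ n ⊕ not h
      head₂ : Eg.headPos f (suc m) (k (not (par m))) ≡ n ℤ.+ + 1
  open State

  record Differ (f f' : PartSeq) (m : ℕ) (k : Bool → ℕ) : Set where
    field
      elsewhere : ∀ x → ¬ x ≡ suc m → f x ≈ f' x
      rest : ∀ q {x} → ¬ x ≡ k q → part q (f (suc m)) x ≡ part q (f' (suc m)) x
  open Differ

  Differ-sym : ∀ {f f' m k} → Differ f f' m k → Differ f' f m k
  Differ-sym {f} {f'} d = record
    { elsewhere = λ x h → ≈-sym {f x} {f' x} (elsewhere d x h) ; rest = λ q h → sym (rest d q h) }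

  -- An edge meets the changed partition only through the part with which it arrives at or leaves
  -- diagonal `suc m`. If this part is the changed one, `State` fixes the whole edge and it belongs
  -- to the flipped pair.
  transfer : ∀ {f f' h m n k} → Differ f f' m k → State f h m n k → ∀ m' n' b → Eg.IsEdge f m' n' b →
    (∀ i → ¬ edgeDom m' n' b ≡ flipEdge h i m n) → Eg.IsEdge f' m' n' b
  transfer {f} {f'} {h} {m} {n} {k} d st m' n' b (lt , x , e , e') no-flip = lt , x , trans e tails , trans e' heads
    where
    tails : Eg.tailPos f m' x ≡ Eg.tailPos f' m' x
    tails with m' ≟ suc m
    ... | no ne = pos-cong (par m') _ (f m') _ (f' m') x refl (part-cong (par m') {f m'} {f' m'} (elsewhere d m' ne) x)
    ... | yes refl with x ≟ k (not (par m))
    ...   | no ne = pos-cong (not (par m)) _ (f (suc m)) _ (f' (suc m)) x refl (rest d (not (par m)) ne)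
    ...   | yes refl = ⊥-elim (no-flip false (trans (cong₂ (edgeDom (suc m)) n≡ b≡) (sym (flipEdge-high h m n))))
      where
      n≡ : n' ≡ n ⊕ not h
      n≡ = trans e (tail₂ st)
      b≡ : b ≡ h
      b≡ = ⊕-inj (n ⊕ not h) b h (trans (cong (_⊕ b) (sym n≡)) (trans e' (trans (head₂ st) (sym (⊕-not n h)))))
    heads : Eg.headPos f m' x ≡ Eg.headPos f' m' x
    heads with m' ≟ m
    ... | no ne = pos-cong (par m') _ (f (suc m')) _ (f' (suc m')) x refl
            (part-cong (par m') {f (suc m')} {f' (suc m')} (elsewhere d (suc m') (ne ∘ suc-injective)) x)
    ... | yes refl with x ≟ k (par m)
    ...   | no ne = pos-cong (par m) _ (f (suc m)) _ (f' (suc m)) x refl (rest d (par m) ne)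
    ...   | yes refl = ⊥-elim (no-flip true (trans (cong₂ (edgeDom m) n≡ b≡) (sym (flipEdge-low h m n))))
      where
      n≡ : n' ≡ n
      n≡ = trans e (tail₁ st)
      b≡ : b ≡ h
      b≡ = ⊕-inj n b h (trans (cong (_⊕ b) (sym n≡)) (trans e' (head₁ st)))

  state-edges : ∀ {f h m n k T} → suc m < length w → Rep T f → State f h m n k → ∀ i → T ∋ flipEdge h i m n
  state-edges {f} {h} {m} {n} {k} {T} lt rp st true = subst (T ∋_) (sym (flipEdge-low h m n))
    (rep-∋ {T} {f} rp m n h (<-trans (n<1+n m) lt , k (par m) , sym (tail₁ st) , sym (head₁ st)))
  state-edges {f} {h} {m} {n} {k} {T} lt rp st false = subst (T ∋_) (sym (flipEdge-high h m n))
    (rep-∋ {T} {f} rp (suc m) (n ⊕ not h) h (lt , k (not (par m)) , sym (tail₂ st) , trans (⊕-not n h) (sym (head₂ st))))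

  state-excludes : ∀ {f h m n k T} → Rep T f → State f (not h) m n k → ∀ i → ¬ T ∋ flipEdge h i m n
  state-excludes {f} {h} {m} {n} {k} {T} rp st true t
    with rep-∈ {T} {f} rp m n h (subst (T ∋_) (flipEdge-low h m n) t)
  ... | _ , x , e , e' with pos-inj (par m) (charge m) (f m) (trans (sym e) (sym (tail₁ st)))
  ...   | refl = b≢not h (⊕-inj n h (not h) (trans e' (head₁ st)))
  state-excludes {f} {h} {m} {n} {k} {T} rp st false t
    with rep-∈ {T} {f} rp (suc m) (n ⊕ not h) h (subst (T ∋_) (flipEdge-high h m n) t)
  ... | _ , x , e , e' with pos-inj (par (suc m)) (charge (suc (suc m))) (f (suc (suc m)))
                            (trans (sym e') (trans (⊕-not n h) (sym (head₂ st))))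
  ...   | refl = b≢not (not h) (⊕-inj n (not h) (not (not h)) (trans e (tail₂ st)))

  flip-states : ∀ {f f' h m n k T T'} → suc m < length w → Rep T f → Rep T' f' →
    Differ f f' m k → State f h m n k → State f' (not h) m n k → flipRel h m n T T'
  flip-states {f} {f'} {h} {m} {n} {k} {T} {T'} lt rp rp' d st st' = mkFlipRel h m n T T' (proj₁ rp) (proj₁ rp')
    (state-edges {f} {h} {m} {n} {k} {T} lt rp st) (state-edges {f'} {not h} {m} {n} {k} {T'} lt rp' st')
    (state-excludes {f'} {h} {m} {n} {k} {T'} rp' st')
    (state-excludes {f} {not h} {m} {n} {k} {T} rp (subst (λ z → State f z m n k) (sym (not-not h)) st))
    λ m' n' b no → bool-ext
      (λ t → rep-∋ {T'} {f'} rp' m' n' b (transfer d st m' n' b (rep-∈ {T} {f} rp m' n' b t) (no h)))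
      (λ t → rep-∋ {T} {f} rp m' n' b (transfer (Differ-sym d) st' m' n' b (rep-∈ {T'} {f'} rp' m' n' b t) (no (not h))))

  -- The box moves a head on diagonal `suc m` between `n` and `n + 1` while its tail on diagonal `m`
  -- stays, and only the tail `n` reaches both. In the same way the head on diagonal `suc (suc m)`
  -- must be `n + 1`. So the edges around the box form a flippable square.
  box-states : ∀ {f f⁺ m k} → Seq true w f → Seq true w f⁺ → suc m < length w →
    (∀ x → ¬ x ≡ suc m → f x ≈ f⁺ x) → AddBox (f (suc m)) (f⁺ (suc m)) k →
    ∃ λ n → State f (par m) m n k × State f⁺ (not (par m)) m n k
  box-states {f} {f⁺} {m} {k} sq sq⁺ lt same ab with box-pos (charge (suc m)) ab
  ... | n , at , at⁺ = n ,
    record { tail₁ = t₁ ; head₁ = at p ; tail₂ = at (not p) ; head₂ = h₂ } ,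
    record { tail₁ = trans (sym tails) t₁ ; head₁ = at⁺ p ; tail₂ = at⁺ (not p) ; head₂ = trans (sym heads) h₂ }
    where
    p = par m
    m<L = <-trans (n<1+n m) lt
    tails : Eg.tailPos f m (k p) ≡ Eg.tailPos f⁺ m (k p)
    tails = pos-cong p _ (f m) _ (f⁺ m) (k p) refl (part-cong p {f m} {f⁺ m} (same m (λ e → 1+n≢n (sym e))) (k p))
    heads : Eg.headPos f (suc m) (k (not p)) ≡ Eg.headPos f⁺ (suc m) (k (not p))
    heads = pos-cong (not p) _ (f (suc (suc m))) _ (f⁺ (suc (suc m))) (k (not p)) refl
      (part-cong (not p) {f (suc (suc m))} {f⁺ (suc (suc m))} (same (suc (suc m)) 1+n≢n) (k (not p)))
    t₁ : Eg.tailPos f m (k p) ≡ n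
    t₁ = let b , e = Eg.hop-exists f sq m m<L (k p) ; b' , e' = Eg.hop-exists f⁺ sq⁺ m m<L (k p) in
      squeeze-tail p _ n b b' (trans e (at p)) (trans (cong (_⊕ b') tails) (trans e' (at⁺ p)))
    h₂ : Eg.headPos f (suc m) (k (not p)) ≡ n ℤ.+ + 1
    h₂ = let b , e = Eg.hop-exists f sq (suc m) lt (k (not p)) ; b' , e' = Eg.hop-exists f⁺ sq⁺ (suc m) lt (k (not p)) in
      squeeze-head (not p) _ n b b' (trans (cong (_⊕ b) (sym (at (not p)))) e)
        (trans (cong (_⊕ b') (sym (at⁺ (not p)))) (trans e' (sym heads)))

  box-differ : ∀ {f f⁺ m k} → (∀ x → ¬ x ≡ suc m → f x ≈ f⁺ x) → AddBox (f (suc m)) (f⁺ (suc m)) k → Differ f f⁺ m k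
  box-differ same ab = record { elsewhere = same ; rest = AddBox.off ab }

  box-flip : ∀ {f f⁺ m k T T⁺} → Seq true w f → Seq true w f⁺ → suc m < length w → Rep T f → Rep T⁺ f⁺ →
    (∀ x → ¬ x ≡ suc m → f x ≈ f⁺ x) → AddBox (f (suc m)) (f⁺ (suc m)) k → Flip T T⁺
  box-flip {f} {f⁺} {m} {k} {T} {T⁺} sq sq⁺ lt rp rp⁺ same ab =
    let n , st , st⁺ = box-states {f} {f⁺} {m} {k} sq sq⁺ lt same ab
    in flipRel⇒Flip (par m) m n T T⁺ (flip-states {f} {f⁺} {par m} {m} {n} {k} {T} {T⁺} lt rp rp⁺ (box-differ {f} {f⁺} same ab) st st⁺)

updS : PartSeq → ℕ → Part → PartSeq
updS f i v x with x ≟ i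
... | yes _ = v
... | no _ = f x

updS-at : ∀ f i v → updS f i v i ≡ v
updS-at f i v with i ≟ i
... | yes _ = refl
... | no h = ⊥-elim (h refl)

updS-off : ∀ f i v {x} → ¬ x ≡ i → updS f i v x ≡ f x
updS-off f i v {x} h with x ≟ i
... | yes e = ⊥-elim (h e)
... | no _ = refl

≡⇒≈ : ∀ {p q} → p ≡ q → p ≈ q
≡⇒≈ refl i = refl

Weight-Σ : ∀ ws f → Weight ws f ≡ Σ< (length ws) (λ m → size (f (suc m)))
Weight-Σ [] f = refl
Weight-Σ (_ ∷ ws) f = trans (cong (λ t → size (f 1) + t) (Weight-Σ ws (f ∘ suc))) (sym (Σ<-shift (length ws) (λ m → size (f (suc m)))))

Weight-bump : ∀ ws {f f⁺ m k} → suc m < length ws → (∀ x → ¬ x ≡ suc m → f x ≈ f⁺ x) →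
  AddBox (f (suc m)) (f⁺ (suc m)) k → Weight ws f⁺ ≡ suc (Weight ws f)
Weight-bump ws {f} {f⁺} {m} lt same ab = trans (Weight-Σ ws f⁺) (trans
  (Σ<-bump (length ws) (λ x → size (f (suc x))) (λ x → size (f⁺ (suc x))) m (<-trans (n<1+n m) lt) (add-size ab)
    (λ x ne → size-cong {f (suc x)} {f⁺ (suc x)} (same (suc x) (ne ∘ suc-injective))))
  (cong suc (sym (Weight-Σ ws f))))

pick : Bool → ℕ → ℕ → Bool → ℕ
pick true a b true = a
pick true a b false = b
pick false a b true = b
pick false a b false = a

pick-same : ∀ p a b → pick p a b p ≡ a
pick-same true a b = refl
pick-same false a b = refl

pick-other : ∀ p a b → pick p a b (not p) ≡ b
pick-other true a b = refl
pick-other false a b = refl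

by-parity : ∀ (P : Bool → Set) p → P p → P (not p) → ∀ q → P q
by-parity P true x y true = x
by-parity P true x y false = y
by-parity P false x y true = y
by-parity P false x y false = x

≡-or-not : ∀ h p → h ≡ p ⊎ h ≡ not p
≡-or-not true true = inj₁ refl
≡-or-not true false = inj₂ refl
≡-or-not false true = inj₂ refl
≡-or-not false false = inj₁ refl

module FlipForward (w : List Sign) (A : ℤ) where
  open FlipSeq w A
  open State
  open Differ

  -- Only two moves differ from those of `f`, and they belong to the two new edges. An edge
  -- prescribes a hop by 0 or 1, from which `pos-move` recovers the strip condition.
  seq-flip : ∀ {f f' h m n k} → suc m < length w → Differ f f' m k → State f' h m n k → Seq true w f → Seq true w f'
  seq-flip {f} {f'} {h} {m} {n} {k} lt d st sq = mkSeq true w f' (λ x s nx → move-step (par x) s (f' x) (f' (suc x)) (mv x s nx)) last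
    where
    last : IsEmpty (f' (length w))
    last = ≈-trans {f' (length w)} {f (length w)} {∅} (≈-sym {f (length w)} {f' (length w)}
      (elsewhere d (length w) (λ e → <⇒≢ lt (sym e)))) (seq-last true w f sq)
    mv : ∀ x s → nth w x s → ∀ y → ∃ (Move s (part (par x) (f' x) y) (part (par x) (f' (suc x)) y))
    mv x s nx y = go
      where
      old : ∃ (Move s (part (par x) (f x) y) (part (par x) (f (suc x)) y))
      old = step-move (par x) s (f x) (f (suc x)) (seq-step true w f sq x s nx) y
      chg : ∀ l → pos (par x) (charge (suc x)) l y ≡ pos (par x) (charge x ℤ.+ + incr (par x) s) l y
      chg l = pos-cong (par x) _ l _ l y (Eg.charge-suc f x s nx) refl
      away : ∀ z → ¬ z ≡ suc m → ∀ q → part q (f z) y ≡ part q (f' z) y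
      away z ne q = part-cong q {f z} {f' z} (elsewhere d z ne) y
      go : ∃ (Move s (part (par x) (f' x) y) (part (par x) (f' (suc x)) y))
      go with x ≟ m
      ... | yes refl with y ≟ k (par m)
      ...   | no ne = subst₂ (λ a b → ∃ (Move s a b)) (away m (λ e → 1+n≢n (sym e)) (par m)) (rest d (par m) ne) old
      ...   | yes refl = pos-move (par m) s (charge m) (f' m) (f' (suc m)) (k (par m)) h
                (trans (cong (_⊕ h) (tail₁ st)) (trans (sym (head₁ st)) (chg (f' (suc m)))))
      go | no x≢m with x ≟ suc m
      ... | no ne = subst₂ (λ a b → ∃ (Move s a b)) (away x ne (par x)) (away (suc x) (x≢m ∘ suc-injective) (par x)) old
      ... | yes refl with y ≟ k (not (par m))
      ...   | no ne = subst₂ (λ a b → ∃ (Move s a b)) (rest d (not (par m)) ne) (away (suc (suc m)) 1+n≢n (not (par m))) old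
      ...   | yes refl = pos-move (not (par m)) s (charge (suc m)) (f' (suc m)) (f' (suc (suc m))) (k (not (par m))) h
                (trans (cong (_⊕ h) (tail₂ st)) (trans (⊕-not n h) (trans (sym (head₂ st)) (chg (f' (suc (suc m)))))))

  Result : PartSeq → Tiling → Set
  Result f T' = Σ PartSeq λ f' → Seq true w f' × IsEmpty (f' 0) × Rep T' f' × Weight w f' ≤ suc (Weight w f)

  -- If `h` is `par m`, the two edges put a particle at `n` and a hole at `n + 1` of diagonal
  -- `suc m`, so a box can be added; otherwise the two are exchanged and a box can be removed. The
  -- result of a flip is determined by its square, hence is the tiling of the new sequence.
  flip-step : ∀ {f T T'} → Seq true w f → IsEmpty (f 0) → Rep T f → Flip T T' → Result f T'
  flip-step {f} {T} {T'} sq f0 rp fl with Flip⇒flipRel {T} {T'} (proj₁ rp) fl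
  ... | h , m , n , ts , rpl
    with rep-∈ {T} {f} rp m n h (subst (T ∋_) (flipEdge-low h m n) (ts true))
       | rep-∈ {T} {f} rp (suc m) (n ⊕ not h) h (subst (T ∋_) (flipEdge-high h m n) (ts false))
  ... | _ , a , e₁ , e₂ | lt , b , e₃ , e₄ = finish (≡-or-not h p)
    where
    p = par m
    z = charge (suc m)
    l = f (suc m)
    k : Bool → ℕ
    k = pick p a b
    st : State f h m n k
    st = record
      { tail₁ = trans (cong (Eg.tailPos f m) (pick-same p a b)) (sym e₁)
      ; head₁ = trans (cong (Eg.headPos f m) (pick-same p a b)) (sym e₂)
      ; tail₂ = trans (cong (Eg.tailPos f (suc m)) (pick-other p a b)) (sym e₃)
      ; head₂ = trans (cong (Eg.headPos f (suc m)) (pick-other p a b)) (trans (sym e₄) (⊕-not n h)) }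
    -- The exponent is `not q` when `h` equals `p`, the positions with the box present, and `q`
    -- otherwise, those with the box absent.
    replaceBy : ∀ l' → (∀ q → pos q z l' (k q) ≡ n ⊕ agree (agree h p) (not q)) →
      (∀ q {x} → ¬ x ≡ k q → part q l x ≡ part q l' x) →
      Weight w (updS f (suc m) l') ≤ suc (Weight w f) → Result f T'
    replaceBy l' ps off wt = f' , seq-flip {f} {f'} {not h} {m} {n} {k} lt df st' sq ,
        ≈-trans {f' 0} {f 0} {∅} (≡⇒≈ (updS-off f (suc m) l' (λ ()))) f0 ,
        rep-ext {tilingOf f'} {T'} {f'} (Replace-unique {T = T} {T' = tilingOf f'} {T'' = T'} (proj₂ fr) rpl) (rep-tiling f') , wt
      where
      f' = updS f (suc m) l'
      f'≡ : ∀ x → ¬ x ≡ suc m → f' x ≡ f x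
      f'≡ x ne = updS-off f (suc m) l' ne
      df : Differ f f' m k
      df = record { elsewhere = λ x ne → ≡⇒≈ (sym (f'≡ x ne))
                  ; rest = λ q {x} ne → trans (off q ne) (cong (λ t → part q t x) (sym (updS-at f (suc m) l'))) }
      new-pos : ∀ q → pos q z (f' (suc m)) (k q) ≡ n ⊕ agree (agree h p) (not q)
      new-pos q = trans (cong (λ t → pos q z t (k q)) (updS-at f (suc m) l')) (ps q)
      b₁ : ∀ h p → agree (agree h p) (not p) ≡ not h
      b₁ true true = refl
      b₁ true false = refl
      b₁ false true = refl
      b₁ false false = refl
      b₂ : ∀ h p → agree (agree h p) (not (not p)) ≡ not (not h)
      b₂ true true = refl
      b₂ true false = refl
      b₂ false true = refl
      b₂ false false = refl
      st' : State f' (not h) m n k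
      st' = record
        { tail₁ = trans (cong (λ t → pos p (charge m) t (k p)) (f'≡ m (λ e → 1+n≢n (sym e)))) (tail₁ st)
        ; head₁ = trans (new-pos p) (cong (n ⊕_) (b₁ h p))
        ; tail₂ = trans (new-pos (not p)) (cong (n ⊕_) (b₂ h p))
        ; head₂ = trans (cong (λ t → pos (not p) (charge (suc (suc m))) t (k (not p))) (f'≡ (suc (suc m)) 1+n≢n)) (head₂ st) }
      fr : flipRel h m n T (tilingOf f')
      fr = flip-states {f} {f'} {h} {m} {n} {k} {T} {tilingOf f'} lt rp (rep-tiling f') df st st'
    finish : h ≡ p ⊎ h ≡ not p → Result f T'
    finish (inj₁ h≡p) = replaceBy l⁺ (λ q → trans (proj₂ (proj₂ bp) q) (cong₂ _⊕_ n₀≡n (sym (same-agree h p q h≡p)))) (AddBox.off ab)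
        (≤-reflexive (Weight-bump w {f} {updS f (suc m) l⁺} {m} {k} lt (λ x ne → ≡⇒≈ (sym (updS-off f (suc m) l⁺ ne)))
          (subst (λ t → AddBox l t k) (sym (updS-at f (suc m) l⁺)) ab)))
      where
      here : ∀ q → pos q z l (k q) ≡ n ⊕ q
      here = by-parity (λ q → pos q z l (k q) ≡ n ⊕ q) p (trans (head₁ st) (cong (n ⊕_) h≡p))
        (trans (tail₂ st) (cong (λ t → n ⊕ not t) h≡p))
      new = add-box-at z l k n here
      l⁺ = proj₁ new
      ab = proj₂ new
      bp = box-pos z ab
      n₀≡n : proj₁ bp ≡ n
      n₀≡n = ⊕-cancel _ _ true (trans (sym (proj₁ (proj₂ bp) true)) (here true))
      same-agree : ∀ h p q → h ≡ p → agree (agree h p) (not q) ≡ not q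
      same-agree true _ q refl = refl
      same-agree false _ q refl = refl
    finish (inj₂ h≡¬p) = replaceBy l⁻ (λ q → trans (proj₁ (proj₂ bp) q) (cong₂ _⊕_ n₀≡n (sym (other-agree h p q h≡¬p))))
        (λ q ne → sym (AddBox.off ab q ne))
        (≤-trans (n≤1+n _) (≤-trans (≤-reflexive (sym (Weight-bump w {updS f (suc m) l⁻} {f} {m} {k} lt
          (λ x ne → ≡⇒≈ (updS-off f (suc m) l⁻ ne)) (subst (λ t → AddBox t l k) (sym (updS-at f (suc m) l⁻)) ab)))) (n≤1+n _)))
      where
      here : ∀ q → pos q z l (k q) ≡ n ⊕ not q
      here = by-parity (λ q → pos q z l (k q) ≡ n ⊕ not q) p (trans (head₁ st) (cong (n ⊕_) h≡¬p))
        (trans (tail₂ st) (cong (λ t → n ⊕ not t) h≡¬p))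
      new = remove-box-at z l k n here
      l⁻ = proj₁ new
      ab = proj₂ new
      bp = box-pos z ab
      n₀≡n : proj₁ bp ≡ n
      n₀≡n = ⊕-cancel _ _ true (trans (sym (proj₂ (proj₂ bp) false)) (here false))
      other-agree : ∀ h p q → h ≡ not p → agree (agree h p) (not q) ≡ q
      other-agree h true q refl = not-not q
      other-agree h false q refl = not-not q

  reach-lower : ∀ n {f T T'} → Seq true w f → IsEmpty (f 0) → Rep T f → Reach T T' n →
    Σ PartSeq λ f' → Seq true w f' × IsEmpty (f' 0) × Rep T' f' × Weight w f' ≤ Weight w f + n
  reach-lower zero {f} {T} {T'} sq f0 rp h = f , sq , f0 , rep-ext {T} {T'} {f} h rp , m≤m+n _ _
  reach-lower (suc n) {f} {T} {T'} sq f0 rp (T₁ , fl , r) with flip-step {f} {T} {T₁} sq f0 rp fl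
  ... | f₁ , sq₁ , e₁ , rp₁ , w₁ with reach-lower n {f₁} {T₁} {T'} sq₁ e₁ rp₁ r
  ...   | f₂ , sq₂ , e₂ , rp₂ , w₂ = f₂ , sq₂ , e₂ , rp₂ ,
      ≤-trans w₂ (≤-trans (+-monoˡ-≤ n w₁) (≤-reflexive (sym (+-suc (Weight w f) n))))

-- Every nonempty sequence has a removable box: one maximizing the rank
-- 2 (i + j) + height m, where the height falls at + and rises at -.

height : List Sign → ℕ → ℕ
height [] m = 0
height (plus ∷ ws) zero = suc (height ws 0)
height (minus ∷ ws) zero = height ws 0
height (plus ∷ ws) (suc m) = height ws m
height (minus ∷ ws) (suc m) = suc (height ws m)

height-plus : ∀ w m → nth w m plus → height w m ≡ suc (height w (suc m))
height-plus (plus ∷ w) zero h = refl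
height-plus (plus ∷ w) (suc m) h = height-plus w m h
height-plus (minus ∷ w) (suc m) h = cong suc (height-plus w m h)

height-minus : ∀ w m → nth w m minus → height w (suc m) ≡ suc (height w m)
height-minus (minus ∷ w) zero h = refl
height-minus (plus ∷ w) (suc m) h = height-minus w m h
height-minus (minus ∷ w) (suc m) h = cong suc (height-minus w m h)

argmax : ∀ (g : ℕ → ℕ) K → ∃ λ i → i ≤ K × (∀ i' → i' ≤ K → g i' ≤ g i)
argmax g zero = 0 , z≤n , λ { zero _ → ≤-refl }
argmax g (suc K) with argmax g K
... | i , i≤K , h with g (suc K) ≤? g i
...   | yes x = i , m≤n⇒m≤1+n i≤K , λ i' l → [ (λ l' → h i' (≤-pred l')) , (λ { refl → x }) ]′ (m≤n⇒m<n∨m≡n l)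
...   | no x = suc K , ≤-refl , λ i' l →
          [ (λ l' → ≤-trans (h i' (≤-pred l')) (<⇒≤ (≰⇒> x))) , (λ { refl → ≤-refl }) ]′ (m≤n⇒m<n∨m≡n l)

-- Within a row of length `r` the last box has the greatest rank, so it represents the row. The
-- `suc` ranks every box above an empty row.
rank : ℕ → ℕ → ℕ → ℕ
rank i zero h = 0
rank i (suc j) h = suc (i + j + (i + j) + h)

rank-≥ : ∀ i {j r} h → j < r → suc (i + j + (i + j) + h) ≤ rank i r h
rank-≥ i {j} {suc r} h j<r = s≤s (+-monoˡ-≤ h (+-mono-≤ (+-monoʳ-≤ i (≤-pred j<r)) (+-monoʳ-≤ i (≤-pred j<r))))

str-shrink-upper : ∀ t x l⁻ l {k} → AddBox l⁻ l k → ¬ k true < row x (k false) → Str t x l → Str t x l⁻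
str-shrink-upper t x l⁻ l {k} ab ¬box st y with y ≟ k t
... | no ne = subst (λ v → part t x y ≤ v × v ≤ suc (part t x y)) (sym (AddBox.off ab t ne)) (st y)
... | yes refl rewrite AddBox.at ab t = small t ¬box ,
        ≤-trans (n≤1+n _) (≤-trans (≤-reflexive (sym (AddBox.at⁺ ab t))) (proj₂ (st (k t))))
  where
  small : ∀ t → ¬ k true < row x (k false) → part t x (k t) ≤ k (not t)
  small true h = ≮⇒≥ (h ∘ c→r x)
  small false h = ≮⇒≥ h

-- Only the shortened row or column can violate the strip condition, and it does so only if `x`
-- continues beyond the removed box: to the right for a vertical strip, downwards for a horizontal
-- one.
str-shrink-lower : ∀ t x l⁻ l {k} → AddBox l⁻ l k → ¬ suc (k true) < row x (k false) → ¬ k true < row x (suc (k false)) →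
  Str t l x → Str t l⁻ x
str-shrink-lower t x l⁻ l {k} ab ¬right ¬below st y with y ≟ k t
... | no ne = subst (λ v → v ≤ part t x y × part t x y ≤ suc v) (sym (AddBox.off ab t ne)) (st y)
... | yes refl rewrite AddBox.at ab t =
        ≤-trans (n≤1+n _) (≤-trans (≤-reflexive (sym (AddBox.at⁺ ab t))) (proj₁ (st (k t)))) , small t
  where
  small : ∀ t → part t x (k t) ≤ suc (k (not t))
  small true = ≮⇒≥ (¬below ∘ c→r x)
  small false = ≮⇒≥ ¬right

record Removable (w : List Sign) (f : PartSeq) : Set where
  field
    f⁻ : PartSeq
    m : ℕ
    k : Bool → ℕ
    seq⁻ : Seq true w f⁻
    first⁻ : IsEmpty (f⁻ 0)
    m< : suc m < length w
    same : ∀ x → ¬ x ≡ suc m → f⁻ x ≈ f x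
    added : AddBox (f⁻ (suc m)) (f (suc m)) k

-- Every obstacle to removing a box is a box of greater rank. A right or lower neighbour in the same
-- partition gains 2. The same box in a neighbouring partition that must stay contained gains 1 in
-- height. In a neighbouring partition that contains this one, the obstacle is a right or lower
-- neighbour: it gains 2 and loses only 1 in height.
removable-exists : ∀ w f → Seq true w f → IsEmpty (f 0) → ¬ Weight w f ≡ 0 → Removable w f
removable-exists w f sq f0 wt = result
  where
  L = length w
  -- At least the number of rows of every partition involved, so rows beyond `K` are empty and the
  -- maximum is global.
  K = Σ< (suc L) (λ m → col (f m) 0)
  rk : ℕ → ℕ → ℕ
  rk m i = rank i (row (f m) i) (height w m)
  bestRow : ∀ m → ∃ λ i → i ≤ K × (∀ i' → i' ≤ K → rk m i' ≤ rk m i)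
  bestRow m = argmax (rk m) K
  best = argmax (λ m → rk m (proj₁ (bestRow m))) L
  m* = proj₁ best
  i* = proj₁ (bestRow m*)
  maximal : ∀ m i → m ≤ L → rk m i ≤ rk m* i*
  maximal m i m≤L with i ≤? K
  ... | yes h = ≤-trans (proj₂ (proj₂ (bestRow m)) i h) (proj₂ (proj₂ best) m m≤L)
  ... | no h rewrite row-zero (f m) (≤-trans (Σ<-term (suc L) (λ m → col (f m) 0) m (s≤s m≤L)) (<⇒≤ (≰⇒> h))) = z≤n
  all-empty : row (f m*) i* ≡ 0 → Weight w f ≡ 0
  all-empty e = trans (Weight-Σ w f) (trans (Σ<-cong L (λ m m<L → size-empty {f (suc m)} (λ i → zero-row (suc m) i m<L)))
      (Σ<-tail0 {0} {L} (λ _ → 0) z≤n (λ _ _ → refl)))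
    where
    zero-row : ∀ m i → m ≤ L → row (f m) i ≡ 0
    zero-row m i h = n≤0⇒n≡0 (≮⇒≥ λ x → n≮0 (≤-trans (rank-≥ i (height w m) x)
      (≤-trans (maximal m i h) (≤-reflexive (cong (λ r → rank i* r (height w m*)) e)))))
  module _ (m j : ℕ) (em : m* ≡ suc m) (e : row (f m*) i* ≡ suc j) where
    k = box i* j
    l = f (suc m)
    e' : row l i* ≡ suc j
    e' = trans (cong (λ t → row (f t) i*) (sym em)) e
    m≤L : suc m ≤ L
    m≤L = subst (_≤ L) em (proj₁ (proj₂ best))
    m<L : suc m < L
    m<L = ≤∧≢⇒< m≤L λ eL → 1+n≢0 (trans (sym e') (subst (λ t → IsEmpty (f t)) (sym eL) (seq-last true w f sq) i*))
    bound : ∀ x i → x ≤ L → rk x i ≤ suc (i* + j + (i* + j) + height w (suc m))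
    bound x i h = ≤-trans (maximal x i h) (≤-reflexive (cong₂ (rank i*) e (cong (height w) em)))
    no-box : ∀ x i j' → x ≤ L → i* + j + (i* + j) + height w (suc m) < i + j' + (i + j') + height w x → ¬ j' < row (f x) i
    no-box x i j' h lt b = <-irrefl refl (<-≤-trans lt (≤-pred (≤-trans (rank-≥ i (height w x) b) (bound x i h))))
    +2 : ∀ a h → a + a + suc h < suc a + suc a + h
    +2 a h = ≤-reflexive (lem a h)
      where
      lem : ∀ a h → suc (a + a + suc h) ≡ suc a + suc a + h
      lem = ℕS.solve-∀
    col≡ : col l j ≡ suc i*
    col≡ = ≤-antisym (≮⇒≥ λ b → no-box (suc m) (suc i*) j m≤L
               (+-monoˡ-< (height w (suc m)) (+-mono-< (n<1+n (i* + j)) (n<1+n (i* + j)))) (c→r l b))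
             (r→c l (≤-reflexive (sym e')))
    rem : Σ Part λ l⁻ → AddBox l⁻ l k
    rem = remove-box l i* j e' col≡
    l⁻ = proj₁ rem
    ab = proj₂ rem
    higher : ∀ x → x ≤ L → height w x ≡ suc (height w (suc m)) → ¬ j < row (f x) i*
    higher x h eh = no-box x i* j h (+-monoʳ-< (i* + j + (i* + j)) (≤-reflexive (sym eh)))
    lower-right : ∀ x → x ≤ L → height w (suc m) ≡ suc (height w x) → ¬ suc j < row (f x) i*
    lower-right x h eh = no-box x i* (suc j) h (subst₂ _<_ (cong (λ t → i* + j + (i* + j) + t) (sym eh))
      (cong (λ t → t + t + height w x) (sym (+-suc i* j))) (+2 (i* + j) (height w x)))
    lower-below : ∀ x → x ≤ L → height w (suc m) ≡ suc (height w x) → ¬ j < row (f x) (suc i*)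
    lower-below x h eh = no-box x (suc i*) j h (subst (λ t → i* + j + (i* + j) + t < suc i* + j + (suc i* + j) + height w x) (sym eh)
      (+2 (i* + j) (height w x)))
    g = updS f (suc m) l⁻
    g-at : g (suc m) ≡ l⁻
    g-at = updS-at f (suc m) l⁻
    g-off : ∀ {x} → ¬ x ≡ suc m → g x ≡ f x
    g-off = updS-off f (suc m) l⁻
    into : ∀ s → nth w m s → Step (par m) s (f m) l → Step (par m) s (f m) l⁻
    into plus nx = str-shrink-upper (par m) (f m) l⁻ l ab (higher m (≤-trans (n≤1+n m) m≤L) (height-plus w m nx))
    into minus nx = str-shrink-lower (par m) (f m) l⁻ l ab (lower-right m (≤-trans (n≤1+n m) m≤L) (height-minus w m nx))
      (lower-below m (≤-trans (n≤1+n m) m≤L) (height-minus w m nx))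
    outof : ∀ s → nth w (suc m) s → Step (not (par m)) s l (f (suc (suc m))) → Step (not (par m)) s l⁻ (f (suc (suc m)))
    outof plus nx = str-shrink-lower (not (par m)) (f (suc (suc m))) l⁻ l ab
      (lower-right (suc (suc m)) m<L (height-plus w (suc m) nx)) (lower-below (suc (suc m)) m<L (height-plus w (suc m) nx))
    outof minus nx = str-shrink-upper (not (par m)) (f (suc (suc m))) l⁻ l ab (higher (suc (suc m)) m<L (height-minus w (suc m) nx))
    steps : ∀ x s → nth w x s → Step (par x) s (g x) (g (suc x))
    steps x s nx with x ≟ m
    ... | yes refl = subst₂ (Step (par m) s) (sym (g-off (λ e → 1+n≢n (sym e)))) (sym g-at) (into s nx (seq-step true w f sq m s nx))
    ... | no x≢m with x ≟ suc m
    ...   | yes refl = subst (Step (not (par m)) s l⁻) (sym (g-off 1+n≢n))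
              (outof s nx (seq-step true w f sq (suc m) s nx))
    ...   | no x≢ = subst (Step (par x) s (f x)) (sym (g-off (x≢m ∘ suc-injective))) (seq-step true w f sq x s nx)
    built : Removable w f
    built = record
      { f⁻ = g ; m = m ; k = k
      ; seq⁻ = mkSeq true w g steps (subst IsEmpty (sym (g-off (λ e → <⇒≢ m<L (sym e)))) (seq-last true w f sq))
      ; first⁻ = subst IsEmpty (sym (g-off (λ ()))) f0
      ; m< = m<L
      ; same = λ x ne → ≡⇒≈ (g-off ne)
      ; added = subst (λ t → AddBox t l k) (sym g-at) ab }
  result : Removable w f
  result = go m* refl (row (f m*) i*) refl
    where
    go : ∀ a → m* ≡ a → ∀ r → row (f m*) i* ≡ r → Removable w f
    go a ea zero e = ⊥-elim (wt (all-empty e))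
    go zero ea (suc j) e = ⊥-elim (1+n≢0 (trans (sym e) (subst (λ t → row (f t) i* ≡ 0) (sym ea) (f0 i*))))
    go (suc m) ea (suc j) e = built m j ea e

-- Flip distance from the minimal tiling

-- `Reach` grows at its first flip, whereas removing a box exposes the last one. At length zero the
-- two tilings agree only pointwise, so the flip has to be transported.
reach-snoc : ∀ n {T T' T''} → Reach T T' n → Flip T' T'' → Reach T T'' (suc n)
reach-snoc zero {T} {T'} {T''} h (a , b , inj₁ (t , t' , r)) = T'' , (a , b ,
  inj₁ (trans (h hor a b) t , trans (h hor a (b ℤ.+ + 1)) t' , λ o x y → trans (r o x y) (cong (λ v → (v ∧ _) ∨ _) (sym (h o x y))))) ,
  λ o x y → refl
reach-snoc zero {T} {T'} {T''} h (a , b , inj₂ (t , t' , r)) = T'' , (a , b ,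
  inj₂ (trans (h ver a b) t , trans (h ver (a ℤ.+ + 1) b) t' , λ o x y → trans (r o x y) (cong (λ v → (v ∧ _) ∨ _) (sym (h o x y))))) ,
  λ o x y → refl
reach-snoc (suc n) (T₁ , fl , r) fl' = T₁ , fl , reach-snoc n r fl'

EqOn-from : ∀ ws {f g} → (∀ m → m ≤ length ws → f m ≈ g m) → EqOn ws f g
EqOn-from [] h = h 0 z≤n
EqOn-from (_ ∷ ws) h = h 0 z≤n , EqOn-from ws (λ m l → h (suc m) (s≤s l))

EqOn-at : ∀ ws {f g} → EqOn ws f g → ∀ m → m ≤ length ws → f m ≈ g m
EqOn-at [] h zero l = h
EqOn-at (_ ∷ ws) h zero l = proj₁ h
EqOn-at (_ ∷ ws) h (suc m) l = EqOn-at ws (proj₂ h) m (≤-pred l)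

weight-zero : ∀ ws f → IsEmpty (f 0) → Weight ws f ≡ 0 → EqOn ws f ∅s
weight-zero [] f h e = h
weight-zero (_ ∷ ws) f h e = h , weight-zero ws (f ∘ suc) (size≡0 (f 1) (m+n≡0⇒m≡0 _ e)) (m+n≡0⇒n≡0 (size (f 1)) e)

module Distance (w : List Sign) (A : ℤ) where
  open FlipSeq w A

  edges-cong : ∀ f g → EqOn w f g → ∀ m n b → Eg.edges f m n b ≡ Eg.edges g m n b
  edges-cong f g h m n b = bool-ext (go f g h) (go g f (EqOn-sym w h))
    where
    go : ∀ f g → EqOn w f g → Eg.edges f m n b ≡ true → Eg.edges g m n b ≡ true
    go f g h t with Eg.edges-sound f m n b t
    ... | lt , k , e , e' = Eg.edges-complete g m n b (lt , k ,
      trans e (pos-cong (par m) _ (f m) _ (g m) k refl (part-cong (par m) {f m} {g m} (EqOn-at w h m (<⇒≤ lt)) k)) ,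
      trans e' (pos-cong (par m) _ (f (suc m)) _ (g (suc m)) k refl (part-cong (par m) {f (suc m)} {g (suc m)} (EqOn-at w h (suc m) lt) k)))

  rep-cong : ∀ {T f g} → EqOn w f g → Rep T f → Rep T g
  rep-cong {T} {f} {g} h (s , e) = s , λ m n b → trans (e m n b) (edges-cong f g h m n b)

  rep-unique : ∀ {T T' f} → Rep T f → Rep T' f → ∀ o x y → T o x y ≡ T' o x y
  rep-unique {T} {T'} (s , e) (s' , e') = supported-ext {T} {T'} s s' (λ m n b → trans (e m n b) (sym (e' m n b)))

  reach-upper : ∀ n f {T T₀} → Seq true w f → IsEmpty (f 0) → Weight w f ≡ n → Rep T f → Rep T₀ ∅s → Reach T₀ T n
  reach-upper zero f {T} {T₀} sq f0 wt rp rp₀ =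
    rep-unique {T₀} {T} {∅s} rp₀ (rep-cong {T} {f} {∅s} (weight-zero w f f0 wt) rp)
  reach-upper (suc n) f {T} {T₀} sq f0 wt rp rp₀ =
    reach-snoc n (reach-upper n f⁻ {tilingOf f⁻} {T₀} seq⁻ first⁻
        (suc-injective (trans (sym (Weight-bump w {f⁻} {f} {m} {k} m< same added)) wt)) (rep-tiling f⁻) rp₀)
      (box-flip {f⁻} {f} {m} {k} {tilingOf f⁻} {T} seq⁻ sq m< (rep-tiling f⁻) rp same added)
    where
    open Removable (removable-exists w f sq f0 (λ e → 0≢1+n (trans (sym e) wt)))

-- Tilings represented by sequences of partitions

pos-part : ∀ p z l l' k → pos p z l k ≡ pos p z l' k → part p l k ≡ part p l' k
pos-part true z l l' k e = sym (+-cancelˡ-≡ k _ _ (pos-true-≡ z k (col l k) k (col l' k) e))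
pos-part false z l l' k e = +-cancelˡ-≡ (suc k) _ _ (pos-false-≡ z (suc k) (row l k) (suc k) (row l' k) e)

part-ext : ∀ p {l l'} → (∀ k → part p l k ≡ part p l' k) → l ≈ l'
part-ext true {l} {l'} h = ≈-dual {dual l} {dual l'} h
part-ext false h = h

pos-shift : ∀ p z k l x → pos p (z ℤ.+ k) l x ≡ pos p z l x ℤ.+ k
pos-shift true z k l x = lem z k (+ x) (+ col l x)
  where
  lem : ∀ z k x a → z ℤ.+ k ℤ.+ x ℤ.- a ≡ z ℤ.+ x ℤ.- a ℤ.+ k
  lem = ℤS.solve-∀
pos-shift false z k l x = lem z k (+ suc x) (+ row l x)
  where
  lem : ∀ z k x a → z ℤ.+ k ℤ.- x ℤ.+ a ≡ z ℤ.- x ℤ.+ a ℤ.+ k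
  lem = ℤS.solve-∀

swapʳ : ∀ a b c → a ℤ.+ b ℤ.+ c ≡ a ℤ.+ c ℤ.+ b
swapʳ = ℤS.solve-∀

sub-add : ∀ n k → n ℤ.- k ℤ.+ k ≡ n
sub-add = ℤS.solve-∀

⊕-shift : ∀ n k b → (n ℤ.+ k) ⊕ b ≡ n ⊕ b ℤ.+ k
⊕-shift n k true = swapʳ n k (+ 1)
⊕-shift n k false = refl

module Represent (ℓ : ℕ) (1≤ℓ : 1 ≤ ℓ) (w : List Sign) (len : length w ≡ 2 * ℓ) where

  Rep : ℤ → Tiling → PartSeq → Set
  Rep = FlipSeq.Rep w

  Valid : PartSeq → Set
  Valid f = Seq true w f × IsEmpty (f 0)

  valid-∅ : Valid ∅s
  valid-∅ = seq-∅ true w , ≈-refl {∅}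

  tilingAt : PartSeq → Tiling
  tilingAt = FlipSeq.tilingOf w (+ 0)

  tilingAt-good : ∀ f → Valid f → Good ℓ w (tilingAt f)
  tilingAt-good f (sq , f0) = SeqEdges.tiling-good ℓ 1≤ℓ w len (+ 0) f sq f0

  represent : ∀ T → IsStripTiling ℓ T → HasAsymptoticData ℓ w T → (p : Pure ℓ T) → ∃ λ f → Valid f × Rep (proj₁ p) T f
  represent T st as p = parts , (parts-seq , ≈-refl {∅}) , strip-supported ℓ T st , edges≡
    where open Decompose ℓ 1≤ℓ w len (edge T) (good⇒edge ℓ w T len st as p)

  good-represent : ∀ T → Good ℓ w T → ∃ λ A → ∃ λ f → Valid f × Rep A T f
  good-represent T (st , _ , as , p) = proj₁ p , represent T st as p

  -- The charge is visible in the tiling: it is the least site of diagonal 0 that has an edge.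
  rep-charge : ∀ {A A' T f f'} → Valid f → Valid f' → Rep A T f → Rep A' T f' → A ≡ A'
  rep-charge {A} {A'} {T} {f} {f'} (sq , f0) (sq' , f0') (_ , e) (_ , e') =
    ℤP.≤-antisym (≤A A A' f f' (out-iff A f sq f0) (out-iff A' f' sq' f0') (λ n b → trans (sym (e' 0 n b)) (e 0 n b)))
                 (≤A A' A f' f (out-iff A' f' sq' f0') (out-iff A f sq f0) (λ n b → trans (sym (e 0 n b)) (e' 0 n b)))
    where
    Out : ℤ → PartSeq → ℤ → Set
    Out A f n = HasOut (Edges.edges w A f) 0 n
    out-iff : ∀ A f sq f0 n → Out A f n ⇔ A ℤ.≤ n
    out-iff A f sq f0 = SeqEdges.left' ℓ 1≤ℓ w len A f sq f0
    ≤A : ∀ A A' f f' → (∀ n → Out A f n ⇔ A ℤ.≤ n) → (∀ n → Out A' f' n ⇔ A' ℤ.≤ n) →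
      (∀ n b → Edges.edges w A' f' 0 n b ≡ Edges.edges w A f 0 n b) → A ℤ.≤ A'
    ≤A A A' f f' h h' same = let b , t = Equivalence.from (h' A') ℤP.≤-refl in
      Equivalence.to (h A') (b , trans (sym (same A' b)) t)

  -- Equal tails have the same edge in `T`, hence equal heads on the next diagonal; for a common
  -- charge the positions determine the parts.
  rep-parts : ∀ {A T f f'} → Valid f → Valid f' → Rep A T f → Rep A T f' → EqOn w f f'
  rep-parts {A} {T} {f} {f'} (sq , f0) (sq' , f0') (_ , e) (_ , e') = EqOn-from w go
    where
    module Eg = Edges w A
    go : ∀ m → m ≤ length w → f m ≈ f' m
    go zero _ = ≈-trans {f 0} {∅} {f' 0} f0 (≈-sym {f' 0} {∅} f0')
    go (suc m) m<L = part-ext (par m) {f (suc m)} {f' (suc m)} λ k → pos-part (par m) (A ℤ.+ + c w (suc m)) (f (suc m)) (f' (suc m)) k (heads k)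
      where
      tails : ∀ k → Eg.tailPos f m k ≡ Eg.tailPos f' m k
      tails k = pos-cong (par m) _ (f m) _ (f' m) k refl (part-cong (par m) {f m} {f' m} (go m (<⇒≤ m<L)) k)
      heads : ∀ k → Eg.headPos f m k ≡ Eg.headPos f' m k
      heads k with Eg.hop-exists f sq m m<L k
      ... | b , h with Eg.edges-sound f' m (Eg.tailPos f m k) b
              (trans (sym (e' m _ b)) (trans (e m _ b) (Eg.edges-complete f m _ b (m<L , k , refl , h))))
      ...   | _ , k' , t , h' with pos-inj (par m) (A ℤ.+ + c w m) (f' m) (trans (sym (tails k)) t)
      ...     | refl = trans (sym h) h'

  shift-supported : ∀ k T → Supported T → Supported (shift k T)
  shift-supported k T s o x y t with s o (x ℤ.- k) (y ℤ.- k) t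
  ... | m , n , b , e = m , n ℤ.+ k , b , trans (sym (cong₂ (λ x y → o , x , y) (sub-add x k) (sub-add y k))) (go m n b (x ℤ.- k) (y ℤ.- k) e)
    where
    go : ∀ m n b x y → (o , x , y) ≡ edgeDom m n b → (o , x ℤ.+ k , y ℤ.+ k) ≡ edgeDom m (n ℤ.+ k) b
    go m n true x y refl = cong (λ z → hor , n ℤ.+ k , z) (swapʳ n (ℤ.- (+ m)) k)
    go m n false x y refl = cong (λ z → ver , n ℤ.+ k , z) (swapʳ n (ℤ.- (+ suc m)) k)

  edge-shift : ∀ k T m n b → edge (shift k T) m n b ≡ edge T m (n ℤ.- k) b
  edge-shift k T m n true = cong (T hor (n ℤ.- k)) (swapʳ n (ℤ.- (+ m)) (ℤ.- k))
  edge-shift k T m n false = cong (T ver (n ℤ.- k)) (swapʳ n (ℤ.- (+ suc m)) (ℤ.- k))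

  rep-shift : ∀ k {A T f} → Rep A T f → Rep (A ℤ.+ k) (shift k T) f
  rep-shift k {A} {T} {f} (s , e) = shift-supported k T s , λ m n b →
    trans (edge-shift k T m n b) (trans (e m (n ℤ.- k) b) (bool-ext (to m n b) (from m n b)))
    where
    posn : ∀ p m m' x → pos p (A ℤ.+ k ℤ.+ + c w m) (f m') x ≡ pos p (A ℤ.+ + c w m) (f m') x ℤ.+ k
    posn p m m' x = trans (cong (λ z → pos p z (f m') x) (swapʳ A k (+ c w m))) (pos-shift p (A ℤ.+ + c w m) k (f m') x)
    to : ∀ m n b → Edges.edges w A f m (n ℤ.- k) b ≡ true → Edges.edges w (A ℤ.+ k) f m n b ≡ true
    to m n b t with Edges.edges-sound w A f m (n ℤ.- k) b t
    ... | lt , x , h , h' = Edges.edges-complete w (A ℤ.+ k) f m n b (lt , x ,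
          trans (sym (sub-add n k)) (trans (cong (ℤ._+ k) h) (sym (posn (par m) m m x))) ,
          trans (cong (_⊕ b) (sym (sub-add n k))) (trans (⊕-shift (n ℤ.- k) k b)
            (trans (cong (ℤ._+ k) h') (sym (posn (par m) (suc m) (suc m) x)))))
    from : ∀ m n b → Edges.edges w (A ℤ.+ k) f m n b ≡ true → Edges.edges w A f m (n ℤ.- k) b ≡ true
    from m n b t with Edges.edges-sound w (A ℤ.+ k) f m n b t
    ... | lt , x , h , h' = Edges.edges-complete w A f m (n ℤ.- k) b (lt , x ,
          trans (cong (ℤ._- k) (trans h (posn (par m) m m x))) (m+n-n _ k) ,
          trans (⊕-shift n (ℤ.- k) b) (trans (cong (ℤ._- k) (trans h' (posn (par m) (suc m) (suc m) x))) (m+n-n _ k)))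

  -- Flips keep the charge 0 of `T₀`, so a translate by `k` is reached only if `A + k` is 0, and it
  -- is then represented by `f` itself. Its weight is at most the number of flips, while removing
  -- boxes one by one gives a path of exactly this length.
  class-dist : ∀ {A T f T₀} → Valid f → Rep A T f → Rep (+ 0) T₀ ∅s → ClassDist T₀ T (Weight w f)
  class-dist {A} {T} {f} {T₀} (sq , f0) rp rp₀ = (ℤ.- A , upper) , lower
    where
    upper : Reach T₀ (shift (ℤ.- A) T) (Weight w f)
    upper = Distance.reach-upper w (+ 0) (Weight w f) f {shift (ℤ.- A) T} {T₀} sq f0 refl
      (subst (λ z → Rep z (shift (ℤ.- A) T) f) (ℤP.+-inverseʳ A) (rep-shift (ℤ.- A) {A} {T} {f} rp)) rp₀
    lower : ∀ m → m < Weight w f → ¬ ReachUpTo T₀ T m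
    lower m lt (k , r) with FlipForward.reach-lower w (+ 0) m {∅s} {T₀} {shift k T} (proj₁ valid-∅) (proj₂ valid-∅) rp₀ r
    ... | f' , sq' , f0' , rp' , wt with rep-shift k {A} {T} {f} rp
    ...   | rpk with rep-charge {A ℤ.+ k} {+ 0} {shift k T} {f} {f'} (sq , f0) (sq' , f0') rpk rp'
    ...     | e = <-irrefl refl (<-≤-trans lt (≤-trans (≤-reflexive (Weight-cong w
                (rep-parts {+ 0} {shift k T} {f} {f'} (sq , f0) (sq' , f0') (subst (λ z → Rep z (shift k T) f) e rpk) rp')))
                (≤-trans wt (≤-reflexive (cong (_+ m) (weight-∅ w))))))

  S⊎W : ∀ T n m b → CoveredBy T n (n ℤ.- + m) (dirE false b) → Occupied T n m
  S⊎W T n m true h = inj₁ h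
  S⊎W T n m false h = inj₂ (inj₁ h)

  -- Particles move on levels of odd index. On an odd diagonal they are tails of south- or
  -- west-going dominos, on a positive even one heads of such dominos, and on diagonal 0 they are
  -- the uncovered sites.
  occupied-particle : ∀ {A T f} → Valid f → Rep A T f → ∀ m → m ≤ length w → ∀ n →
    Occupied T n m ⇔ (∃ λ k → n ≡ pos false (A ℤ.+ + c w m) (f m) k)
  occupied-particle {A} {T} {f} (sq , f0) (sup , e) m m≤L n = mk⇔ to (λ (k , h) → from k h)
    where
    module Eg = Edges w A f
    sound : ∀ m n b → edge T m n b ≡ true → Eg.IsEdge m n b
    sound m n b t = Eg.edges-sound m n b (trans (sym (e m n b)) t)
    complete : ∀ m n b → Eg.IsEdge m n b → edge T m n b ≡ true
    complete m n b h = trans (e m n b) (Eg.edges-complete m n b h)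
    0<L : 0 < length w
    0<L = SeqEdges.0<L ℓ 1≤ℓ w len A f sq f0
    covered : ∀ b → CoveredBy T n (n ℤ.- + m) (dirE false b) → ∃ λ k → n ≡ pos false (A ℤ.+ + c w m) (f m) k
    covered b cb with coveredBy-inv sup m n false b cb
    ... | inj₁ (p , t) = let _ , k , h , _ = sound m n b t in k , trans h (cong (λ p → pos p (A ℤ.+ + c w m) (f m) k) (sym p))
    ... | inj₂ (m' , refl , p , n' , t , h) = let _ , k , _ , h' = sound m' n' b t in
            k , trans h (trans h' (cong (λ p → pos p (A ℤ.+ + c w m) (f m) k) (sym p)))
    to : Occupied T n m → ∃ λ k → n ≡ pos false (A ℤ.+ + c w m) (f m) k
    to (inj₁ h) = covered true h
    to (inj₂ (inj₁ h)) = covered false h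
    to (inj₂ (inj₂ (refl , h))) with pos-cover true (A ℤ.+ + c w 0) (f 0) n
    ... | inj₂ x = x
    ... | inj₁ (k , x) = let b , y = Eg.hop-exists sq 0 0<L k in
            ⊥-elim (h (forget {T} (covered-tail T 0 n b (complete 0 n b (0<L , k , x , trans (cong (_⊕ b) x) y)))))
    from : ∀ k → n ≡ pos false (A ℤ.+ + c w m) (f m) k → Occupied T n m
    from k h with par m in pm
    ... | false = let b , y = Eg.hop-exists sq m m<L k in
        S⊎W T n m b (subst (λ p → CoveredBy T n (n ℤ.- + m) (dirE p b)) pm
          (covered-tail T m n b (complete m n b (m<L , k , tail≡ , trans (cong (_⊕ b) tail≡) y))))
      where
      tail≡ : n ≡ Eg.tailPos m k
      tail≡ = trans h (cong (λ p → pos p (A ℤ.+ + c w m) (f m) k) (sym pm))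
      -- The last diagonal has even index, so an odd diagonal still has edges leaving it.
      m<L : m < length w
      m<L = ≤∧≢⇒< m≤L λ x → tf (trans (sym (par-double ℓ)) (trans (cong par (trans (sym len) (sym x))) pm))
        where
        tf : ¬ true ≡ false
        tf ()
    ... | true = go m m≤L pm h
      where
      go : ∀ m → m ≤ length w → par m ≡ true → n ≡ pos false (A ℤ.+ + c w m) (f m) k → Occupied T n m
      go zero _ _ h = inj₂ (inj₂ (refl , λ cv → out (covered-inv sup 0 n cv)))
        where
        out : ¬ (HasOut (edge T) 0 n ⊎ (∃ λ m' → 0 ≡ suc m' × HasIn (edge T) m' n))
        out (inj₁ (b , t)) = let _ , k' , h' , _ = sound 0 n b t in
          pos-excl true (A ℤ.+ + c w 0) (f 0) k' k (trans (sym h') h)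
      go (suc m) m<L pm h = let b , y = Eg.hop-exists sq m m<L k in
        S⊎W T n (suc m) b (subst₂ (λ z p → CoveredBy T z (z ℤ.- + suc m) (dirE p b)) (trans y head≡) pm'
          (covered-head T m (Eg.tailPos m k) b (complete m _ b (m<L , k , refl , y))))
        where
        pm' : par m ≡ false
        pm' = trans (sym (not-not (par m))) (cong not pm)
        head≡ : Eg.headPos m k ≡ n
        head≡ = trans (cong (λ p → pos p (A ℤ.+ + c w (suc m)) (f (suc m)) k) pm') (sym h)

  minimal : ∀ {T} → Rep (+ 0) T ∅s → ∀ m → m ≤ 2 * ℓ → ∀ n → Occupied T n m ⇔ n ℤ.< + c w m
  minimal {T} rp m h n = mk⇔
      (λ o → let k , e = Equivalence.to occ o in subst (ℤ._< + c w m) (sym (trans e (pos-∅ k))) (below k))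
      (λ lt → let k , e = ≤⇒+ (ℤP.i<j⇒suc[i]≤j lt) in Equivalence.from occ (k , sym (trans (pos-∅ k)
        (trans (cong (λ z → z ℤ.- + suc k) e) (trans (cong (λ z → ℤ.suc n ℤ.+ + k ℤ.- z) (+suc k)) (lem n (+ k)))))))
    where
    occ = occupied-particle {+ 0} {T} {∅s} valid-∅ rp m (≤-trans h (≤-reflexive (sym len))) n
    lem : ∀ n k → + 1 ℤ.+ n ℤ.+ k ℤ.- (k ℤ.+ + 1) ≡ n
    lem = ℤS.solve-∀
    pos-∅ : ∀ k → pos false (+ 0 ℤ.+ + c w m) ∅ k ≡ + c w m ℤ.- + suc k
    pos-∅ k = trans (ℤP.+-identityʳ (+ 0 ℤ.+ + c w m ℤ.- + suc k)) (cong (ℤ._- + suc k) (ℤP.+-identityˡ (+ c w m)))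
    below : ∀ k → + c w m ℤ.- + suc k ℤ.< + c w m
    below k = subst (+ c w m ℤ.- + suc k ℤ.<_) (ℤP.+-identityʳ (+ c w m)) (ℤP.+-monoʳ-< (+ c w m) { -[1+ k ]} {+ 0} ℤ.-<+)

  min-tiling : Σ Tiling (IsMinTiling ℓ w)
  min-tiling = tilingAt ∅s , let st , sp , as , _ = tilingAt-good ∅s valid-∅ in
    st , sp , as , minimal {tilingAt ∅s} (FlipSeq.rep-tiling w (+ 0) ∅s)

  -- Purity is read off from the occupied sites of the two boundary diagonals. On the first one
  -- covered means empty, and `c w 0` is 0; on the last one covered means occupied, which gives the
  -- last covered site `c w (2 * ℓ) - 1`.
  min-pure : ∀ T → IsMinTiling ℓ w T → Σ (Pure ℓ T) λ p → proj₁ p ≡ + 0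
  min-pure T (st@(_ , _ , strip) , _ , _ , occ) = (+ 0 , + c w (2 * ℓ) ℤ.- + 1 , λ n →
      mk⇔ (λ cv → nonneg n (covered-inv sup 0 n (subst (Covered T n) (sym (n-0 n)) cv))) (λ h → subst (Covered T n) (n-0 n) (diag n h)) ,
      mk⇔ (λ cv → upper n (covered-inv sup (2 * ℓ) n cv)) (λ h → anti n (Equivalence.from (occ (2 * ℓ) ≤-refl n) (<-from n h)))) , refl
    where
    sup = strip-supported ℓ T st
    C = + c w (2 * ℓ)
    nonneg : ∀ n → HasOut (edge T) 0 n ⊎ (∃ λ m' → 0 ≡ suc m' × HasIn (edge T) m' n) → + 0 ℤ.≤ n
    nonneg n (inj₁ (b , t)) = ℤP.≮⇒≥ λ lt → bad (Equivalence.from (occ 0 z≤n n) lt)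
      where
      notSW : ∀ b → ¬ CoveredBy T n (n ℤ.- + 0) (dirE false b)
      notSW b cb with coveredBy-inv sup 0 n false b cb
      ... | inj₁ (() , _)
      bad : ¬ Occupied T n 0
      bad (inj₁ cb) = notSW true cb
      bad (inj₂ (inj₁ cb)) = notSW false cb
      bad (inj₂ (inj₂ (_ , nc))) = nc (forget {T} (covered-tail T 0 n b t))
    diag : ∀ n → + 0 ℤ.≤ n → Covered T n (n ℤ.- + 0)
    diag n h with edge T 0 n true in e₁ | edge T 0 n false in e₂
    ... | true | _ = forget {T} (covered-tail T 0 n true e₁)
    ... | false | true = forget {T} (covered-tail T 0 n false e₂)
    ... | false | false = ⊥-elim (ℤP.<-irrefl refl (ℤP.<-≤-trans (Equivalence.to (occ 0 z≤n n)
            (inj₂ (inj₂ (refl , λ cv → none (covered-inv sup 0 n cv))))) h))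
      where
      none : ¬ (HasOut (edge T) 0 n ⊎ (∃ λ m' → 0 ≡ suc m' × HasIn (edge T) m' n))
      none (inj₁ (true , t)) with trans (sym t) e₁
      ... | ()
      none (inj₁ (false , t)) with trans (sym t) e₂
      ... | ()
    pred≤ : ∀ n → n ℤ.< C → n ℤ.≤ C ℤ.- + 1
    pred≤ n h = ≤-from (ℤP.i<j⇒suc[i]≤j h) (lem n C)
      where
      lem : ∀ n C → n ℤ.+ C ≡ C ℤ.- + 1 ℤ.+ (+ 1 ℤ.+ n)
      lem = ℤS.solve-∀
    <-from : ∀ n → n ℤ.≤ C ℤ.- + 1 → n ℤ.< C
    <-from n h = ℤP.≤-<-trans h (subst (C ℤ.- + 1 ℤ.<_) (ℤP.+-identityʳ C) (ℤP.+-monoʳ-< C { -[1+ 0 ]} {+ 0} ℤ.-<+))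
    upper : ∀ n → HasOut (edge T) (2 * ℓ) n ⊎ (∃ λ m' → 2 * ℓ ≡ suc m' × HasIn (edge T) m' n) → n ℤ.≤ C ℤ.- + 1
    upper n (inj₁ (b , t)) = ⊥-elim (<-irrefl refl (+-lin (subst (ℤ._≤ + (2 * ℓ)) (n-[n-m] (n ⊕ b) (+ suc (2 * ℓ)))
      (proj₂ (strip _ _ (forget {T} (covered-head T (2 * ℓ) n b t)))))))
    upper n (inj₂ (m' , e , n' , b , t , refl)) = pred≤ n (Equivalence.to (occ (2 * ℓ) ≤-refl n)
        (S⊎W T n (2 * ℓ) b (subst₂ (λ m p → CoveredBy T n (n ℤ.- + m) (dirE p b)) (sym e) pm (covered-head T m' n' b t))))
      where
      pm : par m' ≡ false
      pm = par-last ℓ (sym e)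
    anti : ∀ n → Occupied T n (2 * ℓ) → Covered T n (n ℤ.- + (2 * ℓ))
    anti n (inj₁ cb) = forget {T} cb
    anti n (inj₂ (inj₁ cb)) = forget {T} cb
    anti n (inj₂ (inj₂ (e , _))) = ⊥-elim (<-irrefl (sym e) (≤-trans 1≤ℓ (m≤m+n ℓ _)))

  -- The first particle sits at the charge minus 1 plus the first part; that it lies to the left of
  -- the charge leaves no room for a box.
  min-empty : ∀ T f → IsMinTiling ℓ w T → Valid f → Rep (+ 0) T f → EqOn w f ∅s
  min-empty T f (_ , _ , _ , occ) v rp = EqOn-from w λ m h → empty-from-first (f m) (first m h)
    where
    lem : ∀ c r → + 1 ℤ.- c ℤ.+ (+ 0 ℤ.+ c ℤ.- + 1 ℤ.+ r) ≡ r
    lem = ℤS.solve-∀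
    lem' : ∀ c → + 1 ℤ.- c ℤ.+ c ≡ + 1
    lem' = ℤS.solve-∀
    first : ∀ m → m ≤ length w → row (f m) 0 ≡ 0
    first m h = n≤0⇒n≡0 (≤-pred (ℤP.drop‿+<+ (subst₂ ℤ._<_ (lem (+ c w m) (+ row (f m) 0)) (lem' (+ c w m))
        (ℤP.+-monoʳ-< (+ 1 ℤ.- + c w m) lt))))
      where
      lt : pos false (+ 0 ℤ.+ + c w m) (f m) 0 ℤ.< + c w m
      lt = Equivalence.to (occ m (≤-trans h (≤-reflexive len)) _)
        (Equivalence.from (occupied-particle {+ 0} {T} {f} v rp m h (pos false (+ 0 ℤ.+ + c w m) (f m) 0)) (0 , refl))

  min-represent : ∀ T → IsMinTiling ℓ w T → Rep (+ 0) T ∅s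
  min-represent T mt = empty (represent T (proj₁ mt) (proj₁ (proj₂ (proj₂ mt))) (proj₁ (min-pure T mt)))
    where
    empty : (∃ λ f → Valid f × Rep (proj₁ (proj₁ (min-pure T mt))) T f) → Rep (+ 0) T ∅s
    empty (f , v , rp) = Distance.rep-cong w (+ 0) {T} {f} {∅s} (min-empty T f mt v rp₀) rp₀
      where
      rp₀ : Rep (+ 0) T f
      rp₀ = subst (λ z → Rep z T f) (proj₂ (min-pure T mt)) rp

-- Counting translation classes

class-dist-unique : ∀ {T₀ T n n'} → ClassDist T₀ T n → ClassDist T₀ T n' → n ≡ n'
class-dist-unique {n = n} {n'} (r , h) (r' , h') with <-cmp n n'
... | tri< lt _ _ = ⊥-elim (h' n lt r)
... | tri≈ _ e _ = e
... | tri> _ _ lt = ⊥-elim (h n' lt r')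

-- The number `K` is kept abstract, so that passing from sequences to tilings is independent of the
-- product formula.
record SeqEnum (w : List Sign) (n K : ℕ) : Set where
  field
    seqOf : Fin K → PartSeq
    valid : ∀ i → Seq true w (seqOf i) × IsEmpty (seqOf i 0)
    weight : ∀ i → Weight w (seqOf i) ≡ n
    separate : ∀ i j → EqOn w (seqOf i) (seqOf j) → i ≡ j
    exhaust : ∀ f → Seq true w f × IsEmpty (f 0) → Weight w f ≡ n → ∃ λ i → EqOn w f (seqOf i)

seq-enum : ∀ w n → SeqEnum w n (productFormula w n)
seq-enum w n = record
  { seqOf = λ i → proj₁ (decode w (elem en n i))
  ; valid = λ i → proj₁ (proj₂ (decode w (elem en n i))) , proj₁ (proj₂ (proj₂ (decode w (elem en n i))))
  ; weight = λ i → trans (coded-weight w (coded i)) (elem-wt en n i)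
  ; separate = λ i j h → elem-inj en n i j (coded-uniq w (coded i) (coded j) h)
  ; exhaust = λ f (sq , f0) wt → found f (encode w f sq f0) wt }
  where
  en = enum-product w
  coded : ∀ i → Coded w (proj₁ (decode w (elem en n i))) (elem en n i)
  coded i = proj₂ (proj₂ (proj₂ (decode w (elem en n i))))
  found : ∀ f → ∃ (Coded w f) → Weight w f ≡ n → ∃ λ i → EqOn w f (proj₁ (decode w (elem en n i)))
  found f (xs , cf) wt with elem-surj en n xs (trans (sym (coded-weight w cf)) wt)
  ... | i , refl = i , coded-inj w cf (coded i)

module Classes (ℓ : ℕ) (1≤ℓ : 1 ≤ ℓ) (w : List Sign) (len : length w ≡ 2 * ℓ)
    (Tmin : Tiling) (mt : IsMinTiling ℓ w Tmin) where
  open Represent ℓ 1≤ℓ w len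

  dist : ∀ {A T f} → Valid f → Rep A T f → ClassDist Tmin T (Weight w f)
  dist {A} {T} {f} v rp = class-dist {A} {T} {f} {Tmin} v rp (min-represent Tmin mt)

  has-dist : ∀ T → Good ℓ w T → ∃ (ClassDist Tmin T)
  has-dist T g = go (good-represent T g)
    where
    go : (∃ λ A → ∃ λ f → Valid f × Rep A T f) → ∃ (ClassDist Tmin T)
    go (A , f , v , rp) = Weight w f , dist {A} {T} {f} v rp

  module _ (n K : ℕ) (en : SeqEnum w n K) where
    open SeqEnum en

    tiling : Fin K → Tiling
    tiling i = tilingAt (seqOf i)

    rep : ∀ i → Rep (+ 0) (tiling i) (seqOf i)
    rep i = FlipSeq.rep-tiling w (+ 0) (seqOf i)

    tiling-dist : ∀ i → ClassDist Tmin (tiling i) n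
    tiling-dist i = subst (ClassDist Tmin (tiling i)) (weight i) (dist {+ 0} {tiling i} {seqOf i} (valid i) (rep i))

    -- A translate by `k` has charge `k`, and all representatives have charge 0. So `k` is 0 and the
    -- two sequences agree.
    tiling-inj : ∀ i j → tiling i ∼ tiling j → i ≡ j
    tiling-inj i j (k , h) = separate i j
        (rep-parts {+ 0 ℤ.+ k} {T'} {seqOf i} {seqOf j} (valid i) (valid j) rpᵢ (subst (λ z → Rep z T' (seqOf j)) (sym e) rpⱼ))
      where
      T' = shift k (tiling i)
      rpᵢ : Rep (+ 0 ℤ.+ k) T' (seqOf i)
      rpᵢ = rep-shift k {+ 0} {tiling i} {seqOf i} (rep i)
      rpⱼ : Rep (+ 0) T' (seqOf j)
      rpⱼ = FlipSeq.rep-ext w (+ 0) {tiling j} {T'} {seqOf j} h (rep j)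
      e : + 0 ℤ.+ k ≡ + 0
      e = rep-charge {+ 0 ℤ.+ k} {+ 0} {T'} {seqOf i} {seqOf j} (valid i) (valid j) rpᵢ rpⱼ

    tiling-surj : ∀ T → Good ℓ w T → ClassDist Tmin T n → ∃ λ i → T ∼ tiling i
    tiling-surj T g cd = go (good-represent T g)
      where
      go : (∃ λ A → ∃ λ f → Valid f × Rep A T f) → ∃ λ i → T ∼ tiling i
      go (A , f , v , rp) = proj₁ ex , ℤ.- A ,
          Distance.rep-unique w (+ 0) {tiling (proj₁ ex)} {shift (ℤ.- A) T} {seqOf (proj₁ ex)} (rep (proj₁ ex))
            (Distance.rep-cong w (+ 0) {shift (ℤ.- A) T} {f} {seqOf (proj₁ ex)} (proj₂ ex) rp₀)
        where
        rp₀ : Rep (+ 0) (shift (ℤ.- A) T) f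
        rp₀ = subst (λ z → Rep z (shift (ℤ.- A) T) f) (ℤP.+-inverseʳ A) (rep-shift (ℤ.- A) {A} {T} {f} rp)
        ex : ∃ λ i → EqOn w f (seqOf i)
        ex = exhaust f v (class-dist-unique {Tmin} {T} (dist {A} {T} {f} v rp) cd)

theorem2 : (ℓ : ℕ) → 1 ≤ ℓ → (w : List Sign) → length w ≡ 2 * ℓ →
    Σ Tiling (IsMinTiling ℓ w) ×
    ((Tmin : Tiling) → IsMinTiling ℓ w Tmin →
      ((T : Tiling) → Good ℓ w T → ∃ λ n → ClassDist Tmin T n) ×
      ((n : ℕ) →
        Σ (Fin (productFormula w n) → Tiling) λ f →
          ((i : Fin (productFormula w n)) → Good ℓ w (f i) × ClassDist Tmin (f i) n) ×
          ((i j : Fin (productFormula w n)) → f i ∼ f j → i ≡ j) ×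
          ((T : Tiling) → Good ℓ w T → ClassDist Tmin T n →
            ∃ λ i → T ∼ f i)))
theorem2 ℓ 1≤ℓ w len = Represent.min-tiling ℓ 1≤ℓ w len , λ Tmin mt →
  let open Classes ℓ 1≤ℓ w len Tmin mt in
  has-dist , λ n →
    let en = seq-enum w n in
    tiling n (productFormula w n) en ,
    (λ i → Represent.tilingAt-good ℓ 1≤ℓ w len (SeqEnum.seqOf en i) (SeqEnum.valid en i) , tiling-dist n (productFormula w n) en i) ,
    tiling-inj n (productFormula w n) en ,
    tiling-surj n (productFormula w n) en
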